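{- For every $\delta>0$ there is an $n_0$ such that the following holds for every fair complete $k$-partite graph $G$ on $n>n_0$ vertices, with $k\ge 2$. If the edges of $G$ are coloured red and blue, and the colouring is not $\delta$-close to a split colouring, then there are two vertex-disjoint monochromatic cycles of distinct colours which together cover all but at most $\delta n$ vertices of $G$.
   Context: A complete $k$-partite graph has $k$ non-empty partition classes, with two vertices adjacent iff they lie in distinct classes. A multipartite graph on $n$ vertices is fair if no partition class contains more than $n/2$ vertices. A colouring is any assignment of red/blue to the edges. For a bipartite graph $H$ with partition classes $U,V$, a red/blue colouring of $E(H)$ is a split colouring if there are partitions $U=A\cup B$ and $V=C\cup D$ such that all edges of $H$ between $A$ and $C$ and between $B$ and $D$ are blue, and all edges of $H$ between $A$ and $D$ and between $B$ and $C$ are red. A colouring of the edges of a complete multipartite graph $G$ is $\delta$-close to a split colouring if by deleting at most $\delta|E(G)|$ edges one can make $G$ bipartite and the (restricted) colouring a split colouring. A cycle is allowed to consist of a single vertex or a single edge, or to be empty. -}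

module Defs where

open import Data.Bool using (Bool; true; false; if_then_else_)
open import Data.Nat as ℕ using (ℕ; zero; suc; _<ᵇ_)
open import Data.Integer using (+_)
open import Data.Rational using (ℚ; _/_; _*_; _≤_)
open import Data.Fin using (Fin; toℕ; _≟_)
open import Data.List using (List; []; _∷_; length; filter; filterᵇ; allFin; _++_; map)
open import Data.Nat.ListAction using (sum)
open import Data.List.Relation.Unary.Unique.Propositional using (Unique)
open import Data.List.Membership.Propositional using (_∈_; _∉_)
open import Data.List.Relation.Unary.Any using (any?)
open import Relation.Nullary.Decidable using (¬?)
open import Data.Product using (Σ; _×_; _,_; ∃)
open import Data.Sum using (_⊎_)
open import Data.Unit using (⊤)
open import Relation.Binary.PropositionalEquality using (_≡_; _≢_)
open import Relation.Nullary using (¬_; does)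
open import Relation.Nullary.Decidable using (⌊_⌋)

ℕtoℚ : ℕ → ℚ
ℕtoℚ m = + m / 1

data Colour : Set where
  red blue : Colour

-- A complete multipartite graph on vertex set Fin n is given by a
-- map  part : Fin n → Fin k  assigning each vertex its partition class;
-- u and v are adjacent iff they lie in distinct classes.

Adj : ∀ {n k} → (Fin n → Fin k) → Fin n → Fin n → Set
Adj part u v = part u ≢ part v

adjᵇ : ∀ {n k} → (Fin n → Fin k) → Fin n → Fin n → Bool
adjᵇ part u v = if ⌊ part u ≟ part v ⌋ then false else true

AllClassesNonEmpty : ∀ {n k} → (Fin n → Fin k) → Set
AllClassesNonEmpty {n} {k} part = (i : Fin k) → ∃ λ (v : Fin n) → part v ≡ i

classSize : ∀ {n k} → (Fin n → Fin k) → Fin k → ℕ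
classSize {n} part i = length (filter (λ v → part v ≟ i) (allFin n))

Fair : ∀ {n k} → (Fin n → Fin k) → Set
Fair {n} {k} part = (i : Fin k) → 2 ℕ.* classSize part i ℕ.≤ n

countPairs : ∀ {n} → (Fin n → Fin n → Bool) → ℕ
countPairs {n} p =
  sum (map (λ u → length (filterᵇ (λ v → if toℕ u <ᵇ toℕ v then p u v else false)
                                  (allFin n)))
           (allFin n))

numEdges : ∀ {n k} → (Fin n → Fin k) → ℕ
numEdges part = countPairs (adjᵇ part)

-- A colouring: colour of edge uv is col u v (symmetry required
-- separately; values on non-edges are irrelevant).

Symmetric : ∀ {n} → (Fin n → Fin n → Colour) → Set
Symmetric {n} col = (u v : Fin n) → col u v ≡ col v u

-- Split-colouring condition for the edge uv of the bipartite graph H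
-- with bipartition U = {side = false}, V = {side = true}, where
-- A = U ∩ {sub = false}, B = U ∩ {sub = true},
-- C = V ∩ {sub = false}, D = V ∩ {sub = true}:
-- A–C and B–D edges blue, A–D and B–C edges red.
splitColour : Bool → Bool → Colour
splitColour false false = blue
splitColour true  true  = blue
splitColour false true  = red
splitColour true  false = red

-- δ-close to a split colouring: there is a set of edges (del u v ≡ true
-- for the unordered pair {u,v}, read at toℕ u < toℕ v) of size at most
-- δ|E(G)| whose deletion leaves a bipartite graph H, with bipartition
-- (side), whose restricted colouring is split (with sub-partition sub).
DeltaClose : ∀ {n k} → ℚ → (Fin n → Fin k) → (Fin n → Fin n → Colour) → Set
DeltaClose {n} δ part col =
  Σ (Fin n → Fin n → Bool) λ del →
    (ℕtoℚ (countPairs (λ u v → if adjᵇ part u v then del u v else false))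
       ≤ δ * ℕtoℚ (numEdges part))
  × Σ (Fin n → Bool) λ side → Σ (Fin n → Bool) λ sub →
      ((u v : Fin n) → toℕ u ℕ.< toℕ v → Adj part u v → del u v ≡ false →
         (side u ≢ side v) × (col u v ≡ splitColour (sub u) (sub v)))

-- Monochromatic cycles, given as lists of distinct vertices
-- v₀ v₁ … v_{m-1}.  The empty list, a single vertex, and a single edge
-- (m = 2) are cycles.  For m ≥ 2 consecutive vertices and v_{m-1}v₀
-- must be edges of G of colour c (for m = 2 this is the single edge).

MonoEdge : ∀ {n k} → (Fin n → Fin k) → (Fin n → Fin n → Colour) → Colour
         → Fin n → Fin n → Set
MonoEdge part col c u v = Adj part u v × col u v ≡ c

ClosedWalkFrom : ∀ {n k} → (Fin n → Fin k) → (Fin n → Fin n → Colour) → Colour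
               → Fin n → Fin n → List (Fin n) → Set
ClosedWalkFrom part col c v₀ u []       = MonoEdge part col c u v₀
ClosedWalkFrom part col c v₀ u (w ∷ ws) = MonoEdge part col c u w × ClosedWalkFrom part col c v₀ w ws

CycleShape : ∀ {n k} → (Fin n → Fin k) → (Fin n → Fin n → Colour) → Colour
           → List (Fin n) → Set
CycleShape part col c []            = ⊤
CycleShape part col c (v ∷ [])      = ⊤
CycleShape part col c (v ∷ w ∷ ws)  = ClosedWalkFrom part col c v v (w ∷ ws)

MonoCycle : ∀ {n k} → (Fin n → Fin k) → (Fin n → Fin n → Colour) → Colour
          → List (Fin n) → Set
MonoCycle part col c xs = Unique xs × CycleShape part col c xs

Disjoint : ∀ {n} → List (Fin n) → List (Fin n) → Set
Disjoint xs ys = ∀ v → v ∈ xs → v ∉ ys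

uncovered : ∀ {n} → List (Fin n) → ℕ
uncovered {n} xs = length (filter (λ v → ¬? (any? (λ x → v ≟ x) xs)) (allFin n))

{-# OPTIONS --safe #-}
-- Components.  For each colour, split the vertex set along linear cuts with few edges of that
-- colour, as long as there are any.  The boundedly many classes that remain are robust
-- components, and few edges of the colour run between them.  The partition classes are bundled
-- into boundedly many groups, again losing few edges.  Once the vertices in small cells (group,
-- red component, blue component) are deleted, any two cells share a coordinate, since otherwise
-- too many edges would run between components.  Hence either one colour has a single component,
-- or some red component and some blue component cover all vertices and those not in both lie
-- in one group, or the colouring is close to a split colouring.
--
-- Matching.  In the first two cases there are a red component r, a blue component b (the
-- majority one if r is everything) and a perfect matching such that between the types of matched
-- vertices almost every edge is red inside r or blue inside b.  Boundedly many types suffice, as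
-- the partitions to be avoided can first be merged into three parts of at most half size.
--
-- Paths.  Depth-first search in red between two matched types leaves a red path and two
-- balanced holes without red edges; searching these in blue leaves blue paths and holes
-- without usable edges, which are small.
--
-- Cycles.  The boundedly many paths of a colour are linked through reserved hubs: connected
-- sets of bounded size that dominate almost all of the component.  A hub is grown from a vertex
-- of linear degree, because every linear cut of the component is dense; a component without
-- such a vertex has too few edges to matter.
module Submission where

open import Defs
open import Data.Nat using (ℕ; _<_; _≤_)
open import Data.Fin using (Fin)
open import Data.List using (List; _++_)
open import Data.Product using (Σ; _×_)
open import Relation.Nullary using (¬_)

-- Only the types of a matched pair matter: if `u`, `v` and `u′`, `v′` are matched with the same
-- types, then `u` and `v′` are as good as a matched pair. So all pairs with the same types form two
-- equally large sides to which the search applies, and no regularity lemma is needed. This is why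
-- the matching has to avoid partitions with boundedly many parts. Reserved hub vertices are not
-- taken out of the matching. They merely lose their usable edges, so no path of the search meets
-- them and they end up in the holes, whose size is bounded through the number of unusable edges.
-- Likewise, the paths have even length because a single vertex need not see any hub, whereas both
-- ends of a usable edge see all of them. Each constant must dominate the earlier ones: number of
-- type pairs, hole size, the threshold `n / z` for linear sets, cell size, cut density. Hub sizes
-- depend on `h`, so `n₀` comes last. Fractions are cleared everywhere, `z * a ≤ n` standing for
-- `a ≤ n / z`, and edges are counted as ordered pairs until the comparison with `numEdges`.

module _ where

  import Algebra.Solver.CommutativeMonoid as CMSolver
  open import Data.Bool using (Bool; true; false; if_then_else_)
  import Data.Bool as Bool
  open import Data.Bool.Properties using (T?) renaming (_≟_ to _≟ᴮ_)
  open import Data.Empty using (⊥; ⊥-elim)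
  open import Data.Fin using (zero; suc; toℕ)
  import Data.Fin as Fin
  import Data.Fin.Properties as Fin
  open import Data.Fin.Subset using (Subset) renaming (_∈_ to _∈ˢ_)
  open import Data.Fin.Subset.Properties using (anySubset?) renaming (_∈?_ to _∈ˢ?_)
  import Data.Integer as ℤ
  import Data.Integer.Properties as ℤ
  open import Data.List using ([]; _∷_; length; filter; map; concat; allFin; filterᵇ; cartesianProduct)
  open import Data.List.Properties using (length-++; ++-assoc; ++-identityʳ; length-map; length-tabulate; filter-++; map-++)
  open import Data.List.Membership.Propositional using (_∈_; _∉_; find; lose)
  open import Data.List.Membership.Propositional.Properties
    using (∈-∃++; ∈-++⁺ˡ; ∈-++⁺ʳ; ∈-++⁻; ∈-filter⁻; ∈-allFin; ∈-map⁻; ∈-cartesianProduct⁺)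
  open import Data.List.Relation.Unary.All as All using (All; []; _∷_)
  open import Data.List.Relation.Unary.All.Properties using (¬All⇒Any¬) renaming (++⁺ to All-++⁺)
  open import Data.List.Relation.Unary.AllPairs using ([]; _∷_)
  open import Data.List.Relation.Unary.Any using (Any; here; there; any?)
  open import Data.List.Relation.Unary.Unique.Propositional using (Unique)
  open import Data.List.Relation.Unary.Unique.Propositional.Properties using (allFin⁺; filter⁺) renaming (++⁺ to Unique-++⁺)
  open import Data.List.Relation.Binary.Permutation.Propositional
    using (_↭_; refl; prep; swap; ↭-refl; ↭-sym; ↭-reflexive; ↭⇒↭ₛ) renaming (trans to ↭trans)
  open import Data.List.Relation.Binary.Permutation.Propositional.Properties
    using (shift; shifts; ∈-resp-↭; ↭-length; ++⁺; ++⁺ˡ; ++⁺ʳ; ++-commutativeMonoid; filter-↭) renaming (map⁺ to ↭-map⁺)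
  import Data.List.Relation.Binary.Permutation.Setoid.Properties as PermSetoid
  open import Data.Maybe using (Maybe; just; nothing)
  open import Data.Maybe.Properties using (just-injective)
  import Data.Maybe.Properties as Maybe
  open import Data.Nat
  open import Data.Nat.DivMod using (m≡m%n+[m/n]*n; m%n<n; m<n*o⇒m/o<n; m/n*n≤m; m*n/n≡m; /-monoˡ-≤)
  open import Data.Nat.ListAction using (sum)
  open import Data.Nat.Properties
  open import Data.Nat.Tactic.RingSolver using (solve-∀)
  open import Data.Product using (∃; ∃₂; _,_; proj₁; proj₂)
  open import Data.Product.Properties using (≡-dec)
  open import Data.Rational using (ℚ; mkℚ; Positive; toℚᵘ) renaming (_*_ to _*ℚ_; _≤_ to _≤ℚ_)
  import Data.Rational.Properties as ℚ
  import Data.Rational.Unnormalised as ℚᵘ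
  import Data.Rational.Unnormalised.Properties as ℚᵘ
  open import Data.Sum using (_⊎_; inj₁; inj₂)
  open import Data.Unit using (tt)
  open import Data.Vec using (tabulate)
  open import Data.Vec.Properties using (lookup∘tabulate; []=⇒lookup; lookup⇒[]=)
  open import Function using (_∘_)
  open import Relation.Binary using (DecidableEquality; tri<; tri≈; tri>)
  open import Relation.Binary.PropositionalEquality hiding ([_])
  open import Relation.Binary.PropositionalEquality.Properties using () renaming (setoid to ≡-setoid)
  open import Relation.Nullary hiding (¬_)
  open import Relation.Nullary.Decidable using (¬?; _×-dec_; _⊎-dec_)
  open import Relation.Unary using (Pred; Decidable)

  -- Finite sums and counting

  -- Linear arithmetic by certificate: the inequality l ≤ r is a sum of hypotheses, s the slack.
  lin : ∀ {a b l r} s → l ≤ r → a + r + s ≡ b + l → a ≤ b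
  lin {a} {b} {l} {r} s l≤r eq = +-cancelʳ-≤ r a b (begin
    a + r     ≤⟨ m≤m+n (a + r) s ⟩
    a + r + s ≡⟨ eq ⟩
    b + l     ≤⟨ +-monoʳ-≤ b l≤r ⟩
    b + r     ∎)
    where open ≤-Reasoning

  *-zero-≤ : ∀ z {a b} → a ≡ 0 → z * a ≤ b
  *-zero-≤ z refl = ≤-trans (≤-reflexive (*-zeroʳ z)) z≤n

  ind : ∀ {p} {P : Set p} → Dec P → ℕ
  ind d = if does d then 1 else 0

  ind≤1 : ∀ {p} {P : Set p} (d : Dec P) → ind d ≤ 1
  ind≤1 (yes _) = ≤-refl
  ind≤1 (no _)  = z≤n

  ind-yes : ∀ {p} {P : Set p} (d : Dec P) → P → ind d ≡ 1
  ind-yes (yes _) _ = refl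
  ind-yes (no ¬p) p = ⊥-elim (¬p p)

  ind-no : ∀ {p} {P : Set p} (d : Dec P) → ¬ P → ind d ≡ 0
  ind-no (yes p) ¬p = ⊥-elim (¬p p)
  ind-no (no _)  _  = refl

  ind-mono : ∀ {p q} {P : Set p} {Q : Set q} (d : Dec P) (e : Dec Q) → (P → Q) → ind d ≤ ind e
  ind-mono (no _)  e f = z≤n
  ind-mono (yes p) e f = ≤-reflexive (sym (ind-yes e (f p)))

  ind-⊎ : ∀ {p q r} {P : Set p} {Q : Set q} {R : Set r} (d : Dec P) (e : Dec Q) (f : Dec R) →
          (P → Q ⊎ R) → ind d ≤ ind e + ind f
  ind-⊎ (no _)  e f g = z≤n
  ind-⊎ (yes p) e f g with g p
  ... | inj₁ q = ≤-trans (≤-reflexive (sym (ind-yes e q))) (m≤m+n _ _)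
  ... | inj₂ r = ≤-trans (≤-reflexive (sym (ind-yes f r))) (m≤n+m _ _)

  ind-¬ : ∀ {p} {P : Set p} (d : Dec P) → ind d + ind (¬? d) ≡ 1
  ind-¬ (yes _) = refl
  ind-¬ (no _)  = refl

  ind-× : ∀ {p q} {P : Set p} {Q : Set q} (d : Dec P) (e : Dec Q) → ind (d ×-dec e) ≡ ind d * ind e
  ind-× (no _)  e       = refl
  ind-× (yes _) (yes _) = refl
  ind-× (yes _) (no _)  = refl

  module _ {A : Set} where

    ∑ : (A → ℕ) → List A → ℕ
    ∑ f []       = 0
    ∑ f (x ∷ xs) = f x + ∑ f xs

    ∑-mono : ∀ {f g : A → ℕ} xs → (∀ {x} → x ∈ xs → f x ≤ g x) → ∑ f xs ≤ ∑ g xs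
    ∑-mono []       f≤g = z≤n
    ∑-mono (x ∷ xs) f≤g = +-mono-≤ (f≤g (here refl)) (∑-mono xs (f≤g ∘ there))

    ∑-cong : ∀ {f g : A → ℕ} xs → (∀ x → f x ≡ g x) → ∑ f xs ≡ ∑ g xs
    ∑-cong []       f≡g = refl
    ∑-cong (x ∷ xs) f≡g = cong₂ _+_ (f≡g x) (∑-cong xs f≡g)

    ∑-+ : ∀ (f g : A → ℕ) xs → ∑ (λ x → f x + g x) xs ≡ ∑ f xs + ∑ g xs
    ∑-+ f g []       = refl
    ∑-+ f g (x ∷ xs) rewrite ∑-+ f g xs = eq (f x) (g x) (∑ f xs) (∑ g xs)
      where
      eq : ∀ a b c d → a + b + (c + d) ≡ a + c + (b + d)
      eq = solve-∀

    ∑-* : ∀ c (f : A → ℕ) xs → ∑ (λ x → c * f x) xs ≡ c * ∑ f xs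
    ∑-* c f []       = sym (*-zeroʳ c)
    ∑-* c f (x ∷ xs) rewrite ∑-* c f xs = sym (*-distribˡ-+ c (f x) (∑ f xs))

    ∑-const : ∀ c (xs : List A) → ∑ (λ _ → c) xs ≡ length xs * c
    ∑-const c []       = refl
    ∑-const c (x ∷ xs) = cong (c +_) (∑-const c xs)

    ∑-zero : ∀ {f : A → ℕ} xs → (∀ x → f x ≡ 0) → ∑ f xs ≡ 0
    ∑-zero xs f≡0 = trans (∑-cong xs f≡0) (trans (∑-const 0 xs) (*-zeroʳ (length xs)))

    ∑-++ : ∀ (f : A → ℕ) xs ys → ∑ f (xs ++ ys) ≡ ∑ f xs + ∑ f ys
    ∑-++ f []       ys = refl
    ∑-++ f (x ∷ xs) ys rewrite ∑-++ f xs ys = sym (+-assoc (f x) _ _)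

    ∑-↭ : ∀ (f : A → ℕ) {xs ys} → xs ↭ ys → ∑ f xs ≡ ∑ f ys
    ∑-↭ f refl         = refl
    ∑-↭ f (prep x p)   = cong (f x +_) (∑-↭ f p)
    ∑-↭ f (swap {xs} {ys} x y p) rewrite ∑-↭ f p = eq (f x) (f y) (∑ f ys)
      where
      eq : ∀ a b c → a + (b + c) ≡ b + (a + c)
      eq = solve-∀
    ∑-↭ f (↭trans p q) = trans (∑-↭ f p) (∑-↭ f q)

    ∈⇒↭ : ∀ {x : A} {xs} → x ∈ xs → ∃ λ xs′ → xs ↭ x ∷ xs′
    ∈⇒↭ {x} x∈ with ∈-∃++ x∈
    ... | ys , zs , refl = ys ++ zs , shift x ys zs

    ∑-⊆ : ∀ (f : A → ℕ) {xs ys} → Unique xs → (∀ {x} → x ∈ xs → x ∈ ys) → ∑ f xs ≤ ∑ f ys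
    ∑-⊆ f {[]}     []       xs⊆ys = z≤n
    ∑-⊆ f {x ∷ xs} (x≢ ∷ u) xs⊆ys with ∈⇒↭ (xs⊆ys (here refl))
    ... | ys′ , p rewrite ∑-↭ f p = +-monoʳ-≤ (f x) (∑-⊆ f u sub)
      where
      sub : ∀ {y} → y ∈ xs → y ∈ ys′
      sub y∈ with ∈-resp-↭ p (xs⊆ys (there y∈))
      ... | here refl = ⊥-elim (All.lookup x≢ y∈ refl)
      ... | there y∈′ = y∈′

    cnt : ∀ {p} {P : Pred A p} → Decidable P → List A → ℕ
    cnt P? = ∑ (λ x → ind (P? x))

    cnt-mono : ∀ {p q} {P : Pred A p} {Q : Pred A q} (P? : Decidable P) (Q? : Decidable Q) xs →
               (∀ {x} → x ∈ xs → P x → Q x) → cnt P? xs ≤ cnt Q? xs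
    cnt-mono P? Q? xs f = ∑-mono xs (λ {x} x∈ → ind-mono (P? x) (Q? x) (f x∈))

    cnt-⊎ : ∀ {p q r} {P : Pred A p} {Q : Pred A q} {R : Pred A r}
            (P? : Decidable P) (Q? : Decidable Q) (R? : Decidable R) xs →
            (∀ {x} → x ∈ xs → P x → Q x ⊎ R x) → cnt P? xs ≤ cnt Q? xs + cnt R? xs
    cnt-⊎ P? Q? R? xs f = ≤-trans (∑-mono xs (λ {x} x∈ → ind-⊎ (P? x) (Q? x) (R? x) (f x∈)))
                                  (≤-reflexive (∑-+ _ _ xs))

    cnt-¬ : ∀ {p} {P : Pred A p} (P? : Decidable P) xs → cnt P? xs + cnt (¬? ∘ P?) xs ≡ length xs
    cnt-¬ P? xs = begin
      cnt P? xs + cnt (¬? ∘ P?) xs                 ≡⟨ sym (∑-+ _ _ xs) ⟩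
      ∑ (λ x → ind (P? x) + ind (¬? (P? x))) xs    ≡⟨ ∑-cong xs (λ x → ind-¬ (P? x)) ⟩
      ∑ (λ _ → 1) xs                               ≡⟨ ∑-const 1 xs ⟩
      length xs * 1                                ≡⟨ *-identityʳ _ ⟩
      length xs                                    ∎
      where open ≡-Reasoning

    cnt≤length : ∀ {p} {P : Pred A p} (P? : Decidable P) xs → cnt P? xs ≤ length xs
    cnt≤length P? xs = ≤-trans (m≤m+n _ _) (≤-reflexive (cnt-¬ P? xs))

    cnt-all : ∀ {p} {P : Pred A p} (P? : Decidable P) xs → (∀ {x} → x ∈ xs → P x) → cnt P? xs ≡ length xs
    cnt-all P? []       f = refl
    cnt-all P? (x ∷ xs) f = cong₂ _+_ (ind-yes (P? x) (f (here refl))) (cnt-all P? xs (f ∘ there))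

    cnt-none : ∀ {p} {P : Pred A p} (P? : Decidable P) xs → (∀ {x} → ¬ P x) → cnt P? xs ≡ 0
    cnt-none P? xs none = ∑-zero xs (λ x → ind-no (P? x) none)

    cnt-filter : ∀ {p} {P : Pred A p} (P? : Decidable P) xs → length (filter P? xs) ≡ cnt P? xs
    cnt-filter P? []       = refl
    cnt-filter P? (x ∷ xs) with P? x
    ... | yes _ = cong suc (cnt-filter P? xs)
    ... | no _  = cnt-filter P? xs

    cnt-pos : ∀ {p} {P : Pred A p} (P? : Decidable P) xs → 0 < cnt P? xs → ∃ λ x → x ∈ xs × P x
    cnt-pos P? (x ∷ xs) pos with P? x
    ... | yes px = x , here refl , px
    ... | no _   with cnt-pos P? xs pos
    ...   | y , y∈ , py = y , there y∈ , py

    cnt-∈ : ∀ {p} {P : Pred A p} (P? : Decidable P) {x xs} → x ∈ xs → P x → 0 < cnt P? xs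
    cnt-∈ P? {xs = _ ∷ xs} (here refl) px rewrite ind-yes (P? _) px = s≤s z≤n
    cnt-∈ P? {xs = y ∷ xs} (there x∈) px = ≤-trans (cnt-∈ P? x∈ px) (m≤n+m _ (ind (P? y)))

    cnt-gap : ∀ {p q} {P : Pred A p} {Q : Pred A q} (P? : Decidable P) (Q? : Decidable Q) xs →
              cnt Q? xs < cnt P? xs → ∃ λ x → x ∈ xs × P x × ¬ Q x
    cnt-gap P? Q? xs lt = cnt-pos (λ x → P? x ×-dec ¬? (Q? x)) xs
      (+-cancelʳ-≤ (cnt Q? xs) 1 _ (≤-trans lt
        (cnt-⊎ P? (λ x → P? x ×-dec ¬? (Q? x)) Q? xs split)))
      where
      split : ∀ {x} → x ∈ xs → _ → _
      split {x} _ px with Q? x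
      ... | yes qx = inj₂ qx
      ... | no ¬qx = inj₁ (px , ¬qx)

  ∑-swap : ∀ {A B : Set} (f : A → B → ℕ) xs ys →
           ∑ (λ x → ∑ (f x) ys) xs ≡ ∑ (λ y → ∑ (λ x → f x y) xs) ys
  ∑-swap f []       ys = sym (∑-zero ys (λ _ → refl))
  ∑-swap f (x ∷ xs) ys rewrite ∑-swap f xs ys = sym (∑-+ (f x) _ ys)

  -- Perfect matchings avoiding two partitions

  ∈⇒↭₂ : ∀ {A : Set} {u v : A} {xs} → u ∈ xs → v ∈ xs → u ≢ v → ∃ λ xs′ → xs ↭ u ∷ v ∷ xs′
  ∈⇒↭₂ {u = u} u∈ v∈ u≢v with ∈⇒↭ u∈
  ... | ys , p with ∈-resp-↭ p v∈
  ...   | here v≡u = ⊥-elim (u≢v (sym v≡u))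
  ...   | there v∈′ with ∈⇒↭ v∈′
  ...     | xs′ , q = xs′ , ↭trans p (prep u q)

  flat : ∀ {A : Set} → List (A × A) → List A
  flat []            = []
  flat ((u , v) ∷ M) = u ∷ v ∷ flat M

  module Matching {A L : Set} (_≟ᴸ_ : DecidableEquality L) where

    -- An element labelled `nothing` lies in no part and clashes with nobody. This leaves a
    -- component unrestricted when its vertices may be matched among themselves.
    InPart : (A → Maybe L) → L → Pred A _
    InPart f l x = f x ≡ just l

    part? : ∀ f l → Decidable (InPart f l)
    part? f l x = Maybe.≡-dec _≟ᴸ_ (f x) (just l)

    Clash : (A → Maybe L) → A → A → Set
    Clash f u v = ∃ λ l → f u ≡ just l × f v ≡ just l

    clash? : ∀ f u → Decidable (Clash f u)
    clash? f u v with f u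
    ... | nothing = no λ ()
    ... | just l with Maybe.≡-dec _≟ᴸ_ (f v) (just l)
    ...   | yes e = yes (l , refl , e)
    ...   | no ¬e = no λ { (_ , refl , e) → ¬e e }

    PartsAtMost : (A → Maybe L) → ℕ → List A → Set
    PartsAtMost f m xs = ∀ l → cnt (part? f l) xs ≤ m

    clash-small : ∀ f {m} xs u → PartsAtMost f m xs → cnt (clash? f u) xs ≤ m
    clash-small f {m} xs u small = bound (f u) refl
      where
      bound : ∀ y → f u ≡ y → cnt (clash? f u) xs ≤ m
      bound nothing eq = ≤-trans (≤-reflexive (cnt-none (clash? f u) xs λ { (_ , e , _) → contradiction (trans (sym eq) e) λ () })) z≤n
      bound (just l) eq = ≤-trans (cnt-mono (clash? f u) (part? f l) xs
        (λ { _ (_ , e , e′) → trans e′ (trans (sym e) eq) })) (small l)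

    module Step (m : ℕ) (xs : List A) (len : length xs ≡ suc m + suc m) where

      -- A part of size `m + 1` is half of the `2(m + 1)` elements, so the next pair has to take
      -- exactly one element from it.
      Tight : (A → Maybe L) → Pred A _
      Tight f x = ∃ λ l → f x ≡ just l × cnt (part? f l) xs ≡ suc m

      tight? : ∀ f → Decidable (Tight f)
      tight? f x with f x
      ... | nothing = no λ ()
      ... | just l with cnt (part? f l) xs ≟ suc m
      ...   | yes e = yes (l , refl , e)
      ...   | no ¬e = no λ { (_ , refl , e) → ¬e e }

      Loose : (A → Maybe L) → Set
      Loose f = PartsAtMost f m xs

      loose-or-tight : ∀ f → PartsAtMost f (suc m) xs → Loose f ⊎ ∃ λ l → cnt (part? f l) xs ≡ suc m
      loose-or-tight f small with any? (tight? f) xs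
      ... | yes t with find t
      ...   | _ , _ , l , _ , e = inj₂ (l , e)
      loose-or-tight f small | no ¬t = inj₁ loose
        where
        loose : Loose f
        loose l with m≤n⇒m<n∨m≡n (small l)
        ... | inj₁ (s≤s lt) = lt
        ... | inj₂ e with cnt-pos (part? f l) xs (subst (0 <_) (sym e) (s≤s z≤n))
        ...   | x , x∈ , fx = contradiction (lose x∈ (l , fx , e)) ¬t

      record Choice (f₁ f₂ : A → Maybe L) : Set where
        constructor choice
        field
          u v    : A
          rest   : List A
          perm   : xs ↭ u ∷ v ∷ rest
          ¬cl₁   : ¬ Clash f₁ u v
          ¬cl₂   : ¬ Clash f₂ u v
          small₁ : PartsAtMost f₁ m rest
          small₂ : PartsAtMost f₂ m rest

      loose-rest : ∀ f {u v rest} → Loose f → xs ↭ u ∷ v ∷ rest → PartsAtMost f m rest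
      loose-rest f {u} {v} loose p l =
        ≤-trans (≤-trans (m≤n+m _ _) (m≤n+m _ (ind (part? f l u))))
                (≤-trans (≤-reflexive (sym (∑-↭ _ p))) (loose l))

      -- Removing one vertex of a tight part and one outside it leaves both sides of size m,
      -- and every other part lies outside.
      tight-rest : ∀ {f l u v rest} → cnt (part? f l) xs ≡ suc m → xs ↭ u ∷ v ∷ rest →
                   InPart f l u × ¬ InPart f l v ⊎ ¬ InPart f l u × InPart f l v → PartsAtMost f m rest
      tight-rest {f} {l} {u} {v} {rest} tight p one l′ = bound (l′ ≟ᴸ l)
        where
        count : InPart f l u × ¬ InPart f l v ⊎ ¬ InPart f l u × InPart f l v →
                ind (part? f l u) + ind (part? f l v) ≡ 1
        count (inj₁ (a , b)) = cong₂ _+_ (ind-yes (part? f l u) a) (ind-no (part? f l v) b)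
        count (inj₂ (a , b)) = cong₂ _+_ (ind-no (part? f l u) a) (ind-yes (part? f l v) b)
        inside : cnt (part? f l) rest ≡ m
        inside = suc-injective (trans (sym (trans (∑-↭ _ p)
          (trans (sym (+-assoc (ind (part? f l u)) _ _)) (cong (_+ cnt (part? f l) rest) (count one))))) tight)
        len-rest : length rest ≡ m + m
        len-rest = suc-injective (suc-injective (trans (sym (↭-length p)) (trans len (cong suc (+-suc m m)))))
        outside : cnt (¬? ∘ part? f l) rest ≡ m
        outside = +-cancelˡ-≡ m _ _ (trans (cong (_+ cnt (¬? ∘ part? f l) rest) (sym inside))
                                           (trans (cnt-¬ (part? f l) rest) len-rest))
        bound : Dec (l′ ≡ l) → cnt (part? f l′) rest ≤ m
        bound (yes refl) = ≤-reflexive inside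
        bound (no l′≢l)  = ≤-trans (cnt-mono (part? f l′) (¬? ∘ part? f l) rest
          (λ _ e e′ → l′≢l (just-injective (trans (sym e) e′)))) (≤-reflexive outside)

      tight-outside : ∀ {f l} → cnt (part? f l) xs ≡ suc m → cnt (¬? ∘ part? f l) xs ≡ suc m
      tight-outside {f} {l} tight = +-cancelˡ-≡ (suc m) _ _
        (trans (cong (_+ cnt (¬? ∘ part? f l) xs) (sym tight)) (trans (cnt-¬ (part? f l) xs) len))

      ¬clash : ∀ {f l u v} → InPart f l u × ¬ InPart f l v ⊎ ¬ InPart f l u × InPart f l v → ¬ Clash f u v
      ¬clash (inj₁ (a , b)) (_ , e , e′) = b (trans e′ (trans (sym e) a))
      ¬clash (inj₂ (a , b)) (_ , e , e′) = a (trans e (trans (sym e′) b))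

      ≢-sides : ∀ {f l u v} → InPart f l u × ¬ InPart f l v ⊎ ¬ InPart f l u × InPart f l v → u ≢ v
      ≢-sides (inj₁ (a , b)) refl = b a
      ≢-sides (inj₂ (a , b)) refl = a b

      -- Any `u` in the tight part will do: `m + 1` elements lie outside that part, and at most `m`
      -- of them clash with `u` under the loose labelling.
      tight-loose : ∀ {f₁ f₂ l} → cnt (part? f₁ l) xs ≡ suc m → Loose f₂ → Choice f₁ f₂
      tight-loose {f₁} {f₂} {l} tight loose
        with cnt-pos (part? f₁ l) xs (subst (0 <_) (sym tight) (s≤s z≤n))
      ... | u , u∈ , fu
        with cnt-gap (¬? ∘ part? f₁ l) (clash? f₂ u) xs
               (subst (cnt (clash? f₂ u) xs <_) (sym (tight-outside {f₁} tight)) (s≤s (clash-small f₂ xs u loose)))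
      ... | v , v∈ , fv , ¬cl with ∈⇒↭₂ u∈ v∈ (≢-sides {f₁} (inj₁ (fu , fv)))
      ... | rest , p = choice u v rest p (¬clash {f₁} (inj₁ (fu , fv))) ¬cl
                         (tight-rest tight p (inj₁ (fu , fv))) (loose-rest f₂ loose p)

      -- The pair must be separated by both tight parts, each of which is half of `xs`. If they meet
      -- in some `u`, then some `v` lies outside both; if they are disjoint, one element of each
      -- will do.
      tight-tight : ∀ {f₁ f₂ l₁ l₂} → cnt (part? f₁ l₁) xs ≡ suc m → cnt (part? f₂ l₂) xs ≡ suc m → Choice f₁ f₂
      tight-tight {f₁} {f₂} {l₁} {l₂} tight₁ tight₂ = pick (any? both? xs)
        where
        both? : Decidable (λ x → InPart f₁ l₁ x × InPart f₂ l₂ x)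
        both? x = part? f₁ l₁ x ×-dec part? f₂ l₂ x
        onlySecond? : Decidable (λ x → ¬ InPart f₁ l₁ x × InPart f₂ l₂ x)
        onlySecond? x = ¬? (part? f₁ l₁ x) ×-dec part? f₂ l₂ x
        build : ∀ {u v} → u ∈ xs → v ∈ xs →
                InPart f₁ l₁ u × ¬ InPart f₁ l₁ v ⊎ ¬ InPart f₁ l₁ u × InPart f₁ l₁ v →
                InPart f₂ l₂ u × ¬ InPart f₂ l₂ v ⊎ ¬ InPart f₂ l₂ u × InPart f₂ l₂ v → Choice f₁ f₂
        build {u} {v} u∈ v∈ s₁ s₂ with ∈⇒↭₂ u∈ v∈ (≢-sides {f₁} s₁)
        ... | rest , p = choice u v rest p (¬clash {f₁} s₁) (¬clash {f₂} s₂)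
                           (tight-rest tight₁ p s₁) (tight-rest tight₂ p s₂)
        pick : Dec (Any (λ x → InPart f₁ l₁ x × InPart f₂ l₂ x) xs) → Choice f₁ f₂
        pick (yes a) with find a
        ... | u , u∈ , fu₁ , fu₂ with cnt-gap (¬? ∘ part? f₁ l₁) onlySecond? xs gap
          where
          split : ∀ x → ind (both? x) + ind (onlySecond? x) ≡ ind (part? f₂ l₂ x)
          split x with part? f₁ l₁ x
          ... | yes _ = +-identityʳ _
          ... | no _  = refl
          gap : cnt onlySecond? xs < cnt (¬? ∘ part? f₁ l₁) xs
          gap = begin-strict
            cnt onlySecond? xs  <⟨ +-monoˡ-≤ _ (cnt-∈ both? u∈ (fu₁ , fu₂)) ⟩
            cnt both? xs + cnt onlySecond? xs         ≡⟨ sym (∑-+ _ _ xs) ⟩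
            ∑ (λ x → ind (both? x) + ind (onlySecond? x)) xs ≡⟨ ∑-cong xs split ⟩
            cnt (part? f₂ l₂) xs                      ≡⟨ tight₂ ⟩
            suc m                                     ≡⟨ sym (tight-outside {f₁} tight₁) ⟩
            cnt (¬? ∘ part? f₁ l₁) xs                 ∎
            where open ≤-Reasoning
        ... | v , v∈ , ¬fv₁ , ¬os = build u∈ v∈ (inj₁ (fu₁ , ¬fv₁)) (inj₁ (fu₂ , λ fv₂ → ¬os (¬fv₁ , fv₂)))
        pick (no ¬a) with cnt-pos (part? f₁ l₁) xs (subst (0 <_) (sym tight₁) (s≤s z≤n))
                        | cnt-pos (part? f₂ l₂) xs (subst (0 <_) (sym tight₂) (s≤s z≤n))
        ... | u , u∈ , fu | v , v∈ , fv =
          build u∈ v∈ (inj₁ (fu , λ e → ¬a (lose v∈ (e , fv)))) (inj₂ ((λ e → ¬a (lose u∈ (fu , e))) , fv))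

      swapChoice : ∀ {f₁ f₂} → Choice f₁ f₂ → Choice f₂ f₁
      swapChoice (choice u v rest p c₁ c₂ s₁ s₂) = choice u v rest p c₂ c₁ s₂ s₁

    -- Any removal keeps the parts small enough, so only the clashes with `u` matter: of the
    -- `2m + 1` candidates each labelling excludes at most `m`.
    loose-loose : ∀ m xs (len : length xs ≡ suc m + suc m) → ∀ {f₁ f₂} →
                  PartsAtMost f₁ m xs → PartsAtMost f₂ m xs → Step.Choice m xs len f₁ f₂
    loose-loose m (u ∷ xs) len {f₁} {f₂} loose₁ loose₂
      with cnt-gap {P = λ x → ¬ Clash f₁ u x} (¬? ∘ clash? f₁ u) (clash? f₂ u) xs gap
      where
      drop-u : ∀ f → PartsAtMost f m (u ∷ xs) → PartsAtMost f m xs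
      drop-u f small l = ≤-trans (m≤n+m _ (ind (part? f l u))) (small l)
      total : cnt (clash? f₁ u) xs + cnt (¬? ∘ clash? f₁ u) xs ≡ m + suc m
      total = trans (cnt-¬ (clash? f₁ u) xs) (suc-injective len)
      gap : cnt (clash? f₂ u) xs < cnt (¬? ∘ clash? f₁ u) xs
      gap = ≤-trans (s≤s (clash-small f₂ xs u (drop-u f₂ loose₂)))
        (+-cancelˡ-≤ m _ _ (≤-trans (≤-reflexive (sym total))
          (+-monoˡ-≤ _ (clash-small f₁ xs u (drop-u f₁ loose₁)))))
    ... | v , v∈ , ¬cl₁ , ¬cl₂ with ∈⇒↭ v∈
    ... | rest , p = Step.choice u v rest (prep u p) ¬cl₁ ¬cl₂
                       (Step.loose-rest m (u ∷ xs) len f₁ loose₁ (prep u p))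
                       (Step.loose-rest m (u ∷ xs) len f₂ loose₂ (prep u p))

    choose : ∀ m xs (len : length xs ≡ suc m + suc m) → ∀ {f₁ f₂} →
             PartsAtMost f₁ (suc m) xs → PartsAtMost f₂ (suc m) xs → Step.Choice m xs len f₁ f₂
    choose m xs len {f₁} {f₂} s₁ s₂ with Step.loose-or-tight m xs len f₁ s₁ | Step.loose-or-tight m xs len f₂ s₂
    ... | inj₁ a       | inj₁ b       = loose-loose m xs len a b
    ... | inj₁ a       | inj₂ (l , b) = Step.swapChoice m xs len (Step.tight-loose m xs len b a)
    ... | inj₂ (l , a) | inj₁ b       = Step.tight-loose m xs len a b
    ... | inj₂ (l , a) | inj₂ (_ , b) = Step.tight-tight m xs len a b

    -- The bound by half of the elements is the invariant that `choose` restores. Three labellings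
    -- would be too many: on four elements, the three partitions into pairs make every pair clash.
    perfectMatching : ∀ m xs → length xs ≡ m + m → ∀ {f₁ f₂} → PartsAtMost f₁ m xs → PartsAtMost f₂ m xs →
      ∃ λ M → flat M ↭ xs × All (λ { (u , v) → ¬ Clash f₁ u v × ¬ Clash f₂ u v }) M
    perfectMatching zero    []       len s₁ s₂ = [] , ↭-refl , []
    perfectMatching (suc m) xs       len s₁ s₂ with choose m xs len s₁ s₂
    ... | Step.choice u v rest p c₁ c₂ t₁ t₂
      with perfectMatching m rest
             (suc-injective (suc-injective (trans (sym (↭-length p)) (trans len (cong suc (+-suc m m)))))) t₁ t₂
    ... | M , q , all = (u , v) ∷ M , ↭trans (prep u (prep v q)) (↭-sym p) , (c₁ , c₂) ∷ all

  -- Trimming, merging and the trichotomy for cells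

  half-≤ : ∀ {a b} → a + a ≤ b + b → a ≤ b
  half-≤ {a} {b} le with a ≤? b
  ... | yes p = p
  ... | no ¬p = contradiction (≤-trans (+-mono-< (≰⇒> ¬p) (≰⇒> ¬p)) (≤-refl)) (≤⇒≯ le)

  half-≤′ : ∀ {a b} → a + a ≤ suc (b + b) → a ≤ b
  half-≤′ {a} {b} le with a ≤? b
  ... | yes p = p
  ... | no ¬p = contradiction (≤-trans (≤-reflexive (cong suc (sym (+-suc b b)))) (+-mono-≤ (≰⇒> ¬p) (≰⇒> ¬p)))
                              (<⇒≱ (s≤s le))

  evenOrOdd : ∀ n → (∃ λ m → n ≡ m + m) ⊎ (∃ λ m → n ≡ suc (m + m))
  evenOrOdd zero    = inj₁ (0 , refl)
  evenOrOdd (suc n) with evenOrOdd n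
  ... | inj₁ (m , refl) = inj₂ (m , refl)
  ... | inj₂ (m , refl) = inj₁ (suc m , cong suc (sym (+-suc m m)))

  module _ {A : Set} (g : A → ℕ) where

    class? : ∀ l → Decidable (λ x → g x ≡ l)
    class? l x = g x ≟ l

    private
      size : ℕ → List A → ℕ
      size l = cnt (class? l)

    -- A class that attains the bound with positive excess holds more than half of the elements.
    -- Deleting one of its elements lowers its excess by one, and the other classes are too small to
    -- violate the new bound.
    trim : ∀ e xs → (∀ l → size l xs + size l xs ≤ length xs + e) →
           ∃₂ λ rs ys → xs ↭ rs ++ ys × length rs ≤ e × (∀ l → size l ys + size l ys ≤ length ys)
    trim zero    xs h = [] , xs , ↭-refl , z≤n , λ l → subst (size l xs + size l xs ≤_) (+-identityʳ _) (h l)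
    trim (suc e) xs h with any? (λ x → size (g x) xs + size (g x) xs ≟ length xs + suc e) xs
    ... | no ¬tight with trim e xs loose
      where
      loose : ∀ l → size l xs + size l xs ≤ length xs + e
      loose l with m≤n⇒m<n∨m≡n (h l)
      ... | inj₁ lt = ≤-pred (≤-trans lt (≤-reflexive (+-suc (length xs) e)))
      ... | inj₂ eq with size l xs ≟ 0
      ...   | yes z rewrite z = z≤n
      ...   | no nz with cnt-pos (class? l) xs (n≢0⇒n>0 nz)
      ...     | x , x∈ , refl = contradiction (lose x∈ eq) ¬tight
    ...   | rs , ys , p , le , fair = rs , ys , p , m≤n⇒m≤1+n le , fair
    trim (suc e) xs h | yes tight with find tight
    ... | x , x∈ , eq with ∈⇒↭ x∈
    ...   | xs′ , p with trim e xs′ smaller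
      where
      len : length xs ≡ suc (length xs′)
      len = ↭-length p
      split : ∀ l → size l xs ≡ ind (class? l x) + size l xs′
      split l = ∑-↭ _ p
      own : size (g x) xs ≡ suc (size (g x) xs′)
      own = trans (split (g x)) (cong (_+ size (g x) xs′) (ind-yes (class? (g x) x) refl))
      both : ∀ l → l ≢ g x → size l xs′ + size (g x) xs ≤ length xs
      both l l≢ = ≤-trans (+-mono-≤ (≤-trans (m≤n+m _ (ind (class? l x))) (≤-reflexive (sym (split l)))) ≤-refl)
        (≤-trans (≤-reflexive (+-comm (size l xs) _))
        (≤-trans (+-monoʳ-≤ _ (cnt-mono (class? l) (¬? ∘ class? (g x)) xs (λ _ a b → l≢ (trans (sym a) b))))
                 (≤-reflexive (cnt-¬ (class? (g x)) xs))))
      smaller : ∀ l → size l xs′ + size l xs′ ≤ length xs′ + e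
      smaller l with l ≟ g x
      ... | yes refl = ≤-reflexive (suc-injective (suc-injective (trans (sym (trans (cong₂ _+_ own own)
              (cong suc (+-suc _ _)))) (trans eq (trans (cong (_+ suc e) len) (cong suc (+-suc _ e)))))))
      ... | no l≢ = lin (e + e) (+-mono-≤ (both l l≢) (both l l≢))
              (trans (cong₂ (λ a b → size l xs′ + size l xs′ + (a + a) + b) len (refl {x = e + e}))
                (trans (alg (size l xs′) (length xs′) e)
                  (trans (cong (λ t → length xs′ + e + (size l xs′ + size l xs′ + t)) (sym (trans eq (cong (_+ suc e) len))))
                    (cong (length xs′ + e +_) (alg₂ (size l xs′) (size (g x) xs))))))
        where
        alg : ∀ s n e → s + s + (suc n + suc n) + (e + e) ≡ n + e + (s + s + (suc n + suc e))
        alg = solve-∀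
        alg₂ : ∀ s c → s + s + (c + c) ≡ s + c + (s + c)
        alg₂ = solve-∀
    ...     | rs , ys , q , le , fair = x ∷ rs , ys , ↭trans p (prep x q) , s≤s le , fair

    -- An odd length `2m + 1` costs one further element, whichever it is: by integrality a class
    -- with at most half of the elements has size at most `m` already.
    evenTrim : ∀ e xs → (∀ l → size l xs + size l xs ≤ length xs + e) →
      ∃₂ λ rs ys → xs ↭ rs ++ ys × length rs ≤ suc e × ∃ λ m → length ys ≡ m + m × (∀ l → size l ys ≤ m)
    evenTrim e xs h with trim e xs h
    ... | rs , ys , p , le , fair with evenOrOdd (length ys)
    ...   | inj₁ (m , eq) = rs , ys , p , m≤n⇒m≤1+n le , m , eq ,
              λ l → half-≤ (subst (size l ys + size l ys ≤_) eq (fair l))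
    ...   | inj₂ (m , eq) with ys
    ...     | y ∷ ys′ = y ∷ rs , ys′ , ↭trans p (shift y rs ys′) , s≤s le , m , suc-injective eq ,
                λ l → half-≤′ (≤-trans (+-mono-≤ (m≤n+m _ (ind (class? l y))) (m≤n+m _ (ind (class? l y))))
                                       (subst (size l (y ∷ ys′) + size l (y ∷ ys′) ≤_) eq (fair l)))

  module Matching₃ {A : Set} = Matching {A} {Fin 3} Fin._≟_

  open Matching₃ public using () renaming
    (PartsAtMost to PartsAtMost₃; part? to part₃?; Clash to Clash₃; perfectMatching to perfectMatching₃)

  super : ℕ → ℕ → Fin 3
  super t l with l <? t | l ≟ t
  ... | yes _ | _     = zero
  ... | no _  | yes _ = suc zero
  ... | no _  | no _  = suc (suc zero)

  superOf : ∀ {A : Set} → (A → ℕ) → ℕ → A → Maybe (Fin 3)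
  superOf f t x = just (super t (f x))

  -- Take the label `t` at which the number of elements with smaller labels passes `m`. The labels
  -- below `t`, the label `t` alone and the labels above `t` then each carry at most half.
  merge₃ : ∀ {A : Set} (f : A → ℕ) L m xs → length xs ≡ m + m → (∀ {x} → x ∈ xs → f x < L) →
           (∀ l → cnt (λ x → f x ≟ l) xs ≤ m) → ∃ λ t → PartsAtMost₃ (superOf f t) m xs
  merge₃ f L m xs len bound parts = finish (crossing L top)
    where
    below : ℕ → ℕ
    below t = cnt (λ x → f x <? t) xs
    top : m ≤ below L
    top = ≤-trans (≤-trans (m≤m+n m m) (≤-reflexive (sym len))) (≤-reflexive (sym (cnt-all (λ x → f x <? L) xs bound)))
    crossing : ∀ L → m ≤ below L → ∃ λ t → below t ≤ m × m ≤ below (suc t)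
    crossing zero le = 0 , ≤-trans (≤-reflexive zero-below) z≤n , ≤-trans (≤-trans le (≤-reflexive zero-below)) z≤n
      where
      zero-below : below 0 ≡ 0
      zero-below = cnt-none (λ x → f x <? 0) xs λ ()
    crossing (suc L) le with below L ≤? m
    ... | yes b = L , b , le
    ... | no ¬b = crossing L (<⇒≤ (≰⇒> ¬b))
    finish : (∃ λ t → below t ≤ m × m ≤ below (suc t)) → ∃ λ t → PartsAtMost₃ (superOf f t) m xs
    finish (t , lo , hi) = t , small
      where
      F = superOf f t
      above? = λ x → ¬? (f x <? suc t)
      p₀ : ∀ x → just (super t (f x)) ≡ just zero → f x < t
      p₀ x e with f x <? t | f x ≟ t
      p₀ x e  | yes lt | _ = lt
      p₀ x () | no _ | yes _
      p₀ x () | no _ | no _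
      p₁ : ∀ x → just (super t (f x)) ≡ just (suc zero) → f x ≡ t
      p₁ x e with f x <? t | f x ≟ t
      p₁ x () | yes lt | _
      p₁ x e  | no _ | yes eq = eq
      p₁ x () | no _ | no _
      p₂ : ∀ x → just (super t (f x)) ≡ just (suc (suc zero)) → ¬ f x < suc t
      p₂ x e lt with f x <? t | f x ≟ t
      p₂ x () lt | yes _ | _
      p₂ x () lt | no _ | yes _
      p₂ x e  lt | no ≮ | no ≢ = ≢ (≤-antisym (≤-pred lt) (≮⇒≥ ≮))
      small : PartsAtMost₃ F m xs
      small zero = ≤-trans (cnt-mono (part₃? F zero) (λ x → f x <? t) xs (λ {x} _ → p₀ x)) lo
      small (suc zero) = ≤-trans (cnt-mono (part₃? F (suc zero)) (λ x → f x ≟ t) xs (λ {x} _ → p₁ x)) (parts t)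
      small (suc (suc zero)) = ≤-trans (cnt-mono (part₃? F (suc (suc zero))) above? xs (λ {x} _ → p₂ x))
        (+-cancelˡ-≤ m _ _ (≤-trans (+-monoˡ-≤ _ hi)
          (≤-trans (≤-reflexive (cnt-¬ (λ x → f x <? suc t) xs)) (≤-reflexive len))))

  module Trichotomy {A : Set} (g ρ b : A → ℕ) (xs : List A)
    (pairwise : ∀ {u v} → u ∈ xs → v ∈ xs → g u ≡ g v ⊎ ρ u ≡ ρ v ⊎ b u ≡ b v)
    (escape : ∀ l → ∃ λ z → z ∈ xs × g z ≢ l) where

    Cell : ℕ → ℕ → A → Set
    Cell r s v = ρ v ≡ r × b v ≡ s

    CrossShape : Set
    CrossShape = ∃ λ r → ∃ λ s → ∃ λ g₁ →
      ∀ {v} → v ∈ xs → Cell r s v ⊎ g v ≡ g₁ × (ρ v ≡ r ⊎ b v ≡ s)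

    -- Four cells of a two by two table, one diagonal in each group. Vertices of different groups
    -- then share exactly one component, and its colour is forced on an edge that does not run
    -- between components.
    SplitShape : Set
    SplitShape = ∃₂ λ r₁ r₂ → ∃₂ λ s₁ s₂ → ∃₂ λ g₁ g₂ → r₁ ≢ r₂ × s₁ ≢ s₂ ×
      (∀ {v} → v ∈ xs → g v ≡ g₁ × (Cell r₁ s₁ v ⊎ Cell r₂ s₂ v) ⊎ g v ≡ g₂ × (Cell r₁ s₂ v ⊎ Cell r₂ s₁ v))

    far : ∀ {u v} → u ∈ xs → v ∈ xs → ρ u ≢ ρ v → b u ≢ b v → g u ≡ g v
    far u∈ v∈ ρ≢ b≢ with pairwise u∈ v∈
    ... | inj₁ e        = e
    ... | inj₂ (inj₁ e) = contradiction e ρ≢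
    ... | inj₂ (inj₂ e) = contradiction e b≢

    near : ∀ {u v} → u ∈ xs → v ∈ xs → g u ≢ g v → ρ u ≡ ρ v ⊎ b u ≡ b v
    near u∈ v∈ g≢ with pairwise u∈ v∈
    ... | inj₁ e = contradiction e g≢
    ... | inj₂ s = s

    -- `z` agrees with each of `x` and `y` in some colour, and these colours are distinct because
    -- `x` and `y` agree in neither.
    between : ∀ {x y z} → x ∈ xs → y ∈ xs → z ∈ xs → ρ x ≢ ρ y → b x ≢ b y → g z ≢ g x → g z ≢ g y →
              Cell (ρ x) (b y) z ⊎ Cell (ρ y) (b x) z
    between x∈ y∈ z∈ ρ≢ b≢ gx gy with near z∈ x∈ gx | near z∈ y∈ gy
    ... | inj₁ e | inj₁ e′ = contradiction (trans (sym e) e′) ρ≢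
    ... | inj₁ e | inj₂ e′ = inj₁ (e , e′)
    ... | inj₂ e | inj₁ e′ = inj₂ (e′ , e)
    ... | inj₂ e | inj₂ e′ = contradiction (trans (sym e) e′) b≢

    -- Outside the common group of `x` and `y` only the two mixed cells occur, and `z` is in one of
    -- them. If the other is empty there, the cell of `z` is the centre of a cross. Otherwise a
    -- vertex of the group must agree with a vertex of each mixed cell, which leaves only the cells
    -- of `x` and `y`.
    diagonal : ∀ {x y z} → x ∈ xs → y ∈ xs → z ∈ xs → ρ x ≢ ρ y → b x ≢ b y → g x ≡ g y → g z ≢ g x →
               Cell (ρ x) (b y) z → CrossShape ⊎ SplitShape
    diagonal {x} {y} {z} x∈ y∈ z∈ ρ≢ b≢ gxy gz (ρz , bz)
      with any? (λ v → ¬? (g v ≟ g x) ×-dec (ρ v ≟ ρ y) ×-dec (b v ≟ b x)) xs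
    ... | no ¬a = inj₁ (ρ x , b y , g x , shape)
      where
      shape : ∀ {v} → v ∈ xs → Cell (ρ x) (b y) v ⊎ g v ≡ g x × (ρ v ≡ ρ x ⊎ b v ≡ b y)
      shape {v} v∈ with g v ≟ g x
      ... | no g≢ with between x∈ y∈ v∈ ρ≢ b≢ g≢ (λ e → g≢ (trans e (sym gxy)))
      ...   | inj₁ c = inj₁ c
      ...   | inj₂ c = contradiction (lose v∈ (g≢ , c)) ¬a
      shape {v} v∈ | yes g≡ with near v∈ z∈ (λ e → gz (trans (sym e) g≡))
      ...   | inj₁ e = inj₂ (g≡ , inj₁ (trans e ρz))
      ...   | inj₂ e = inj₂ (g≡ , inj₂ (trans e bz))
    ... | yes a with find a
    ...   | z′ , z′∈ , gz′ , ρz′ , bz′ = inj₂ (ρ x , ρ y , b x , b y , g x , g z , ρ≢ , b≢ , shape)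
      where
      zz′ : g z′ ≡ g z
      zz′ = far z′∈ z∈ (λ e → ρ≢ (trans (sym ρz) (trans (sym e) ρz′))) (λ e → b≢ (trans (sym bz′) (trans e bz)))
      shape : ∀ {v} → v ∈ xs → g v ≡ g x × (Cell (ρ x) (b x) v ⊎ Cell (ρ y) (b y) v)
                              ⊎ g v ≡ g z × (Cell (ρ x) (b y) v ⊎ Cell (ρ y) (b x) v)
      shape {v} v∈ with g v ≟ g x
      ... | no g≢ with between x∈ y∈ v∈ ρ≢ b≢ g≢ (λ e → g≢ (trans e (sym gxy)))
      ...   | inj₁ (ρv , bv) = inj₂ (trans (far v∈ z′∈ (λ e → ρ≢ (trans (sym ρv) (trans e ρz′)))
                                            (λ e → b≢ (trans (sym bz′) (trans (sym e) bv)))) zz′ , inj₁ (ρv , bv))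
      ...   | inj₂ (ρv , bv) = inj₂ (far v∈ z∈ (λ e → ρ≢ (trans (sym ρz) (trans (sym e) ρv)))
                                            (λ e → b≢ (trans (sym bv) (trans e bz))) , inj₂ (ρv , bv))
      shape {v} v∈ | yes g≡ with near v∈ z∈ (λ e → gz (trans (sym e) g≡)) | near v∈ z′∈ (λ e → gz′ (trans (sym e) g≡))
      ... | inj₁ e | inj₁ e′ = contradiction (trans (sym ρz) (trans (sym e) (trans e′ ρz′))) ρ≢
      ... | inj₁ e | inj₂ e′ = inj₁ (g≡ , inj₁ (trans e ρz , trans e′ bz′))
      ... | inj₂ e | inj₁ e′ = inj₁ (g≡ , inj₂ (trans e′ ρz′ , trans e bz))
      ... | inj₂ e | inj₂ e′ = contradiction (trans (sym bz′) (trans (sym e′) (trans e bz))) b≢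

    skew : ∀ {x y} → x ∈ xs → y ∈ xs → ρ x ≢ ρ y → b x ≢ b y → CrossShape ⊎ SplitShape
    skew {x} {y} x∈ y∈ ρ≢ b≢ with escape (g x)
    ... | z , z∈ , gz with far x∈ y∈ ρ≢ b≢
    ...   | gxy with between x∈ y∈ z∈ ρ≢ b≢ gz (λ e → gz (trans e (sym gxy)))
    ...     | inj₁ c = diagonal x∈ y∈ z∈ ρ≢ b≢ gxy gz c
    ...     | inj₂ c = diagonal y∈ x∈ z∈ (ρ≢ ∘ sym) (b≢ ∘ sym) (sym gxy) (λ e → gz (trans e (sym gxy))) c

    -- If neither labelling is constant, some `u` leaves the red component of `x` and some `w` its
    -- blue component; two of these three vertices then differ in both colours.
    trichotomy : (∃ λ r → ∀ {v} → v ∈ xs → ρ v ≡ r) ⊎ (∃ λ s → ∀ {v} → v ∈ xs → b v ≡ s) ⊎ CrossShape ⊎ SplitShape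
    -- Any group number serves here; only some vertex of `xs` is wanted.
    trichotomy with escape 0
    ... | x , x∈ , _ with All.all? (λ v → ρ v ≟ ρ x) xs | All.all? (λ v → b v ≟ b x) xs
    ...   | yes a | _     = inj₁ (ρ x , λ v∈ → All.lookup a v∈)
    ...   | no _  | yes a = inj₂ (inj₁ (b x , λ v∈ → All.lookup a v∈))
    ...   | no ¬a | no ¬a′ with find (¬All⇒Any¬ (λ v → ρ v ≟ ρ x) xs ¬a) | find (¬All⇒Any¬ (λ v → b v ≟ b x) xs ¬a′)
    ...     | u , u∈ , ρu | w , w∈ , bw with b u ≟ b x | ρ w ≟ ρ x
    ...       | no b≢ | _      = inj₂ (inj₂ (skew u∈ x∈ ρu b≢))
    ...       | yes _ | no ρ≢  = inj₂ (inj₂ (skew w∈ x∈ ρ≢ bw))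
    ...       | yes e | yes e′ = inj₂ (inj₂ (skew u∈ w∈ (λ q → ρu (trans q e′)) (λ q → bw (trans (sym q) e))))

  -- Depth-first search

  data Path {A : Set} (E : A → A → Set) : A → List A → A → Set where
    [_]  : ∀ a → Path E a (a ∷ []) a
    step : ∀ {a b c xs} → E a b → Path E b xs c → Path E a (a ∷ xs) c

  data IsPath {A : Set} (E : A → A → Set) : List A → Set where
    empty : IsPath E []
    path  : ∀ {a xs b} → Path E a xs b → IsPath E xs

  mapPath : ∀ {A B : Set} {E : A → A → Set} {F : B → B → Set} (f : A → B) → (∀ {a b} → E a b → F (f a) (f b)) →
            ∀ {a xs b} → Path E a xs b → Path F (f a) (map f xs) (f b)
  mapPath f h [ a ]      = [ f a ]
  mapPath f h (step e p) = step (h e) (mapPath f h p)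

  mapIsPath : ∀ {A B : Set} {E : A → A → Set} {F : B → B → Set} (f : A → B) → (∀ {a b} → E a b → F (f a) (f b)) →
              ∀ {xs} → IsPath E xs → IsPath F (map f xs)
  mapIsPath f h empty    = empty
  mapIsPath f h (path p) = path (mapPath f h p)

  module _ {A : Set} where

    open CMSolver (++-commutativeMonoid {A = A}) using (solve; _⊜_; _⊕_)

    ↭-regroup : ∀ (p q s t u v : List A) → (p ++ s ++ u) ++ (q ++ t ++ v) ↭ (p ++ q) ++ (s ++ v) ++ (u ++ t)
    ↭-regroup = solve 6 (λ p q s t u v → (p ⊕ s ⊕ u) ⊕ (q ⊕ t ⊕ v) ⊜ (p ⊕ q) ⊕ (s ⊕ v) ⊕ (u ⊕ t)) ↭-refl

    ↭-zip₃ : ∀ (x y z x′ y′ z′ : List A) → (x ++ y ++ z) ++ (x′ ++ y′ ++ z′) ↭ (x ++ x′) ++ (y ++ y′) ++ (z ++ z′)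
    ↭-zip₃ = solve 6 (λ x y z x′ y′ z′ → (x ⊕ y ⊕ z) ⊕ (x′ ⊕ y′ ⊕ z′) ⊜ (x ⊕ x′) ⊕ (y ⊕ y′) ⊕ (z ⊕ z′)) ↭-refl

    ↭-collect : ∀ (p p₁ a b p₂ c d : List A) →
      p ++ (p₁ ++ a ++ b) ++ (p₂ ++ c ++ d) ↭ p ++ (p₁ ++ p₂) ++ (a ++ b ++ c ++ d)
    ↭-collect = solve 7 (λ p p₁ a b p₂ c d → p ⊕ (p₁ ⊕ a ⊕ b) ⊕ (p₂ ⊕ c ⊕ d) ⊜ p ⊕ (p₁ ⊕ p₂) ⊕ (a ⊕ b ⊕ c ⊕ d)) ↭-refl

  NoEdges : ∀ {A : Set} → (A → A → Set) → List A → List A → Set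
  NoEdges E xs ys = ∀ {x y} → x ∈ xs → y ∈ ys → ¬ E x y

  -- The search is interrupted when the finished and the untouched vertices are equally many.
  module DFS {A : Set} (E : A → A → Set) (E? : ∀ x y → Dec (E x y)) (E-sym : ∀ {x y} → E x y → E y x) where

    record Result (V : List A) : Set where
      constructor result
      field
        P S T    : List A
        isPath   : IsPath E P
        perm     : V ↭ P ++ S ++ T
        balanced : length S ≡ length T
        noEdges  : NoEdges E S T

    -- `k` is the lead of the untouched vertices over the finished ones. Each step either takes a
    -- vertex from `T` or puts one into `S`, so the lead falls by exactly one and cannot jump over
    -- zero.
    search : ∀ k {V} P S T → IsPath E P → V ↭ P ++ S ++ T → length T ≡ k + length S → NoEdges E S T → Result V
    search zero P S T isP perm len ne = result P S T isP perm (sym len) ne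
    search (suc k) [] S (t ∷ T) isP perm len ne =
      search k (t ∷ []) S T (path [ t ]) (↭trans perm (shift t S T)) (suc-injective len) (λ s∈ t∈ → ne s∈ (there t∈))
    search (suc k) (p ∷ P) S T isP perm len ne with any? (E? p) T
    search (suc k) (p ∷ P) S T (path q) perm len ne | yes a with find a
    ... | t , t∈ , e with ∈⇒↭ t∈
    ...   | T′ , r = search k (t ∷ p ∷ P) S T′ (extend q)
                       (↭trans perm (↭trans (++⁺ˡ (p ∷ P) (↭trans (++⁺ˡ S r) (shift t S T′))) (shift t (p ∷ P) (S ++ T′))))
                       (suc-injective (trans (sym (↭-length r)) len))
                       (λ s∈ t∈′ → ne s∈ (∈-resp-↭ (↭-sym r) (there t∈′)))
      where
      extend : ∀ {a b} → Path E a (p ∷ P) b → IsPath E (t ∷ p ∷ P)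
      extend q@([ _ ])    = path (step (E-sym e) q)
      extend q@(step _ _) = path (step (E-sym e) q)
    -- The head of the path has no neighbour left in `T`, so it may join `S`.
    search (suc k) (p ∷ P) S T isP perm len ne | no ¬a =
      search k P (p ∷ S) T (pop isP) (↭trans perm (↭-sym (shift p P (S ++ T)))) (trans len (sym (+-suc k _)))
        λ { (here refl) t∈ e → ¬a (lose t∈ e) ; (there s∈) t∈ → ne s∈ t∈ }
      where
      pop : IsPath E (p ∷ P) → IsPath E P
      pop (path [ _ ])      = empty
      pop (path (step _ q)) = path q

    dfs : ∀ V → Result V
    dfs V = search (length V) [] [] V empty ↭-refl (sym (+-identityʳ _)) λ ()

  -- Bipartite search on vertices tagged by their side

  module _ {A : Set} where

    tag? : ∀ s → Decidable (λ (x : Bool × A) → proj₁ x ≡ s)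
    tag? s x = proj₁ x ≟ᴮ s

    sel : Bool → List (Bool × A) → List A
    sel s L = map proj₂ (filter (tag? s) L)

    sel-∈ : ∀ s {x} L → x ∈ sel s L → (s , x) ∈ L
    sel-∈ s L x∈ with ∈-map⁻ proj₂ x∈
    ... | y , y∈ , refl with ∈-filter⁻ (tag? s) {xs = L} y∈
    ...   | y∈L , refl = y∈L

    sel-↭ : ∀ s {L L′} → L ↭ L′ → sel s L ↭ sel s L′
    sel-↭ s p = ↭-map⁺ proj₂ (filter-↭ (tag? s) p)

    sel-++ : ∀ s L L′ → sel s (L ++ L′) ≡ sel s L ++ sel s L′
    sel-++ s L L′ = trans (cong (map proj₂) (filter-++ (tag? s) L L′)) (map-++ proj₂ (filter (tag? s) L) (filter (tag? s) L′))

    untag-↭ : ∀ L → map proj₂ L ↭ sel true L ++ sel false L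
    untag-↭ []                = ↭-refl
    untag-↭ ((true  , x) ∷ L) = prep x (untag-↭ L)
    untag-↭ ((false , x) ∷ L) = ↭trans (prep x (untag-↭ L)) (↭-sym (shift x (sel true L) (sel false L)))

    sel-length : ∀ L → length (sel true L) + length (sel false L) ≡ length L
    sel-length L = trans (sym (trans (↭-length (untag-↭ L)) (length-++ (sel true L)))) (length-map proj₂ L)

    tagged : List A → List A → List (Bool × A)
    tagged X Y = map (true ,_) X ++ map (false ,_) Y

    sel-true-tagged : ∀ X Y → sel true (tagged X Y) ≡ X
    sel-true-tagged []      []      = refl
    sel-true-tagged []      (y ∷ Y) = sel-true-tagged [] Y
    sel-true-tagged (x ∷ X) Y       = cong (x ∷_) (sel-true-tagged X Y)

    sel-false-tagged : ∀ X Y → sel false (tagged X Y) ≡ Y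
    sel-false-tagged []      []      = refl
    sel-false-tagged []      (y ∷ Y) = cong (y ∷_) (sel-false-tagged [] Y)
    sel-false-tagged (x ∷ X) Y       = sel-false-tagged X Y

  odd≢even : ∀ a b → suc (a + a) ≢ b + b
  odd≢even a b eq with a <? b
  ... | yes a<b = <⇒≢ (≤-trans (≤-reflexive (cong suc (sym (+-suc a a)))) (+-mono-≤ a<b a<b)) eq
  ... | no ≮    = <⇒≢ (s≤s (+-mono-≤ (≮⇒≥ ≮) (≮⇒≥ ≮))) (sym eq)

  module Bipartite {A : Set} (E : A → A → Set) (E? : ∀ x y → Dec (E x y)) (E-sym : ∀ {x y} → E x y → E y x) where

    Cross : Bool × A → Bool × A → Set
    Cross (s , x) (t , y) = s ≢ t × E x y

    cross? : ∀ u v → Dec (Cross u v)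
    cross? (s , x) (t , y) = ¬? (s ≟ᴮ t) ×-dec E? x y

    cross-sym : ∀ {u v} → Cross u v → Cross v u
    cross-sym (s≢ , e) = s≢ ∘ sym , E-sym e

    record Result (X Y : List A) : Set where
      field
        P X₁ Y₁ X₂ Y₂ : List A
        isPath : IsPath E P
        even   : ∃ λ a → length P ≡ a + a
        perm   : X ++ Y ↭ P ++ (X₁ ++ Y₁) ++ (X₂ ++ Y₂)
        bal₁   : length X₁ ≡ length Y₁
        bal₂   : length X₂ ≡ length Y₂
        X₁⊆    : ∀ {x} → x ∈ X₁ → x ∈ X
        Y₁⊆    : ∀ {x} → x ∈ Y₁ → x ∈ Y
        X₂⊆    : ∀ {x} → x ∈ X₂ → x ∈ X
        Y₂⊆    : ∀ {x} → x ∈ Y₂ → x ∈ Y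
        no₁    : NoEdges E X₁ Y₁
        no₂    : NoEdges E X₂ Y₂

    #t #f : List (Bool × A) → ℕ
    #t L = length (sel true L)
    #f L = length (sel false L)

    -- The first argument is the side of the starting vertex: on an alternating path only that side
    -- can be ahead, and by at most one.
    Near : Bool → List (Bool × A) → Set
    Near true  L = #t L ≡ #f L ⊎ #t L ≡ suc (#f L)
    Near false L = #f L ≡ #t L ⊎ #f L ≡ suc (#t L)

    alternate : ∀ {a L b} → Path Cross a L b → Near (proj₁ a) L
    alternate [ true , _ ]  = inj₂ refl
    alternate [ false , _ ] = inj₂ refl
    alternate (step {a = true , x} {b = true , y} (s≢ , _) p)   = contradiction refl s≢
    alternate (step {a = false , x} {b = false , y} (s≢ , _) p) = contradiction refl s≢
    alternate (step {a = true , x} {b = false , y} _ p) with alternate p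
    ... | inj₁ e = inj₂ (cong suc (sym e))
    ... | inj₂ e = inj₁ (sym e)
    alternate (step {a = false , x} {b = true , y} _ p) with alternate p
    ... | inj₁ e = inj₂ (cong suc (sym e))
    ... | inj₂ e = inj₁ (sym e)

    near : ∀ {L} → IsPath Cross L → #t L ≡ #f L ⊎ #t L ≡ suc (#f L) ⊎ #f L ≡ suc (#t L)
    near empty = inj₁ refl
    near (path {a = true , _} p) with alternate p
    ... | inj₁ e = inj₁ e
    ... | inj₂ e = inj₂ (inj₁ e)
    near (path {a = false , _} p) with alternate p
    ... | inj₁ e = inj₁ (sym e)
    ... | inj₂ e = inj₂ (inj₂ e)

    -- Each of the final sets `S` and `T` is split by side: the left part of `S` faces the right
    -- part of `T`, and vice versa. Since the path uses both sides equally, the sizes of the four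
    -- parts satisfy two linear equations that make both holes balanced.
    bipartite : ∀ X Y → length X ≡ length Y → Result X Y
    bipartite X Y |X|≡|Y| = record
      { P = map proj₂ P ; X₁ = sel true S ; Y₁ = sel false T ; X₂ = sel true T ; Y₂ = sel false S
      ; isPath = mapIsPath proj₂ proj₂ isPath
      ; even = #f P , trans (length-map proj₂ P) (trans (sym (sel-length P)) (cong (_+ #f P) Pbal))
      ; perm = perm′
      ; bal₁ = halve (lin′₁ (#t S) (#t T) (#f S) (#f T) ST side)
      ; bal₂ = halve (lin′₂ (#t S) (#t T) (#f S) (#f T) ST side)
      ; X₁⊆ = λ x∈ → inX (∈-++⁺ʳ (sel true P) (∈-++⁺ˡ x∈))
      ; Y₁⊆ = λ x∈ → inY (∈-++⁺ʳ (sel false P) (∈-++⁺ʳ (sel false S) x∈))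
      ; X₂⊆ = λ x∈ → inX (∈-++⁺ʳ (sel true P) (∈-++⁺ʳ (sel true S) x∈))
      ; Y₂⊆ = λ x∈ → inY (∈-++⁺ʳ (sel false P) (∈-++⁺ˡ x∈))
      ; no₁ = λ x∈ y∈ e → noEdges (sel-∈ true S x∈) (sel-∈ false T y∈) ((λ ()) , e)
      ; no₂ = λ x∈ y∈ e → noEdges (sel-∈ false S y∈) (sel-∈ true T x∈) ((λ ()) , E-sym e)
      }
      where
      open DFS Cross cross? cross-sym
      open DFS.Result (dfs (tagged X Y))
      halve : ∀ {a b} → a + a ≡ b + b → a ≡ b
      halve e = ≤-antisym (half-≤ (≤-reflexive e)) (half-≤ (≤-reflexive (sym e)))
      selX : X ↭ sel true P ++ sel true S ++ sel true T
      selX = subst₂ _↭_ (sel-true-tagged X Y)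
        (trans (sel-++ true P (S ++ T)) (cong (sel true P ++_) (sel-++ true S T))) (sel-↭ true perm)
      selY : Y ↭ sel false P ++ sel false S ++ sel false T
      selY = subst₂ _↭_ (sel-false-tagged X Y)
        (trans (sel-++ false P (S ++ T)) (cong (sel false P ++_) (sel-++ false S T))) (sel-↭ false perm)
      inX : ∀ {x} → x ∈ sel true P ++ sel true S ++ sel true T → x ∈ X
      inX = ∈-resp-↭ (↭-sym selX)
      inY : ∀ {x} → x ∈ sel false P ++ sel false S ++ sel false T → x ∈ Y
      inY = ∈-resp-↭ (↭-sym selY)
      len₃ : ∀ (a b c : List A) → length (a ++ b ++ c) ≡ length a + (length b + length c)
      len₃ a b c = trans (length-++ a) (cong (length a +_) (length-++ b))
      total : #t P + (#t S + #t T) ≡ #f P + (#f S + #f T)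
      total = trans (sym (trans (↭-length selX) (len₃ (sel true P) (sel true S) (sel true T))))
                    (trans |X|≡|Y| (trans (↭-length selY) (len₃ (sel false P) (sel false S) (sel false T))))
      ST : #t S + #f S ≡ #t T + #f T
      ST = trans (sel-length S) (trans balanced (sym (sel-length T)))
      alg : ∀ p q st sf rt rf → p + (st + rt) ≡ q + (sf + rf) → st + sf ≡ rt + rf → p + q + ((st + sf) + (st + sf)) ≡
            q + (sf + rf) + (q + (sf + rf))
      alg p q st sf rt rf e₁ e₂ = trans (cong (λ w → p + q + (st + sf + w)) e₂)
        (trans (rearr p q st sf rt rf) (cong (_+ (q + (sf + rf))) e₁))
        where
        rearr : ∀ p q st sf rt rf → p + q + (st + sf + (rt + rf)) ≡ p + (st + rt) + (q + (sf + rf))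
        rearr = solve-∀
      -- By alternation the two sides of the path differ by at most one. Its length is even, being
      -- `2|X|` minus `2|S|`, so they do not differ.
      Pbal : #t P ≡ #f P
      Pbal with near isPath
      ... | inj₁ e = e
      ... | inj₂ (inj₁ e) = contradiction (trans (odd (#f P) (#t S + #f S))
              (trans (cong (λ w → w + #f P + (#t S + #f S + (#t S + #f S))) (sym e))
                (alg (#t P) (#f P) (#t S) (#f S) (#t T) (#f T) total ST)))
              (odd≢even (#f P + (#t S + #f S)) (#f P + (#f S + #f T)))
        where
        odd : ∀ q r → suc (q + r + (q + r)) ≡ suc q + q + (r + r)
        odd = solve-∀
      ... | inj₂ (inj₂ e) = contradiction (trans (odd (#t P) (#t S + #f S))
              (trans (cong (λ w → #t P + w + (#t S + #f S + (#t S + #f S))) (sym e))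
                (alg (#t P) (#f P) (#t S) (#f S) (#t T) (#f T) total ST)))
              (odd≢even (#t P + (#t S + #f S)) (#f P + (#f S + #f T)))
        where
        odd : ∀ q r → suc (q + r + (q + r)) ≡ q + suc q + (r + r)
        odd = solve-∀
      side : #t S + #t T ≡ #f S + #f T
      side = +-cancelˡ-≡ (#f P) _ _ (trans (cong (_+ (#t S + #t T)) (sym Pbal)) total)
      lin′₁ : ∀ st rt sf rf → st + sf ≡ rt + rf → st + rt ≡ sf + rf → st + st ≡ rf + rf
      lin′₁ st rt sf rf e₁ e₂ = +-cancelʳ-≡ (rt + sf) _ _ (trans (r₁ st rt sf) (trans (cong₂ _+_ e₁ e₂) (r₂ rt sf rf)))
        where
        r₁ : ∀ st rt sf → st + st + (rt + sf) ≡ st + sf + (st + rt)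
        r₁ = solve-∀
        r₂ : ∀ rt sf rf → rt + rf + (sf + rf) ≡ rf + rf + (rt + sf)
        r₂ = solve-∀
      lin′₂ : ∀ st rt sf rf → st + sf ≡ rt + rf → st + rt ≡ sf + rf → rt + rt ≡ sf + sf
      lin′₂ st rt sf rf e₁ e₂ = +-cancelʳ-≡ (st + rf) _ _
        (trans (r₁ st rt rf) (trans (cong₂ _+_ (sym e₁) e₂) (r₂ st sf rf)))
        where
        r₁ : ∀ st rt rf → rt + rt + (st + rf) ≡ rt + rf + (st + rt)
        r₁ = solve-∀
        r₂ : ∀ st sf rf → st + sf + (sf + rf) ≡ sf + sf + (st + rf)
        r₂ = solve-∀
      perm′ : X ++ Y ↭ map proj₂ P ++ (sel true S ++ sel false T) ++ (sel true T ++ sel false S)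
      perm′ = ↭trans (++⁺ selX selY) (↭trans
        (↭-regroup (sel true P) (sel false P) (sel true S) (sel false S) (sel true T) (sel false T))
        (++⁺ʳ _ (↭-sym (untag-↭ P))))

  -- Path covers and linking

  -- Evenness excludes single vertices: every vertex of a nonempty such path lies on an edge.
  EvenPath : ∀ {A : Set} → (A → A → Set) → List A → Set
  EvenPath E xs = IsPath E xs × ∃ λ a → length xs ≡ a + a

  Hole : Set → Set
  Hole A = List A × List A

  concatH : ∀ {A : Set} → List (Hole A) → List A
  concatH []            = []
  concatH ((X , Y) ∷ H) = (X ++ Y) ++ concatH H

  concatH-++ : ∀ {A : Set} (H H′ : List (Hole A)) → concatH (H ++ H′) ≡ concatH H ++ concatH H′
  concatH-++ []            H′ = refl
  concatH-++ ((X , Y) ∷ H) H′ = trans (cong ((X ++ Y) ++_) (concatH-++ H H′)) (sym (++-assoc (X ++ Y) _ _))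

  flat-↭ : ∀ {A : Set} (M : List (A × A)) → flat M ↭ map proj₁ M ++ map proj₂ M
  flat-↭ []            = ↭-refl
  flat-↭ ((u , v) ∷ M) = prep u (↭trans (prep v (flat-↭ M)) (↭-sym (shift v (map proj₁ M) (map proj₂ M))))

  module Cover {A : Set} (E₁ E₂ : A → A → Set)
    (E₁? : ∀ x y → Dec (E₁ x y)) (E₂? : ∀ x y → Dec (E₂ x y))
    (sym₁ : ∀ {x y} → E₁ x y → E₁ y x) (sym₂ : ∀ {x y} → E₂ x y → E₂ y x) where

    IsHole : (A → A → Set) → Hole A → Set
    IsHole Ok (X , Y) = length X ≡ length Y × NoEdges E₁ X Y × NoEdges E₂ X Y × (∀ {x y} → x ∈ X → y ∈ Y → Ok x y)

    -- `k` counts pairs of types. Each of them yields one path from the search in the first colour,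
    -- two from the searches of its two holes in the second colour, and four final holes.
    record PathCover (Ok : A → A → Set) (k : ℕ) (V : List A) : Set where
      constructor pathCover
      field
        ps₁ ps₂ : List (List A)
        holes   : List (Hole A)
        |ps₁|   : length ps₁ ≡ k
        |ps₂|   : length ps₂ ≡ k + k
        |holes| : length holes ≡ k * 4
        all₁    : All (EvenPath E₁) ps₁
        all₂    : All (EvenPath E₂) ps₂
        allH    : All (IsHole Ok) holes
        perm    : V ↭ concat ps₁ ++ concat ps₂ ++ concatH holes

    merge : ∀ {Ok j k V W} → PathCover Ok j V → PathCover Ok k W → PathCover Ok (j + k) (V ++ W)
    merge {j = j} {k} (pathCover p q h a b c d e f π) (pathCover p′ q′ h′ a′ b′ c′ d′ e′ f′ π′) =
      pathCover (p ++ p′) (q ++ q′) (h ++ h′)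
        (trans (length-++ p) (cong₂ _+_ a a′))
        (trans (length-++ q) (trans (cong₂ _+_ b b′) (eq j k)))
        (trans (length-++ h) (trans (cong₂ _+_ c c′) (sym (*-distribʳ-+ 4 j k))))
        (All-++⁺ d d′) (All-++⁺ e e′) (All-++⁺ f f′)
        (↭trans (++⁺ π π′) (↭trans
          (↭-zip₃ (concat p) (concat q) (concatH h) (concat p′) (concat q′) (concatH h′))
          (↭-reflexive (sym (cong₂ _++_ (concat-++′ p p′) (cong₂ _++_ (concat-++′ q q′) (concatH-++ h h′)))))))
      where
      concat-++′ : ∀ (xs ys : List (List A)) → concat (xs ++ ys) ≡ concat xs ++ concat ys
      concat-++′ []       ys = refl
      concat-++′ (x ∷ xs) ys = trans (cong (x ++_) (concat-++′ xs ys)) (sym (++-assoc x _ _))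
      eq : ∀ j k → j + j + (k + k) ≡ j + k + (j + k)
      eq = solve-∀

    coverPair : ∀ {Ok} X Y → length X ≡ length Y → (∀ {x y} → x ∈ X → y ∈ Y → Ok x y) → PathCover Ok 1 (X ++ Y)
    coverPair X Y |X|≡|Y| ok = pathCover (R.P ∷ []) (R₁.P ∷ R₂.P ∷ [])
      ((R₁.X₁ , R₁.Y₁) ∷ (R₁.X₂ , R₁.Y₂) ∷ (R₂.X₁ , R₂.Y₁) ∷ (R₂.X₂ , R₂.Y₂) ∷ []) refl refl refl
      ((R.isPath , R.even) ∷ []) ((R₁.isPath , R₁.even) ∷ (R₂.isPath , R₂.even) ∷ [])
      ( (R₁.bal₁ , (λ x∈ y∈ → R.no₁ (R₁.X₁⊆ x∈) (R₁.Y₁⊆ y∈)) , R₁.no₁ , λ x∈ y∈ → ok (R.X₁⊆ (R₁.X₁⊆ x∈)) (R.Y₁⊆ (R₁.Y₁⊆ y∈)))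
      ∷ (R₁.bal₂ , (λ x∈ y∈ → R.no₁ (R₁.X₂⊆ x∈) (R₁.Y₂⊆ y∈)) , R₁.no₂ , λ x∈ y∈ → ok (R.X₁⊆ (R₁.X₂⊆ x∈)) (R.Y₁⊆ (R₁.Y₂⊆ y∈)))
      ∷ (R₂.bal₁ , (λ x∈ y∈ → R.no₂ (R₂.X₁⊆ x∈) (R₂.Y₁⊆ y∈)) , R₂.no₁ , λ x∈ y∈ → ok (R.X₂⊆ (R₂.X₁⊆ x∈)) (R.Y₂⊆ (R₂.Y₁⊆ y∈)))
      ∷ (R₂.bal₂ , (λ x∈ y∈ → R.no₂ (R₂.X₂⊆ x∈) (R₂.Y₂⊆ y∈)) , R₂.no₂ , λ x∈ y∈ → ok (R.X₂⊆ (R₂.X₂⊆ x∈)) (R.Y₂⊆ (R₂.Y₂⊆ y∈)))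
      ∷ [])
      (↭trans R.perm (↭trans (++⁺ˡ R.P (++⁺ R₁.perm R₂.perm)) (↭trans
        (↭-collect R.P R₁.P (R₁.X₁ ++ R₁.Y₁) (R₁.X₂ ++ R₁.Y₂) R₂.P (R₂.X₁ ++ R₂.Y₁) (R₂.X₂ ++ R₂.Y₂))
        (↭-reflexive (cong₂ _++_ (sym (++-identityʳ R.P)) (cong₂ _++_
          (cong (R₁.P ++_) (sym (++-identityʳ R₂.P)))
          (cong (λ w → (R₁.X₁ ++ R₁.Y₁) ++ (R₁.X₂ ++ R₁.Y₂) ++ (R₂.X₁ ++ R₂.Y₁) ++ w)
            (sym (++-identityʳ (R₂.X₂ ++ R₂.Y₂))))))))))
      where
      module R = Bipartite.Result (Bipartite.bipartite E₁ E₁? sym₁ X Y |X|≡|Y|)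
      module R₁ = Bipartite.Result (Bipartite.bipartite E₂ E₂? sym₂ R.X₁ R.Y₁ R.bal₁)
      module R₂ = Bipartite.Result (Bipartite.bipartite E₂ E₂? sym₂ R.X₂ R.Y₂ R.bal₂)

    module _ {T : Set} (_≟ᵀ_ : DecidableEquality T) (τ : A → T) {Ok : A → A → Set} where

      -- The matched pairs are sorted by key. The hypothesis on `Ok` mixes ends of different pairs,
      -- so within one key every left end is compatible with every right end, as `coverPair`
      -- demands.
      coverMatching : ∀ (keys : List (T × T)) M →
        (∀ {u v} → (u , v) ∈ M → (τ u , τ v) ∈ keys) →
        (∀ {u v u′ v′} → (u , v) ∈ M → (u′ , v′) ∈ M → τ u ≡ τ u′ → τ v ≡ τ v′ → Ok u v′) →
        PathCover Ok (length keys) (flat M)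
      coverMatching [] [] inKeys ok = pathCover [] [] [] refl refl refl [] [] [] ↭-refl
      coverMatching [] (_ ∷ _) inKeys ok with inKeys (here refl)
      ... | ()
      coverMatching (k ∷ keys) M inKeys ok =
        let open PathCover (merge (coverPair X Y (trans (length-map proj₁ Mk) (sym (length-map proj₂ Mk))) okk)
                   (coverMatching keys Mr inKeys′ (λ a b → ok (Mr⊆ a) (Mr⊆ b))))
        in record { PathCover (merge (coverPair X Y (trans (length-map proj₁ Mk) (sym (length-map proj₂ Mk))) okk)
                     (coverMatching keys Mr inKeys′ (λ a b → ok (Mr⊆ a) (Mr⊆ b))))
                  ; perm = ↭trans (split M) (↭trans (++⁺ʳ (flat Mr) (flat-↭ Mk)) perm) }
        where
        _≟ᴷ_ : DecidableEquality (T × T)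
        _≟ᴷ_ = Data.Product.Properties.≡-dec _≟ᵀ_ _≟ᵀ_
          where import Data.Product.Properties
        key? : Decidable (λ uv → (τ (proj₁ uv) , τ (proj₂ uv)) ≡ k)
        key? uv = _ ≟ᴷ k
        Mk = filter key? M
        Mr = filter (¬? ∘ key?) M
        X = map proj₁ Mk
        Y = map proj₂ Mk
        Mr⊆ : ∀ {uv} → uv ∈ Mr → uv ∈ M
        Mr⊆ uv∈ = proj₁ (∈-filter⁻ (¬? ∘ key?) {xs = M} uv∈)
        okk : ∀ {x y} → x ∈ X → y ∈ Y → Ok x y
        okk x∈ y∈ with ∈-map⁻ proj₁ x∈ | ∈-map⁻ proj₂ y∈
        ... | uv , uv∈ , refl | uv′ , uv′∈ , refl with ∈-filter⁻ key? {xs = M} uv∈ | ∈-filter⁻ key? {xs = M} uv′∈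
        ...   | m , e | m′ , e′ = ok m m′ (cong proj₁ (trans e (sym e′))) (cong proj₂ (trans e (sym e′)))
        inKeys′ : ∀ {u v} → (u , v) ∈ Mr → (τ u , τ v) ∈ keys
        inKeys′ uv∈ with ∈-filter⁻ (¬? ∘ key?) {xs = M} uv∈
        ... | m , ¬e with inKeys m
        ...   | here e   = contradiction e ¬e
        ...   | there k∈ = k∈
        split : ∀ M → flat M ↭ flat (filter key? M) ++ flat (filter (¬? ∘ key?) M)
        split [] = ↭-refl
        split ((u , v) ∷ M) with key? (u , v)
        ... | yes _ = prep u (prep v (split M))
        ... | no _  = ↭trans (prep u (prep v (split M))) (↭-sym (shifts (flat (filter key? M)) (u ∷ v ∷ [])))

  Unique-↭ : ∀ {A : Set} {xs ys : List A} → xs ↭ ys → Unique xs → Unique ys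
  Unique-↭ {A} p = PermSetoid.Unique-resp-↭ (≡-setoid A) (↭⇒↭ₛ p)

  Unique-++⁻ : ∀ {A : Set} (xs : List A) {ys} → Unique (xs ++ ys) →
               Unique xs × Unique ys × (∀ {v} → v ∈ xs → v ∉ ys)
  Unique-++⁻ []       u        = [] , u , λ ()
  Unique-++⁻ (x ∷ xs) (x≢ ∷ u) with Unique-++⁻ xs u
  ... | u₁ , u₂ , d = All.tabulate (λ v∈ → All.lookup x≢ (∈-++⁺ˡ v∈)) ∷ u₁ , u₂ ,
    λ { (here refl) v∈ → All.lookup x≢ (∈-++⁺ʳ xs v∈) refl ; (there v∈) → d v∈ }

  joinPath : ∀ {A : Set} {E : A → A → Set} {a xs b c ys d} → Path E a xs b → E b c → Path E c ys d → Path E a (xs ++ ys) d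
  joinPath [ a ]      e q = step e q
  joinPath (step f p) e q = step f (joinPath p e q)

  -- Each hub is spent on a single link, so one path inside it between any entry and exit is enough.
  record IsHub {A : Set} (E : A → A → Set) (h : List A) : Set where
    field
      unique    : Unique h
      connected : ∀ {a b} → a ∈ h → b ∈ h → ∃ λ xs → Path E a xs b × Unique xs × (∀ {v} → v ∈ xs → v ∈ h)

  IsCycle : ∀ {A : Set} → (A → A → Set) → List A → Set
  IsCycle E xs = xs ≡ [] ⊎ ∃₂ λ a b → Path E a xs b × E b a

  -- Linking paths through hubs into one cycle

  module Link {A : Set} (E U : A → A → Set) (E-sym : ∀ {x y} → E x y → E y x)
    (U⇒E : ∀ {x y} → U x y → E x y) (hubs : List (List A))
    (dominated : ∀ {x y h} → U x y → h ∈ hubs → Any (E x) h)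
    (U-sym : ∀ {x y} → U x y → U y x) where

    Good : A → Set
    Good v = ∀ {h} → h ∈ hubs → Any (E v) h

    IsChain : List A → Set
    IsChain xs = xs ≡ [] ⊎ ∃₂ λ a b → Path E a xs b × Good a × Good b

    evenPath⇒chain : ∀ {xs} → EvenPath U xs → IsChain xs
    evenPath⇒chain (empty , _) = inj₁ refl
    evenPath⇒chain (path [ a ] , zero , ())
    evenPath⇒chain (path [ a ] , suc k , eq) = contradiction (suc-injective (trans eq (cong suc (+-suc k k)))) λ ()
    evenPath⇒chain (path (step e p) , _) = inj₂ (_ , _ , mapE (step e p) , dominated e , last e p)
      where
      mapE : ∀ {a xs b} → Path U a xs b → Path E a xs b
      mapE [ a ]      = [ a ]
      mapE (step e p) = step (U⇒E e) (mapE p)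
      last : ∀ {a b xs c} → U a b → Path U b xs c → Good c
      last e [ _ ]      = dominated (U-sym e)
      last _ (step e p) = last e p

    bridge : ∀ {b c h} → IsHub E h → h ∈ hubs → Good b → Good c →
             ∃ λ xs → Unique xs × (∀ {v} → v ∈ xs → v ∈ h) × ∃₂ λ w w′ → Path E w xs w′ × E b w × E w′ c
    bridge hub h∈ gb gc with find (gb h∈) | find (gc h∈)
    ... | w , w∈ , e | w′ , w′∈ , e′ with IsHub.connected hub w∈ w′∈
    ...   | xs , p , u , xs⊆ = xs , u , xs⊆ , w , w′ , p , e , E-sym e′

    -- `inside` serves the disjointness arguments and `long` the count of covered vertices; no exact
    -- description of the vertex set is needed.
    record Chain (ps hs : List (List A)) : Set where
      constructor chainOf
      field
        verts   : List A
        isChain : IsChain verts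
        unique  : Unique verts
        inside  : ∀ {v} → v ∈ verts → v ∈ concat ps ⊎ v ∈ concat hs
        long    : length (concat ps) ≤ length verts

    chain : ∀ ps hs → length ps ≤ length hs → All (EvenPath U) ps → (∀ {h} → h ∈ hs → h ∈ hubs) → All (IsHub E) hs →
            Unique (concat ps) → Unique (concat hs) → (∀ {v} → v ∈ concat ps → v ∉ concat hs) → Chain ps hs
    chain [] hs le ep h⊆ ih up uh dis = chainOf [] (inj₁ refl) [] (λ ()) z≤n
    chain (p ∷ ps) (h ∷ hs) (s≤s le) (e ∷ ep) h⊆ (ih ∷ ihs) up uh dis
      with Unique-++⁻ p up | Unique-++⁻ h uh
    ... | u₁ , u₂ , d | v₁ , v₂ , d′
      with evenPath⇒chain e | chain ps hs le ep (h⊆ ∘ there) ihs u₂ v₂ (λ a b → dis (∈-++⁺ʳ p a) (∈-++⁺ʳ h b))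
    ... | inj₁ refl | chainOf xs c u ins long = chainOf xs c u (λ v∈ → weaken (ins v∈)) long
      where
      weaken : ∀ {v} → v ∈ concat ps ⊎ v ∈ concat hs → v ∈ concat ps ⊎ v ∈ concat (h ∷ hs)
      weaken (inj₁ a) = inj₁ a
      weaken (inj₂ b) = inj₂ (∈-++⁺ʳ h b)
    -- No path follows, so `p` is the whole chain and the hub `h` stays unspent.
    ... | c@(inj₂ _) | chainOf [] _ _ _ long = chainOf p c u₁ (λ v∈ → inj₁ (∈-++⁺ˡ v∈))
            (≤-trans (≤-reflexive (length-++ p)) (≤-trans (+-monoʳ-≤ (length p) long) (≤-reflexive (+-identityʳ _))))
    ... | inj₂ (a , b , pp , ga , gb) | chainOf xs@(_ ∷ _) (inj₂ (a′ , b′ , qq , ga′ , gb′)) u ins long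
      with bridge ih (h⊆ (here refl)) gb ga′
    ... | ys , uy , ys⊆ , w , w′ , r , e₁ , e₂ =
      chainOf (p ++ ys ++ xs) (inj₂ (a , b′ , joinPath pp e₁ (joinPath r e₂ qq) , ga , gb′))
        (Unique-++⁺ u₁ (Unique-++⁺ uy u d₁) d₂) ins′
        (≤-trans (≤-reflexive (length-++ p)) (≤-trans (+-monoʳ-≤ (length p)
          (≤-trans long (≤-trans (m≤n+m _ (length ys)) (≤-reflexive (sym (length-++ ys))))))
          (≤-reflexive (sym (length-++ p)))))
      where
      d₁ : ∀ {v} → v ∈ ys × v ∈ xs → ⊥
      d₁ (y∈ , x∈) with ins x∈
      ... | inj₁ i = dis (∈-++⁺ʳ p i) (∈-++⁺ˡ (ys⊆ y∈))
      ... | inj₂ j = d′ (ys⊆ y∈) j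
      d₂ : ∀ {v} → v ∈ p × v ∈ ys ++ xs → ⊥
      d₂ (p∈ , q∈) with ∈-++⁻ ys q∈
      ... | inj₁ y∈ = dis (∈-++⁺ˡ p∈) (∈-++⁺ˡ (ys⊆ y∈))
      ... | inj₂ x∈ with ins x∈
      ...   | inj₁ i = d p∈ i
      ...   | inj₂ j = dis (∈-++⁺ˡ p∈) (∈-++⁺ʳ h j)
      ins′ : ∀ {v} → v ∈ p ++ ys ++ xs → v ∈ concat (p ∷ ps) ⊎ v ∈ concat (h ∷ hs)
      ins′ v∈ with ∈-++⁻ p v∈
      ... | inj₁ i = inj₁ (∈-++⁺ˡ i)
      ... | inj₂ j with ∈-++⁻ ys j
      ...   | inj₁ y∈ = inj₂ (∈-++⁺ˡ (ys⊆ y∈))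
      ...   | inj₂ x∈ with ins x∈
      ...     | inj₁ i = inj₁ (∈-++⁺ʳ p i)
      ...     | inj₂ j = inj₂ (∈-++⁺ʳ h j)

    record LinkedCycle (ps hs : List (List A)) : Set where
      constructor linkedCycle
      field
        verts   : List A
        isCycle : IsCycle E verts
        unique  : Unique verts
        inside  : ∀ {v} → v ∈ verts → v ∈ concat ps ⊎ v ∈ concat hs
        long    : length (concat ps) ≤ length verts

    -- One hub is kept back to return from the end of the chain to its start, whence the strict
    -- inequality. It contributes at least one vertex, so even a single edge closes up to a triangle
    -- or a longer cycle.
    close : ∀ ps hs → length ps < length hs → All (EvenPath U) ps → (∀ {h} → h ∈ hs → h ∈ hubs) → All (IsHub E) hs →
            Unique (concat ps) → Unique (concat hs) → (∀ {v} → v ∈ concat ps → v ∉ concat hs) → LinkedCycle ps hs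
    close ps (h ∷ hs) (s≤s le) ep h⊆ (ih ∷ ihs) up uh dis with Unique-++⁻ h uh
    ... | v₁ , v₂ , d′ with chain ps hs le ep (h⊆ ∘ there) ihs up v₂ (λ a b → dis a (∈-++⁺ʳ h b))
    ... | chainOf xs (inj₁ e) u ins long = linkedCycle xs (inj₁ e) u
            (λ v∈ → contradiction (subst (_ ∈_) e v∈) λ ()) long
    ... | chainOf xs (inj₂ (a , b , p , ga , gb)) u ins long
      with bridge ih (h⊆ (here refl)) gb ga
    ... | ys , uy , ys⊆ , w , w′ , r , e₁ , e₂ =
      linkedCycle (xs ++ ys) (inj₂ (a , w′ , joinPath p e₁ r , e₂)) (Unique-++⁺ u uy d) ins′
        (≤-trans long (≤-trans (m≤m+n _ (length ys)) (≤-reflexive (sym (length-++ xs)))))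
      where
      d : ∀ {v} → v ∈ xs × v ∈ ys → ⊥
      d (x∈ , y∈) with ins x∈
      ... | inj₁ i = dis i (∈-++⁺ˡ (ys⊆ y∈))
      ... | inj₂ j = d′ (ys⊆ y∈) j
      ins′ : ∀ {v} → v ∈ xs ++ ys → v ∈ concat ps ⊎ v ∈ concat (h ∷ hs)
      ins′ v∈ with ∈-++⁻ xs v∈
      ... | inj₂ y∈ = inj₂ (∈-++⁺ˡ (ys⊆ y∈))
      ... | inj₁ x∈ with ins x∈
      ...   | inj₁ i = inj₁ i
      ...   | inj₂ j = inj₂ (∈-++⁺ʳ h j)

  -- Robust components

  cnt-members : ∀ {A : Set} (_≟ᴬ_ : DecidableEquality A) {xs} → Unique xs → (F : List A) →
                cnt (λ v → any? (v ≟ᴬ_) F) xs ≤ length F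
  cnt-members _≟ᴬ_ {xs} u []      = ≤-reflexive (∑-zero xs (λ _ → refl))
  cnt-members _≟ᴬ_ {xs} u (f ∷ F) = ≤-trans
    (cnt-⊎ (λ v → any? (v ≟ᴬ_) (f ∷ F)) (_≟ᴬ f) (λ v → any? (v ≟ᴬ_) F) xs
      (λ { _ (here e) → inj₁ e ; _ (there a) → inj₂ a }))
    (+-mono-≤ (once u) (cnt-members _≟ᴬ_ u F))
    where
    once : ∀ {xs} → Unique xs → cnt (_≟ᴬ f) xs ≤ 1
    once []                       = z≤n
    once {x ∷ xs} (x≢ ∷ u) with x ≟ᴬ f
    ... | no _     = once u
    ... | yes refl = s≤s (≤-reflexive (trans (none xs x≢) refl))
      where
      none : ∀ xs → All (f ≢_) xs → cnt (_≟ᴬ f) xs ≡ 0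
      none []       []        = refl
      none (y ∷ ys) (ne ∷ as) = cong₂ _+_ (ind-no (y ≟ᴬ f) (ne ∘ sym)) (none ys as)

  ⊥? : Dec ⊥
  ⊥? = no λ ()

  module Pairs (n : ℕ) where

    V : List (Fin n)
    V = allFin n

    length-V : length V ≡ n
    length-V = length-tabulate _

    pc : ∀ {p} {R : Fin n → Fin n → Set p} → (∀ u v → Dec (R u v)) → ℕ
    pc R? = ∑ (λ u → cnt (R? u) V) V

    pc-mono : ∀ {p q} {R : Fin n → Fin n → Set p} {S : Fin n → Fin n → Set q}
              (R? : ∀ u v → Dec (R u v)) (S? : ∀ u v → Dec (S u v)) → (∀ {u v} → R u v → S u v) → pc R? ≤ pc S?
    pc-mono R? S? f = ∑-mono V (λ {u} _ → cnt-mono (R? u) (S? u) V (λ _ → f))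

    pc-⊎ : ∀ {p q r} {R : Fin n → Fin n → Set p} {S : Fin n → Fin n → Set q} {T : Fin n → Fin n → Set r}
           (R? : ∀ u v → Dec (R u v)) (S? : ∀ u v → Dec (S u v)) (T? : ∀ u v → Dec (T u v)) →
           (∀ {u v} → R u v → S u v ⊎ T u v) → pc R? ≤ pc S? + pc T?
    pc-⊎ R? S? T? f = ≤-trans (∑-mono V (λ {u} _ → cnt-⊎ (R? u) (S? u) (T? u) V (λ _ → f)))
                              (≤-reflexive (∑-+ _ _ V))

    pc-flip : ∀ {p} {R : Fin n → Fin n → Set p} (R? : ∀ u v → Dec (R u v)) → pc (λ u v → R? v u) ≡ pc R?
    pc-flip R? = ∑-swap (λ u v → ind (R? v u)) V V

  module Labels (n z h : ℕ) (n>0 : 0 < n) (z>0 : 0 < z)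
    (E : Fin n → Fin n → Set) (E? : ∀ u v → Dec (E u v)) (E-sym : ∀ {u v} → E u v → E v u) where

    open Pairs n

    Cross : (Fin n → ℕ) → Fin n → Fin n → Set
    Cross lab u v = E u v × lab u ≢ lab v

    cross? : ∀ lab u v → Dec (Cross lab u v)
    cross? lab u v = E? u v ×-dec ¬? (lab u ≟ lab v)

    module _ (lab : Fin n → ℕ) (ℓ : ℕ) {Z : Fin n → Set} (Z? : Decidable Z) where

      in? : Decidable (λ v → lab v ≡ ℓ × Z v)
      in? v = (lab v ≟ ℓ) ×-dec Z? v

      out? : Decidable (λ v → lab v ≡ ℓ × ¬ Z v)
      out? v = (lab v ≟ ℓ) ×-dec ¬? (Z? v)

      cut? : ∀ u v → Dec ((lab u ≡ ℓ × Z u) × (lab v ≡ ℓ × ¬ Z v) × E u v)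
      cut? u v = in? u ×-dec out? v ×-dec E? u v

      Sparse : Set
      Sparse = n ≤ z * cnt in? V × n ≤ z * cnt out? V × h * pc cut? ≤ n * n

      sparse? : Dec Sparse
      sparse? = (n ≤? z * cnt in? V) ×-dec (n ≤? z * cnt out? V) ×-dec (h * pc cut? ≤? n * n)

    -- The factor `m + m` pays for one sparse cut per class, its edges being counted in both
    -- orientations.
    record Labelling (m : ℕ) : Set where
      field
        lab   : Fin n → ℕ
        bound : ∀ v → lab v < m
        big   : ∀ ℓ → ℓ < m → n ≤ z * cnt (λ v → lab v ≟ ℓ) V
        cross : h * pc (cross? lab) ≤ (m + m) * (n * n)

    few-labels : ∀ {m} → Labelling m → m ≤ z
    few-labels {m} L = *-cancelʳ-≤ m z n {{>-nonZero n>0}} (≤-trans (go m ≤-refl)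
        (*-monoʳ-≤ z (≤-trans (cnt≤length (λ v → lab v <? m) V) (≤-reflexive length-V))))
      where
      open Labelling L
      go : ∀ j → j ≤ m → j * n ≤ z * cnt (λ v → lab v <? j) V
      go zero    j≤m = z≤n
      go (suc j) j≤m = begin
        n + j * n
          ≤⟨ +-mono-≤ (big j j≤m) (go j (<⇒≤ j≤m)) ⟩
        z * cnt (λ v → lab v ≟ j) V + z * cnt (λ v → lab v <? j) V
          ≡⟨ sym (*-distribˡ-+ z _ _) ⟩
        z * (cnt (λ v → lab v ≟ j) V + cnt (λ v → lab v <? j) V)
          ≡⟨ cong (z *_) (sym (∑-+ _ _ V)) ⟩
        z * ∑ (λ v → ind (lab v ≟ j) + ind (lab v <? j)) V
          ≤⟨ *-monoʳ-≤ z (∑-mono V (λ {v} _ → point (lab v))) ⟩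
        z * cnt (λ v → lab v <? suc j) V ∎
        where
        open ≤-Reasoning
        point : ∀ l → ind (l ≟ j) + ind (l <? j) ≤ ind (l <? suc j)
        point l with l ≟ j
        ... | yes refl = ≤-trans (+-mono-≤ (ind≤1 (l ≟ l)) (≤-reflexive (ind-no (l <? l) (<-irrefl refl))))
                                 (≤-reflexive (sym (ind-yes (l <? suc l) ≤-refl)))
        ... | no l≢j = ≤-trans (≤-reflexive (cong (_+ ind (l <? j)) (ind-no (l ≟ j) l≢j)))
                               (ind-mono (l <? j) (l <? suc j) m<n⇒m<1+n)

    initial : Labelling 1
    initial = record
      { lab   = λ _ → 0
      ; bound = λ _ → s≤s z≤n
      ; big   = λ { zero _ → ≤-trans (≤-reflexive (sym length-V)) (≤-trans (≤-reflexive (sym (cnt-all {P = λ _ → 0 ≡ 0} (λ _ → 0 ≟ 0) V (λ _ → refl))))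
                  (m≤n*m _ z {{>-nonZero z>0}})) ; (suc _) (s≤s ()) }
      ; cross = *-zero-≤ h (∑-zero V (λ u → cnt-none (cross? (λ _ → 0) u) V (λ { (_ , ne) → ne refl })))
      }

    splitClass : ∀ {m} (L : Labelling m) ℓ → ℓ < m → ∀ {Z : Fin n → Set} (Z? : Decidable Z) →
                 Sparse (Labelling.lab L) ℓ Z? → Labelling (suc m)
    splitClass {m} L ℓ ℓ<m {Z} Z? (bigIn , bigOut , sparse) = record
      { lab = lab′ ; bound = bound′ ; big = big′ ; cross = cross′ }
      where
      open Labelling L
      lab′ : Fin n → ℕ
      lab′ v with in? lab ℓ Z? v
      ... | yes _ = m
      ... | no _  = lab v
      lab′-in : ∀ {v} → lab v ≡ ℓ × Z v → lab′ v ≡ m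
      lab′-in {v} i with in? lab ℓ Z? v
      ... | yes _ = refl
      ... | no ¬i = contradiction i ¬i
      lab′-out : ∀ {v} → ¬ (lab v ≡ ℓ × Z v) → lab′ v ≡ lab v
      lab′-out {v} ¬i with in? lab ℓ Z? v
      ... | yes i = contradiction i ¬i
      ... | no _  = refl
      bound′ : ∀ v → lab′ v < suc m
      bound′ v with in? lab ℓ Z? v
      ... | yes _ = ≤-refl
      ... | no _  = m<n⇒m<1+n (bound v)
      big′ : ∀ ℓ′ → ℓ′ < suc m → n ≤ z * cnt (λ v → lab′ v ≟ ℓ′) V
      big′ ℓ′ lt with ℓ′ ≟ m | ℓ′ ≟ ℓ
      ... | yes refl | _ = ≤-trans bigIn (*-monoʳ-≤ z (cnt-mono (in? lab ℓ Z?) (λ v → lab′ v ≟ m) V (λ _ → lab′-in)))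
      ... | no _ | yes refl = ≤-trans bigOut (*-monoʳ-≤ z (cnt-mono (out? lab ℓ Z?) (λ v → lab′ v ≟ ℓ) V
              (λ { _ (e , ¬Zv) → trans (lab′-out (λ { (_ , Zv) → ¬Zv Zv })) e })))
      ... | no ≢m | no ≢ℓ = ≤-trans (big ℓ′ (≤∧≢⇒< (≤-pred lt) ≢m)) (*-monoʳ-≤ z (cnt-mono (λ v → lab v ≟ ℓ′) (λ v → lab′ v ≟ ℓ′) V
              (λ _ e → trans (lab′-out (λ { (e′ , _) → ≢ℓ (trans (sym e) e′) })) e)))
      cases : ∀ {u v} → Cross lab′ u v → Cross lab u v ⊎
              ((lab u ≡ ℓ × Z u) × (lab v ≡ ℓ × ¬ Z v) × E u v ⊎ (lab v ≡ ℓ × Z v) × (lab u ≡ ℓ × ¬ Z u) × E v u)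
      cases {u} {v} (e , ne) with lab u ≟ lab v
      ... | no ne′ = inj₁ (e , ne′)
      ... | yes eq with in? lab ℓ Z? u | in? lab ℓ Z? v
      ...   | yes _ | yes _ = contradiction refl ne
      ...   | no _  | no _  = contradiction eq ne
      ...   | yes (lu , zu) | no ¬i = inj₂ (inj₁ ((lu , zu) , (trans (sym eq) lu , λ zv → ¬i (trans (sym eq) lu , zv)) , e))
      ...   | no ¬i | yes (lv , zv) = inj₂ (inj₂ ((lv , zv) , (trans eq lv , λ zu → ¬i (trans eq lv , zu)) , E-sym e))
      cross′ : h * pc (cross? lab′) ≤ (suc m + suc m) * (n * n)
      cross′ = begin
        h * pc (cross? lab′)
          ≤⟨ *-monoʳ-≤ h (≤-trans (pc-⊎ (cross? lab′) (cross? lab) both? cases)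
                           (+-monoʳ-≤ _ (pc-⊎ both? cutD? (λ u v → cutD? v u) (λ b → b)))) ⟩
        h * (pc (cross? lab) + (pc cutD? + pc (λ u v → cutD? v u)))
          ≡⟨ cong (λ w → h * (pc (cross? lab) + (pc cutD? + w))) (pc-flip cutD?) ⟩
        h * (pc (cross? lab) + (pc cutD? + pc cutD?))
          ≡⟨ alg₁ h (pc (cross? lab)) (pc cutD?) ⟩
        h * pc (cross? lab) + (h * pc cutD? + h * pc cutD?)
          ≤⟨ +-mono-≤ cross (+-mono-≤ sparse sparse) ⟩
        (m + m) * (n * n) + (n * n + n * n)
          ≡⟨ alg₂ m (n * n) ⟩
        (suc m + suc m) * (n * n) ∎
        where
        open ≤-Reasoning
        cutD? = cut? lab ℓ Z?
        both? : ∀ u v → Dec _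
        both? u v = cutD? u v ⊎-dec cutD? v u
        alg₁ : ∀ h a b → h * (a + (b + b)) ≡ h * a + (h * b + h * b)
        alg₁ = solve-∀
        alg₂ : ∀ m q → (m + m) * q + (q + q) ≡ (suc m + suc m) * q
        alg₂ = solve-∀

    -- `ℓ` need not occur as a label: for an empty class the size hypotheses of `robust` fail.
    record Robust : Set₁ where
      field
        lab    : Fin n → ℕ
        bound  : ∀ v → lab v < z
        cross  : h * pc (cross? lab) ≤ (z + z) * (n * n)
        robust : ∀ ℓ {Z : Fin n → Set} (Z? : Decidable Z) →
                 n ≤ z * cnt (in? lab ℓ Z?) V → n ≤ z * cnt (out? lab ℓ Z?) V → n * n < h * pc (cut? lab ℓ Z?)

    -- Every split adds a class of size at least `n / z`, so `suc z` classes are impossible and `k`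
    -- can count down. Whether a sparse cut remains is decided by running through all subsets of the
    -- vertex set.
    refine : ∀ k m → k + m ≡ suc z → Labelling m → Robust
    refine zero    m eq L = contradiction (few-labels L) (<⇒≱ (≤-reflexive (sym eq)))
    refine (suc k) m eq L with anyUpTo? (λ ℓ → anySubset? (λ S → sparse? (Labelling.lab L) ℓ (_∈ˢ? S))) m
    ... | yes (ℓ , ℓ<m , S , sparse) = refine k (suc m) (trans (+-suc k m) eq) (splitClass L ℓ ℓ<m (_∈ˢ? S) sparse)
    ... | no none = record
      { lab = lab ; bound = λ v → ≤-trans (bound v) (few-labels L)
      ; cross = ≤-trans cross (*-monoˡ-≤ (n * n) (+-mono-≤ (few-labels L) (few-labels L))) ; robust = robust }
      where
      open Labelling L
      robust : ∀ ℓ {Z : Fin n → Set} (Z? : Decidable Z) →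
               n ≤ z * cnt (in? lab ℓ Z?) V → n ≤ z * cnt (out? lab ℓ Z?) V → n * n < h * pc (cut? lab ℓ Z?)
      robust ℓ {Z} Z? bigIn bigOut with ℓ <? m
      ... | no ℓ≮m = contradiction (≤-trans bigIn (*-zero-≤ z nobody)) (<⇒≱ n>0)
        where
        nobody : cnt (in? lab ℓ Z?) V ≡ 0
        nobody = cnt-none (in? lab ℓ Z?) V (λ { {v} (refl , _) → ℓ≮m (bound v) })
      ... | yes ℓ<m = ≰⇒> λ le → none (ℓ , ℓ<m , S ,
            ≤-trans bigIn (*-monoʳ-≤ z (cnt-mono (in? lab ℓ Z?) (in? lab ℓ {_∈ˢ S} S?) V (λ { _ (a , b) → a , to b }))) ,
            ≤-trans bigOut (*-monoʳ-≤ z (cnt-mono (out? lab ℓ Z?) (out? lab ℓ {_∈ˢ S} S?) V (λ { _ (a , b) → a , b ∘ from }))) ,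
            ≤-trans (*-monoʳ-≤ h (pc-mono (cut? lab ℓ {_∈ˢ S} S?) (cut? lab ℓ Z?)
              (λ { ((a , b) , (c , d) , e) → (a , from b) , (c , d ∘ to) , e }))) le)
        where
        -- The enumeration covers subsets only, so the predicate is replaced by its characteristic
        -- vector.
        S : Subset n
        S = tabulate (λ v → does (Z? v))
        S? : Decidable (λ v → v ∈ˢ S)
        S? v = v ∈ˢ? S
        to : ∀ {v} → Z v → v ∈ˢ S
        to {v} zv = lookup⇒[]= v S (trans (lookup∘tabulate _ v) (does-true (Z? v)))
          where
          does-true : (d : Dec (Z v)) → does d ≡ true
          does-true (yes _)  = refl
          does-true (no ¬zv) = contradiction zv ¬zv
        from : ∀ {v} → v ∈ˢ S → Z v
        from {v} v∈ = true-does (Z? v) (trans (sym (lookup∘tabulate _ v)) ([]=⇒lookup v∈))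
          where
          true-does : (d : Dec (Z v)) → does d ≡ true → Z v
          true-does (yes zv) _ = zv

    robustLabelling : Robust
    robustLabelling = refine z 1 (+-comm z 1) initial

    -- Hubs and usable edges inside one robust component

    module InClass (R : Robust) (r : ℕ) where
      open Robust R

      _∈?_ : ∀ v (F : List (Fin n)) → Dec (v ∈ F)
      v ∈? F = any? (v Fin.≟_) F

      Dom : List (Fin n) → Fin n → Set
      Dom H v = Any (E v) H

      dom? : ∀ H → Decidable (Dom H)
      dom? H v = any? (E? v) H

      nbr? : ∀ w → Decidable (λ v → lab v ≡ r × E w v)
      nbr? w v = (lab v ≟ r) ×-dec E? w v

      undom : List (Fin n) → ℕ
      undom H = cnt (out? lab r (dom? H)) V

      cutDeg : List (Fin n) → Fin n → ℕ
      cutDeg H w = cnt (cut? lab r (dom? H) w) V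

      cnt-V≤n : ∀ {P : Fin n → Set} (P? : Decidable P) → cnt P? V ≤ n
      cnt-V≤n P? = ≤-trans (cnt≤length P? V) (≤-reflexive length-V)

      module _ (F : List (Fin n)) (F-small : (h + h) * length F ≤ n) where

        -- Averaging: otherwise the vertices outside `F` have fewer than `n / 2h` cut edges each.
        -- Those in `F` have at most `n` each, but there are at most `n / 2h` of them, so the cut
        -- would have at most `n² / h` edges.
        expander : ∀ H → n * n < h * pc (cut? lab r (dom? H)) →
                   ∃ λ w → w ∉ F × n ≤ (h + h) * cutDeg H w
        expander H many with any? (λ w → ¬? (w ∈? F) ×-dec (n ≤? (h + h) * cutDeg H w)) V
        ... | yes a with find a
        ...   | w , _ , p = w , p
        expander H many | no ¬a = contradiction (half-≤ few) (<⇒≱ many)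
          where
          point : ∀ {w} → w ∈ V → (h + h) * cutDeg H w ≤ (h + h) * n * ind (w ∈? F) + n
          point {w} w∈ with w ∈? F
          ... | yes _  = ≤-trans (*-monoʳ-≤ (h + h) (cnt-V≤n (cut? lab r (dom? H) w)))
                                 (≤-trans (≤-reflexive (sym (*-identityʳ _))) (m≤m+n _ n))
          ... | no w∉ = ≤-trans (<⇒≤ (≰⇒> λ le → ¬a (lose w∈ (w∉ , le)))) (m≤n+m n _)
          few : h * pc (cut? lab r (dom? H)) + h * pc (cut? lab r (dom? H)) ≤ n * n + n * n
          few = begin
            h * pc (cut? lab r (dom? H)) + h * pc (cut? lab r (dom? H)) ≡⟨ sym (*-distribʳ-+ _ h h) ⟩
            (h + h) * pc (cut? lab r (dom? H))              ≡⟨ sym (∑-* (h + h) (cutDeg H) V) ⟩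
            ∑ (λ w → (h + h) * cutDeg H w) V                ≤⟨ ∑-mono V point ⟩
            ∑ (λ w → (h + h) * n * ind (w ∈? F) + n) V      ≡⟨ ∑-+ _ _ V ⟩
            ∑ (λ w → (h + h) * n * ind (w ∈? F)) V + ∑ (λ _ → n) V
              ≡⟨ cong₂ _+_ (∑-* ((h + h) * n) _ V) (trans (∑-const n V) (cong (_* n) length-V)) ⟩
            (h + h) * n * cnt (_∈? F) V + n * n
              ≤⟨ +-monoˡ-≤ (n * n) (*-monoʳ-≤ ((h + h) * n) (cnt-members Fin._≟_ (allFin⁺ n) F)) ⟩
            (h + h) * n * length F + n * n  ≡⟨ cong (_+ n * n) (alg h n (length F)) ⟩
            (h + h) * length F * n + n * n  ≤⟨ +-monoˡ-≤ (n * n) (*-monoˡ-≤ n F-small) ⟩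
            n * n + n * n                                   ∎
            where
            open ≤-Reasoning
            alg : ∀ h n f → (h + h) * n * f ≡ (h + h) * f * n
            alg = solve-∀

        record Hub : Set where
          field
            verts : List (Fin n)
            isHub : IsHub E verts
            avoid : ∀ {w} → w ∈ verts → w ∉ F
            small : length verts ≤ suc (h + h)
            dense : z * undom verts < n

        addHub : ∀ {w H} → IsHub E H → w ∉ H → Dom H w → IsHub E (w ∷ H)
        addHub {w} {H} hub w∉ d with find d
        ... | x , x∈ , e = record { unique = All.tabulate (λ { v∈ refl → w∉ v∈ }) ∷ unique ; connected = conn }
          where
          open IsHub hub
          conn : ∀ {a b} → a ∈ w ∷ H → b ∈ w ∷ H →
                 ∃ λ xs → Path E a xs b × Unique xs × (∀ {v} → v ∈ xs → v ∈ w ∷ H)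
          conn (here refl) (here refl) = w ∷ [] , [ w ] , [] ∷ [] , λ { (here refl) → here refl }
          conn (here refl) (there b∈) with connected x∈ b∈
          ... | xs , p , u , xs⊆ = w ∷ xs , step e p , All.tabulate (λ { v∈ refl → w∉ (xs⊆ v∈) }) ∷ u ,
                  λ { (here refl) → here refl ; (there v∈) → there (xs⊆ v∈) }
          conn (there a∈) (here refl) with connected a∈ x∈
          ... | xs , p , u , xs⊆ = xs ++ w ∷ [] , joinPath p (E-sym e) [ w ] ,
                  Unique-++⁺ u ([] ∷ []) (λ { (v∈ , here refl) → w∉ (xs⊆ v∈) }) , sub
            where
            sub : ∀ {v} → v ∈ xs ++ w ∷ [] → v ∈ w ∷ H
            sub v∈ with ∈-++⁻ xs v∈
            ... | inj₁ i           = there (xs⊆ i)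
            ... | inj₂ (here refl) = here refl
          conn (there a∈) (there b∈) with connected a∈ b∈
          ... | xs , p , u , xs⊆ = xs , p , u , there ∘ xs⊆

        -- While linearly many vertices of the class are undominated, the cut between dominated and
        -- undominated vertices is dense. A dominated `w` with `n / 2h` undominated neighbours keeps
        -- the hub connected and makes all these neighbours dominated, so `2h` additions suffice;
        -- with the starting vertex this gives the size bound.
        grow : ∀ fuel H → IsHub E H → (∀ {w} → w ∈ H → w ∉ F) → length H + fuel ≤ suc (h + h) →
               n ≤ z * cnt (in? lab r (dom? H)) V → (h + h) * undom H ≤ fuel * n → Hub
        grow fuel H hub av len big fuelled with n ≤? z * undom H
        ... | no ¬le = record { verts = H ; isHub = hub ; avoid = av ; small = ≤-trans (m≤m+n _ fuel) len ; dense = ≰⇒> ¬le }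
        ... | yes le with expander H (robust r (dom? H) big le)
        ...   | w , w∉F , deg = extend fuel fuelled len
          where
          0<deg : 0 < cutDeg H w
          0<deg = n≢0⇒n>0 λ e → <⇒≱ n>0 (≤-trans deg (*-zero-≤ (h + h) e))
          witness : ∃ λ v → v ∈ V × (lab w ≡ r × Dom H w) × (lab v ≡ r × ¬ Dom H v) × E w v
          witness = cnt-pos (cut? lab r (dom? H) w) V 0<deg
          -- All neighbours of a vertex of `H` are dominated, but `w` has an undominated one.
          w∉H : w ∉ H
          w∉H w∈ with witness
          ... | v , _ , _ , (_ , ¬d) , e = ¬d (lose w∈ (E-sym e))
          dw : Dom H w
          dw with witness
          ... | _ , _ , (_ , d) , _ = d
          shrink : undom (w ∷ H) + cutDeg H w ≤ undom H
          shrink = ≤-trans (≤-reflexive (sym (∑-+ _ _ V))) (∑-mono V (λ {v} _ → point v))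
            where
            point : ∀ v → ind (out? lab r (dom? (w ∷ H)) v) + ind (cut? lab r (dom? H) w v) ≤ ind (out? lab r (dom? H) v)
            point v = go (cut? lab r (dom? H) w v)
              where
              go : (d : Dec _) → ind (out? lab r (dom? (w ∷ H)) v) + ind d ≤ ind (out? lab r (dom? H) v)
              go (yes (_ , o , e)) = ≤-trans (≤-reflexive (cong (_+ 1) (ind-no (out? lab r (dom? (w ∷ H)) v)
                                       (λ { (_ , ¬d) → ¬d (here (E-sym e)) }))))
                                     (≤-reflexive (sym (ind-yes (out? lab r (dom? H) v) o)))
              go (no _) = ≤-trans (≤-reflexive (+-identityʳ _))
                            (ind-mono (out? lab r (dom? (w ∷ H)) v) (out? lab r (dom? H) v) (λ { (l , ¬d) → l , ¬d ∘ there }))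
          shrink′ : (h + h) * undom (w ∷ H) + n ≤ (h + h) * undom H
          shrink′ = ≤-trans (+-monoʳ-≤ _ deg) (≤-trans (≤-reflexive (sym (*-distribˡ-+ (h + h) _ _))) (*-monoʳ-≤ (h + h) shrink))
          extend : ∀ fuel → (h + h) * undom H ≤ fuel * n → length H + fuel ≤ suc (h + h) → Hub
          extend zero f _ = contradiction (≤-trans (≤-trans (m≤n+m n _) shrink′) f) (<⇒≱ n>0)
          extend (suc fuel) f len = grow fuel (w ∷ H) (addHub hub w∉H dw)
            (λ { (here refl) → w∉F ; (there v∈) → av v∈ })
            (≤-trans (≤-reflexive (sym (+-suc (length H) fuel))) len)
            (≤-trans big (*-monoʳ-≤ z (cnt-mono (in? lab r (dom? H)) (in? lab r (dom? (w ∷ H))) V (λ { _ (l , d) → l , there d }))))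
            (+-cancelʳ-≤ n _ _ (≤-trans shrink′ (≤-trans f (≤-reflexive (+-comm n _)))))

        Dead : Set
        Dead = ∀ w → w ∉ F → lab w ≡ r → z * cnt (nbr? w) V < n

        hub-or-dead : Hub ⊎ Dead
        hub-or-dead with any? (λ w → ¬? (w ∈? F) ×-dec (lab w ≟ r) ×-dec (n ≤? z * cnt (nbr? w) V)) V
        ... | no ¬a = inj₂ (λ w w∉ l → ≰⇒> λ le → ¬a (lose (∈-allFin w) (w∉ , l , le)))
        ... | yes a with find a
        ...   | w , _ , w∉ , l , deg = inj₁ (grow (h + h) (w ∷ [])
                (record { unique = [] ∷ [] ; connected = λ { (here refl) (here refl) → w ∷ [] , [ w ] , [] ∷ [] , λ x → x } })
                (λ { (here refl) → w∉ }) ≤-refl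
                (≤-trans deg (*-monoʳ-≤ z (cnt-mono (nbr? w) (in? lab r (dom? (w ∷ []))) V (λ { _ (l , e) → l , here (E-sym e) }))))
                (*-monoʳ-≤ (h + h) (cnt-V≤n (out? lab r (dom? (w ∷ []))))))

      record Hubs (F : List (Fin n)) (N : ℕ) : Set where
        field
          hubs    : List (List (Fin n))
          number  : length hubs ≡ N
          allHubs : All (IsHub E) hubs
          unique  : Unique (concat hubs)
          avoid   : ∀ {w} → w ∈ concat hubs → w ∉ F
          small   : length (concat hubs) ≤ N * suc (h + h)
          dense   : All (λ H → z * undom H < n) hubs

      -- The avoided set is part of the outcome, since suitable starting vertices may run out only
      -- after some hubs have been reserved.
      record DeadClass (f : ℕ) : Set where
        field
          F     : List (Fin n)
          small : length F ≤ f
          dead  : ∀ w → w ∉ F → lab w ≡ r → z * cnt (nbr? w) V < n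

      -- Every new hub joins the set to be avoided by the later ones, and the budget keeps this set
      -- below the `n / 2h` that `expander` tolerates.
      manyHubs : ∀ N F → (h + h) * (length F + N * suc (h + h)) ≤ n → Hubs F N ⊎ DeadClass (length F + N * suc (h + h))
      manyHubs zero    F le = inj₁ (record { hubs = [] ; number = refl ; allHubs = [] ; unique = [] ; avoid = λ () ; small = z≤n ; dense = [] })
      manyHubs (suc N) F le with hub-or-dead F (≤-trans (*-monoʳ-≤ (h + h) (m≤m+n _ _)) le)
      ... | inj₂ dead = inj₂ (record { F = F ; small = m≤m+n _ _ ; dead = dead })
      ... | inj₁ hub  = further (manyHubs N (Hub.verts hub ++ F) (≤-trans (*-monoʳ-≤ (h + h) sizes) le))
        where
        sizes : length (Hub.verts hub ++ F) + N * suc (h + h) ≤ length F + suc N * suc (h + h)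
        sizes = begin
          length (Hub.verts hub ++ F) + N * suc (h + h)
            ≡⟨ cong (_+ N * suc (h + h)) (length-++ (Hub.verts hub)) ⟩
          length (Hub.verts hub) + length F + N * suc (h + h)
            ≤⟨ +-monoˡ-≤ _ (+-monoˡ-≤ (length F) (Hub.small hub)) ⟩
          suc (h + h) + length F + N * suc (h + h)
            ≡⟨ alg (suc (h + h)) (length F) (N * suc (h + h)) ⟩
          length F + suc N * suc (h + h) ∎
          where
          open ≤-Reasoning
          alg : ∀ a b c → a + b + c ≡ b + (a + c)
          alg = solve-∀
        further : Hubs (Hub.verts hub ++ F) N ⊎ DeadClass (length (Hub.verts hub ++ F) + N * suc (h + h)) →
                  Hubs F (suc N) ⊎ DeadClass (length F + suc N * suc (h + h))
        further (inj₂ dead) = inj₂ (record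
          { F = DeadClass.F dead ; small = ≤-trans (DeadClass.small dead) sizes ; dead = DeadClass.dead dead })
        further (inj₁ hs) = inj₁ (record
          { hubs    = Hub.verts hub ∷ hubs
          ; number  = cong suc number
          ; allHubs = Hub.isHub hub ∷ allHubs
          ; unique  = Unique-++⁺ (IsHub.unique (Hub.isHub hub)) unique (λ { (a , b) → avoid b (∈-++⁺ˡ a) })
          ; avoid   = av
          ; small   = ≤-trans (≤-reflexive (length-++ (Hub.verts hub))) (+-mono-≤ (Hub.small hub) small)
          ; dense   = Hub.dense hub ∷ dense })
          where
          open Hubs hs
          av : ∀ {w} → w ∈ Hub.verts hub ++ concat hubs → w ∉ F
          av w∈ with ∈-++⁻ (Hub.verts hub) w∈
          ... | inj₁ i = Hub.avoid hub i
          ... | inj₂ j = λ w∈F → avoid j (∈-++⁺ʳ (Hub.verts hub) w∈F)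

      Inner : Fin n → Fin n → Set
      Inner u v = E u v × lab u ≡ r × lab v ≡ r

      inner? : ∀ u v → Dec (Inner u v)
      inner? u v = E? u v ×-dec (lab u ≟ r) ×-dec (lab v ≟ r)

      -- Common interface of the two outcomes of `manyHubs`. With hubs, an edge of the component is
      -- usable if both ends avoid the reserved set and see every hub. In a dead class no edge is
      -- usable, and the empty cycle suffices.
      record Usable (N f : ℕ) (hv F : List (Fin n)) : Set₁ where
        field
          U     : Fin n → Fin n → Set
          U?    : ∀ u v → Dec (U u v)
          U-sym : ∀ {u v} → U u v → U v u
          avoid : ∀ {u v} → U u v → u ∉ F
          -- At most `f` vertices are reserved and each of the `N` hubs misses at most `n / z`
          -- vertices of the class. A bad vertex spoils at most `n` pairs as first end and `n` as
          -- second end.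
          few   : z * pc (λ u v → inner? u v ×-dec ¬? (U? u v)) ≤ (z * (f * n) + N * (n * n)) + (z * (f * n) + N * (n * n))
          cycle : ∀ ps → length ps < N → All (EvenPath U) ps → Unique (concat ps) →
                  ∃ λ xs → IsCycle E xs × Unique xs × (∀ {v} → v ∈ xs → v ∈ concat ps ⊎ v ∈ hv) × length (concat ps) ≤ length xs

      evenPath-avoid : ∀ {U : Fin n → Fin n → Set} {F : List (Fin n)} → (∀ {u v} → U u v → U v u) →
                       (∀ {u v} → U u v → u ∉ F) → ∀ {xs v} → EvenPath U xs → v ∈ xs → v ∉ F
      evenPath-avoid U-sym av (path [ a ] , zero , ()) v∈
      evenPath-avoid U-sym av (path [ a ] , suc k , eq) v∈ = contradiction (suc-injective (trans eq (cong suc (+-suc k k)))) λ ()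
      evenPath-avoid {U} {F} U-sym av (path (step e p) , _) v∈ = go e p v∈
        where
        go : ∀ {a b xs c v} → U a b → Path U b xs c → v ∈ a ∷ xs → v ∉ F
        go e p          (here refl)         = av e
        go e [ _ ]      (there (here refl)) = av (U-sym e)
        go e (step f p) (there v∈)          = go f p v∈

      concat-avoid : ∀ {U : Fin n → Fin n → Set} {F : List (Fin n)} → (∀ {u v} → U u v → U v u) →
                     (∀ {u v} → U u v → u ∉ F) → ∀ ps {v} → All (EvenPath U) ps → v ∈ concat ps → v ∉ F
      concat-avoid U-sym av (p ∷ ps) (e ∷ es) v∈ with ∈-++⁻ p v∈
      ... | inj₁ i = evenPath-avoid U-sym av e i
      ... | inj₂ j = concat-avoid U-sym av ps es j

      hubVerts : ∀ {F N f} → Hubs F N ⊎ DeadClass f → List (Fin n)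
      hubVerts (inj₁ hs) = concat (Hubs.hubs hs)
      hubVerts (inj₂ _)  = []

      usable : ∀ {F₀ N f₀} (stage : Hubs F₀ N ⊎ DeadClass f₀) → 0 < N → ∀ f F → f₀ ≤ f → length F ≤ f →
               (∀ {v} → v ∈ hubVerts stage → v ∈ F) → Usable N f (hubVerts stage) F
      usable {F₀} {N} (inj₁ hs) 0<N f F f₀≤f F≤f hv⊆F = record
        { U = U ; U? = U?
        ; U-sym = U-sym
        ; avoid = avoid′
        ; few = few
        ; cycle = cycle }
        where
        open Hubs hs
        Good : Fin n → Set
        Good v = v ∉ F × All (λ H → Dom H v) hubs
        good? : Decidable Good
        good? v = ¬? (v ∈? F) ×-dec All.all? (λ H → dom? H v) hubs
        U : Fin n → Fin n → Set
        U u v = Inner u v × Good u × Good v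
        U? : ∀ u v → Dec (U u v)
        U? u v = inner? u v ×-dec good? u ×-dec good? v
        U-sym : ∀ {u v} → U u v → U v u
        U-sym ((e , lu , lv) , gu , gv) = (E-sym e , lv , lu) , gv , gu
        U⇒E : ∀ {u v} → U u v → E u v
        U⇒E ((e , _) , _) = e
        avoid′ : ∀ {u v} → U u v → u ∉ F
        avoid′ (_ , (u∉ , _) , _) = u∉
        dominated : ∀ {u v H} → U u v → H ∈ hubs → Any (E u) H
        dominated (_ , (_ , a) , _) H∈ = All.lookup a H∈
        missed? : ∀ (Hs : List (List (Fin n))) → Decidable (λ v → lab v ≡ r × ¬ All (λ H → Dom H v) Hs)
        missed? Hs v = (lab v ≟ r) ×-dec ¬? (All.all? (λ H → dom? H v) Hs)
        missed-few : ∀ Hs → All (λ H → z * undom H < n) Hs → z * cnt (missed? Hs) V ≤ length Hs * n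
        missed-few [] [] = *-zero-≤ z (cnt-none (missed? []) V (λ { (_ , ¬a) → ¬a [] }))
        missed-few (H ∷ Hs) (d ∷ ds) = ≤-trans (*-monoʳ-≤ z (cnt-⊎ (missed? (H ∷ Hs)) (out? lab r (dom? H)) (missed? Hs) V split))
            (≤-trans (≤-reflexive (*-distribˡ-+ z _ _)) (+-mono-≤ (<⇒≤ d) (missed-few Hs ds)))
          where
          split : ∀ {v} → v ∈ V → _ → _
          split {v} _ (l , ¬a) with dom? H v
          ... | no ¬d = inj₁ (l , ¬d)
          ... | yes d = inj₂ (l , λ a → ¬a (d ∷ a))
        Bad : Fin n → Set
        Bad v = v ∈ F ⊎ (lab v ≡ r × ¬ All (λ H → Dom H v) hubs)
        bad? : Decidable Bad
        bad? v = (v ∈? F) ⊎-dec missed? hubs v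
        bad-few : z * cnt bad? V ≤ z * f + N * n
        bad-few = ≤-trans (*-monoʳ-≤ z (cnt-⊎ bad? (_∈? F) (missed? hubs) V (λ _ b → b)))
          (≤-trans (≤-reflexive (*-distribˡ-+ z _ _))
            (+-mono-≤ (*-monoʳ-≤ z (≤-trans (cnt-members Fin._≟_ (allFin⁺ n) F) F≤f))
                      (≤-trans (missed-few hubs dense) (≤-reflexive (cong (_* n) number)))))
        bads : pc (λ u v → bad? u) ≡ n * cnt bad? V
        bads = trans (∑-cong V (λ u → trans (∑-const (ind (bad? u)) V) (cong (_* ind (bad? u)) length-V))) (∑-* n _ V)
        bads′ : z * pc (λ u v → bad? u) ≤ z * (f * n) + N * (n * n)
        bads′ = ≤-trans (≤-reflexive (trans (cong (z *_) bads) (alg₁ z n (cnt bad? V))))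
          (≤-trans (*-monoˡ-≤ n bad-few) (≤-reflexive (alg₂ z f N n)))
          where
          alg₁ : ∀ z n c → z * (n * c) ≡ z * c * n
          alg₁ = solve-∀
          alg₂ : ∀ z f N n → (z * f + N * n) * n ≡ z * (f * n) + N * (n * n)
          alg₂ = solve-∀
        few : z * pc (λ u v → inner? u v ×-dec ¬? (U? u v)) ≤ (z * (f * n) + N * (n * n)) + (z * (f * n) + N * (n * n))
        few = ≤-trans (*-monoʳ-≤ z (pc-⊎ (λ u v → inner? u v ×-dec ¬? (U? u v)) (λ u v → bad? u) (λ u v → bad? v) split))
          (≤-trans (≤-reflexive (*-distribˡ-+ z _ _))
            (+-mono-≤ bads′ (≤-trans (≤-reflexive (cong (z *_) (pc-flip (λ u v → bad? u)))) bads′)))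
          where
          bad-or-good : ∀ {v} → lab v ≡ r → Bad v ⊎ Good v
          bad-or-good {v} l with v ∈? F | All.all? (λ H → dom? H v) hubs
          ... | yes i | _     = inj₁ (inj₁ i)
          ... | no _  | no ¬a = inj₁ (inj₂ (l , ¬a))
          ... | no ¬i | yes a = inj₂ (¬i , a)
          split : ∀ {u v} → Inner u v × ¬ U u v → Bad u ⊎ Bad v
          split (i@(_ , lu , lv) , ¬U) with bad-or-good lu | bad-or-good lv
          ... | inj₁ b | _      = inj₁ b
          ... | inj₂ _ | inj₁ b = inj₂ b
          ... | inj₂ g | inj₂ g′ = contradiction (i , g , g′) ¬U
        cycle : ∀ ps → length ps < N → All (EvenPath U) ps → Unique (concat ps) →
                ∃ λ xs → IsCycle E xs × Unique xs × (∀ {v} → v ∈ xs → v ∈ concat ps ⊎ v ∈ concat hubs) × length (concat ps) ≤ length xs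
        cycle ps lt eps up = verts , isCycle , uniq , inside , long
          where
          open Link E U E-sym U⇒E hubs dominated U-sym
          linked : LinkedCycle ps hubs
          linked = close ps hubs (subst (length ps <_) (sym number) lt) eps (λ x → x) allHubs up unique
            (λ v∈ v∈h → concat-avoid {U} {F} U-sym avoid′ ps eps v∈ (hv⊆F v∈h))
          open LinkedCycle linked
            renaming (unique to uniq)
      usable {N = N} (inj₂ D) 0<N f F f₀≤f F≤f hv⊆F = record
        { U = λ _ _ → ⊥ ; U? = λ _ _ → ⊥? ; U-sym = λ () ; avoid = λ () ; few = few ; cycle = cycle }
        where
        open DeadClass D renaming (F to F₁; small to F₁-small)
        point : ∀ u → z * cnt (inner? u) V ≤ z * n * ind (u ∈? F₁) + n
        point u with u ∈? F₁ | lab u ≟ r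
        ... | yes _ | _ = ≤-trans (*-monoʳ-≤ z (cnt-V≤n (inner? u))) (≤-trans (≤-reflexive (sym (*-identityʳ _))) (m≤m+n _ n))
        ... | no u∉ | yes l = ≤-trans (*-monoʳ-≤ z (cnt-mono (inner? u) (nbr? u) V (λ { _ (e , _ , lv) → lv , e })))
                                      (≤-trans (<⇒≤ (dead u u∉ l)) (m≤n+m n _))
        ... | no _ | no ¬l = *-zero-≤ z (cnt-none (inner? u) V (λ { (_ , l , _) → ¬l l }))
        few : z * pc (λ u v → inner? u v ×-dec ¬? ⊥?) ≤ (z * (f * n) + N * (n * n)) + (z * (f * n) + N * (n * n))
        few = begin
          z * pc (λ u v → inner? u v ×-dec ¬? ⊥?)
            ≤⟨ *-monoʳ-≤ z (pc-mono (λ u v → inner? u v ×-dec ¬? ⊥?) inner? proj₁) ⟩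
          z * pc inner?                                    ≡⟨ sym (∑-* z _ V) ⟩
          ∑ (λ u → z * cnt (inner? u) V) V                 ≤⟨ ∑-mono V (λ {u} _ → point u) ⟩
          ∑ (λ u → z * n * ind (u ∈? F₁) + n) V            ≡⟨ ∑-+ _ _ V ⟩
          ∑ (λ u → z * n * ind (u ∈? F₁)) V + ∑ (λ _ → n) V
            ≡⟨ cong₂ _+_ (∑-* (z * n) _ V) (trans (∑-const n V) (cong (_* n) length-V)) ⟩
          z * n * cnt (_∈? F₁) V + n * n
            ≤⟨ +-mono-≤ (*-monoʳ-≤ (z * n) (≤-trans (cnt-members Fin._≟_ (allFin⁺ n) F₁) (≤-trans F₁-small f₀≤f)))
                        (≤-trans (≤-reflexive (sym (*-identityˡ _))) (*-monoˡ-≤ (n * n) 0<N)) ⟩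
          z * n * f + N * (n * n)                          ≡⟨ cong (_+ N * (n * n)) (alg z n f) ⟩
          z * (f * n) + N * (n * n)                        ≤⟨ m≤m+n _ _ ⟩
          (z * (f * n) + N * (n * n)) + (z * (f * n) + N * (n * n)) ∎
          where
          open ≤-Reasoning
          alg : ∀ z n f → z * n * f ≡ z * (f * n)
          alg = solve-∀
        empty-paths : ∀ ps → All (EvenPath (λ _ _ → ⊥)) ps → concat ps ≡ []
        empty-paths [] [] = refl
        empty-paths ([] ∷ ps) (_ ∷ es) = empty-paths ps es
        -- Without edges the path vacuously avoids every set, in particular one that contains its
        -- own first vertex.
        empty-paths ((v ∷ p) ∷ ps) (e ∷ es) = ⊥-elim (evenPath-avoid {F = v ∷ []} (λ ()) (λ ()) e (here refl) (here refl))
        cycle : ∀ ps → length ps < N → All (EvenPath (λ _ _ → ⊥)) ps → Unique (concat ps) →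
                ∃ λ xs → IsCycle E xs × Unique xs × (∀ {v} → v ∈ xs → v ∈ concat ps ⊎ v ∈ []) × length (concat ps) ≤ length xs
        cycle ps lt eps up = [] , inj₁ refl , [] , (λ ()) , ≤-reflexive (cong length (empty-paths ps eps))

  -- Groups of partition classes

  total⇒refl : ∀ {A : Set} {_≼_ : A → A → Set} → (∀ x y → x ≼ y ⊎ y ≼ x) → ∀ x → x ≼ x
  total⇒refl total x with total x x
  ... | inj₁ r = r
  ... | inj₂ r = r

  extremal : ∀ {A : Set} {P : A → Set} (_≼_ : A → A → Set) → (∀ x y → x ≼ y ⊎ y ≼ x) → (∀ {x y z} → x ≼ y → y ≼ z → x ≼ z) →
             (P? : Decidable P) → ∀ xs → 0 < cnt P? xs → ∃ λ x → P x × (∀ {y} → y ∈ xs → P y → x ≼ y)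
  extremal _≼_ total tr P? (x ∷ xs) pos with P? x | cnt P? xs ≟ 0
  ... | no ¬px | yes e = contradiction (subst (0 <_) e pos) λ ()
  ... | no ¬px | no ne with extremal _≼_ total tr P? xs (n≢0⇒n>0 ne)
  ...   | m , pm , least = m , pm , λ { (here refl) py → contradiction py ¬px ; (there y∈) py → least y∈ py }
  extremal _≼_ total tr P? (x ∷ xs) pos | yes px | yes e =
    x , px , λ { (here refl) _ → total⇒refl total x ; (there y∈) py → contradiction (subst (0 <_) e (cnt-∈ P? y∈ py)) λ () }
  extremal _≼_ total tr P? (x ∷ xs) pos | yes px | no ne with extremal _≼_ total tr P? xs (n≢0⇒n>0 ne)
  ... | m , pm , least with total x m
  ...   | inj₁ x≼m = x , px , λ { (here refl) _ → total⇒refl total x ; (there y∈) py → tr x≼m (least y∈ py) }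
  ...   | inj₂ m≼x = m , pm , λ { (here refl) _ → m≼x ; (there y∈) py → least y∈ py }

  module Counting {n k : ℕ} (part : Fin n → Fin k) (fair : Fair part) where

    open Pairs n

    countPairs-pc : ∀ p → countPairs p ≡ pc (λ u v → T? (if toℕ u <ᵇ toℕ v then p u v else false))
    countPairs-pc p = go V
      where
      q : Fin n → Fin n → Bool
      q u v = if toℕ u <ᵇ toℕ v then p u v else false
      go : ∀ xs → sum (map (λ u → length (filterᵇ (q u) V)) xs) ≡ ∑ (λ u → cnt (T? ∘ q u) V) xs
      go []       = refl
      go (x ∷ xs) = cong₂ _+_ (cnt-filter (T? ∘ q x) V) (go xs)

    countPairs≤pc : ∀ p {R : Fin n → Fin n → Set} (R? : ∀ u v → Dec (R u v)) →
                    (∀ u v → p u v ≡ true → R u v) → countPairs p ≤ pc R?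
    countPairs≤pc p R? f = ≤-trans (≤-reflexive (countPairs-pc p)) (pc-mono (λ u v → T? (if toℕ u <ᵇ toℕ v then p u v else false)) R? (λ {u} {v} → sub u v))
      where
      sub : ∀ u v → Bool.T (if toℕ u <ᵇ toℕ v then p u v else false) → _
      sub u v t with toℕ u <ᵇ toℕ v | p u v in eq
      ... | true | true = f u v eq

    part? : ∀ u v → Dec (part u ≡ part v)
    part? u v = part u Fin.≟ part v

    size≡cnt : ∀ i → classSize part i ≡ cnt (λ v → part v Fin.≟ i) V
    size≡cnt i = cnt-filter (λ v → part v Fin.≟ i) V

    adj-lower : n * n ≤ pc (λ u v → ¬? (part? u v)) + pc (λ u v → ¬? (part? u v))
    adj-lower = begin
      n * n  ≡⟨ sym (trans (∑-const n V) (cong (_* n) length-V)) ⟩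
      ∑ (λ _ → n) V                                     ≤⟨ ∑-mono V (λ {u} _ → point u) ⟩
      ∑ (λ u → deg u + deg u) V                         ≡⟨ ∑-+ deg deg V ⟩
      pc (λ u v → ¬? (part? u v)) + pc (λ u v → ¬? (part? u v)) ∎
      where
      open ≤-Reasoning
      deg : Fin n → ℕ
      deg u = cnt (λ v → ¬? (part? u v)) V
      point : ∀ u → n ≤ deg u + deg u
      point u = +-cancelˡ-≤ n _ _ (≤-trans (≤-reflexive (trans (cong₂ _+_ (sym total) (sym total)) (rearr own (deg u))))
                  (+-monoˡ-≤ _ (≤-trans (≤-reflexive own₂) (fair (part u)))))
        where
        own : ℕ
        own = cnt (λ v → part? u v) V
        total : own + deg u ≡ n
        total = trans (cnt-¬ (part? u) V) length-V
        own₂ : own + own ≡ 2 * classSize part (part u)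
        own₂ = trans (cong₂ _+_ own≡ (trans own≡ (sym (+-identityʳ _)))) refl
          where
          own≡ : own ≡ classSize part (part u)
          own≡ = trans (≤-antisym (cnt-mono (part? u) (λ v → part v Fin.≟ part u) V (λ _ → sym))
                                  (cnt-mono (λ v → part v Fin.≟ part u) (part? u) V (λ _ → sym))) (sym (size≡cnt (part u)))
        rearr : ∀ a b → a + b + (a + b) ≡ a + a + (b + b)
        rearr = solve-∀

    -- By fairness every degree is at least `n / 2`, and an edge gives two ordered pairs. This turns
    -- bounds in terms of `n²` into bounds in terms of the number of edges.
    edges-lower : n * n ≤ 4 * numEdges part
    edges-lower = ≤-trans adj-lower (≤-trans (+-mono-≤ adj≤ adj≤) (≤-reflexive (alg (numEdges part))))
      where
      q : Fin n → Fin n → Bool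
      q u v = if toℕ u <ᵇ toℕ v then adjᵇ part u v else false
      forward : ∀ {u v} → part u ≢ part v → toℕ u < toℕ v → Bool.T (q u v)
      forward {u} {v} ne lt with toℕ u <ᵇ toℕ v | <⇒<ᵇ lt | part u Fin.≟ part v
      ... | true | _ | yes e = contradiction e ne
      ... | true | _ | no _  = _
      either : ∀ {u v} → part u ≢ part v → Bool.T (q u v) ⊎ Bool.T (q v u)
      either {u} {v} ne with <-cmp (toℕ u) (toℕ v)
      ... | tri< lt _ _ = inj₁ (forward ne lt)
      ... | tri≈ _ e _  = contradiction (cong part (Fin.toℕ-injective e)) ne
      ... | tri> _ _ gt = inj₂ (forward (ne ∘ sym) gt)
      adj≤ : pc (λ u v → ¬? (part? u v)) ≤ numEdges part + numEdges part
      adj≤ = ≤-trans (pc-⊎ (λ u v → ¬? (part? u v)) (λ u v → T? (q u v)) (λ u v → T? (q v u)) either)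
        (≤-reflexive (cong₂ _+_ (sym (countPairs-pc (adjᵇ part))) (trans (pc-flip (λ u v → T? (q u v))) (sym (countPairs-pc (adjᵇ part))))))
      alg : ∀ e → e + e + (e + e) ≡ 4 * e
      alg = solve-∀

  module Groups {n k : ℕ} (part : Fin n → Fin k) (fair : Fair part) (n>0 : 0 < n) (z : ℕ) where

    open Pairs n
    open Counting part fair

    private instance
      n≢0 : NonZero n
      n≢0 = >-nonZero n>0

    before? : ∀ v w → Dec (part w Fin.< part v)
    before? v w = part w Fin.<? part v

    pos : Fin n → ℕ
    pos v = cnt (before? v) V

    -- The classes are laid out consecutively on a line of length n, and a class is put into
    -- the group given by the z-th part of the line in which it starts.
    g : Fin n → ℕ
    g v = pos v * z / n

    g-bound : 0 < z → ∀ v → g v < z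
    g-bound z>0 v = m<n*o⇒m/o<n {o = n} (subst (pos v * z <_) (*-comm n z)
        (*-monoˡ-< z {{>-nonZero z>0}} (≤-trans (strict V (∈-allFin v)) (≤-reflexive length-V))))
      where
      strict : ∀ xs → v ∈ xs → cnt (before? v) xs < length xs
      strict xs v∈ = ≤-trans (+-monoˡ-≤ (cnt (before? v) xs) (cnt-∈ (¬? ∘ before? v) v∈ (Fin.<-irrefl refl)))
                             (≤-reflexive (trans (+-comm _ (cnt (before? v) xs)) (cnt-¬ (before? v) xs)))

    g-part : ∀ {u v} → g u ≢ g v → part u ≢ part v
    g-part ne e = ne (cong (λ i → cnt (λ w → part w Fin.<? i) V * z / n) e)

    near : ∀ {u v} → g u ≡ g v → pos v * z < pos u * z + n
    near {u} {v} e = begin-strict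
      pos v * z                              ≡⟨ m≡m%n+[m/n]*n (pos v * z) n ⟩
      pos v * z % n + pos v * z / n * n      <⟨ +-monoˡ-< _ (m%n<n (pos v * z) n) ⟩
      n + pos v * z / n * n                  ≡⟨ cong (λ w → n + w * n) (sym e) ⟩
      n + pos u * z / n * n  ≤⟨ +-monoʳ-≤ n (≤-trans (m≤n+m _ (pos u * z % n)) (≤-reflexive (sym (m≡m%n+[m/n]*n (pos u * z) n)))) ⟩
      n + pos u * z                          ≡⟨ +-comm n _ ⟩
      pos u * z + n                          ∎
      where open ≤-Reasoning

    earlier? : ∀ v u → Dec (g u ≡ g v × part u Fin.< part v)
    earlier? v u = (g u ≟ g v) ×-dec before? v u

    -- Let `u` lie in the first class of the group. The vertices in question fill the line between
    -- `pos u` and `pos v`, which start in the same interval of length `n / z`. Only the last class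
    -- of a group can reach beyond it.
    earlier-few : ∀ v → z * cnt (earlier? v) V ≤ n
    earlier-few v with cnt (earlier? v) V ≟ 0
    ... | yes e = *-zero-≤ z e
    ... | no ne with extremal (λ x y → toℕ (part x) ≤ toℕ (part y)) (λ x y → ≤-total _ _) ≤-trans (earlier? v) V (n≢0⇒n>0 ne)
    ...   | u , (gu , u<v) , least = +-cancelʳ-≤ (pos u * z) _ _ (begin
      z * cnt (earlier? v) V + pos u * z   ≡⟨ alg z (cnt (earlier? v) V) (pos u) ⟩
      (cnt (earlier? v) V + pos u) * z     ≤⟨ *-monoˡ-≤ z disjoint ⟩
      pos v * z                            ≤⟨ <⇒≤ (near gu) ⟩
      pos u * z + n                        ≡⟨ +-comm (pos u * z) n ⟩
      n + pos u * z                        ∎)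
      where
      open ≤-Reasoning
      alg : ∀ z c p → z * c + p * z ≡ (c + p) * z
      alg = solve-∀
      disjoint : cnt (earlier? v) V + pos u ≤ pos v
      disjoint = ≤-trans (≤-reflexive (sym (∑-+ _ _ V))) (∑-mono V (λ {w} w∈ → point w w∈))
        where
        point : ∀ w → w ∈ V → ind (earlier? v w) + ind (before? u w) ≤ ind (before? v w)
        point w w∈ = go (earlier? v w)
          where
          go : (d : Dec (g w ≡ g v × part w Fin.< part v)) → ind d + ind (before? u w) ≤ ind (before? v w)
          go (yes d@(_ , w<v)) = ≤-trans (≤-reflexive (cong (1 +_) (ind-no (before? u w) (≤⇒≯ (least w∈ d)))))
                                         (≤-reflexive (sym (ind-yes (before? v w) w<v)))
          go (no _) = ind-mono (before? u w) (before? v w) (λ w<u → Fin.<-trans w<u u<v)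

    group? : ∀ t → Decidable (λ v → g v ≡ t)
    group? t v = g v ≟ t

    -- The last class of the group has at most `n / 2` vertices by fairness, all earlier ones
    -- together at most `n / z`.
    group-size : ∀ t → z * (cnt (group? t) V + cnt (group? t) V) ≤ z * n + (n + n)
    group-size t with cnt (group? t) V ≟ 0
    ... | yes e = *-zero-≤ z (cong (λ c → c + c) e)
    ... | no ne with extremal (λ x y → toℕ (part y) ≤ toℕ (part x)) (λ x y → ≤-total _ _) (λ a b → ≤-trans b a) (group? t) V (n≢0⇒n>0 ne)
    ...   | v , gv , greatest = begin
      z * (cnt (group? t) V + cnt (group? t) V)     ≤⟨ *-monoʳ-≤ z (+-mono-≤ bound bound) ⟩
      z * (c + s + (c + s))                         ≡⟨ alg z c s ⟩
      z * (2 * s) + (z * c + z * c)  ≤⟨ +-mono-≤ (*-monoʳ-≤ z (fair (part v))) (+-mono-≤ (earlier-few v) (earlier-few v)) ⟩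
      z * n + (n + n)                               ∎
      where
      open ≤-Reasoning
      c = cnt (earlier? v) V
      s = classSize part (part v)
      alg : ∀ z c s → z * (c + s + (c + s)) ≡ z * (2 * s) + (z * c + z * c)
      alg = solve-∀
      split : ∀ {u} → u ∈ V → g u ≡ t → (g u ≡ g v × part u Fin.< part v) ⊎ part u ≡ part v
      split {u} u∈ gu with part u Fin.≟ part v
      ... | yes e = inj₂ e
      ... | no ne = inj₁ (trans gu (sym gv) , ≤∧≢⇒< (greatest u∈ gu) (ne ∘ Fin.toℕ-injective))
      bound : cnt (group? t) V ≤ c + s
      bound = ≤-trans (cnt-⊎ (group? t) (earlier? v) (λ u → part u Fin.≟ part v) V split)
                      (≤-reflexive (cong (c +_) (sym (size≡cnt (part v)))))

    inner? : ∀ u v → Dec (part u ≢ part v × g u ≡ g v)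
    inner? u v = ¬? (part? u v) ×-dec (g u ≟ g v)

    -- Of two vertices in distinct classes of a group, one is among the at most `n / z` vertices
    -- earlier than the other.
    inner-few : z * pc inner? ≤ n * n + n * n
    inner-few = begin
      z * pc inner?  ≤⟨ *-monoʳ-≤ z (pc-⊎ inner? (λ u v → earlier? v u) earlier? split) ⟩
      z * (pc (λ u v → earlier? v u) + pc earlier?)  ≡⟨ cong (λ w → z * (w + pc earlier?)) (pc-flip earlier?) ⟩
      z * (pc earlier? + pc earlier?)                        ≡⟨ *-distribˡ-+ z _ _ ⟩
      z * pc earlier? + z * pc earlier?                      ≤⟨ +-mono-≤ half half ⟩
      n * n + n * n                                          ∎
      where
      open ≤-Reasoning
      split : ∀ {u v} → part u ≢ part v × g u ≡ g v → (g u ≡ g v × part u Fin.< part v) ⊎ (g v ≡ g u × part v Fin.< part u)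
      split {u} {v} (ne , e) with <-cmp (toℕ (part u)) (toℕ (part v))
      ... | tri< lt _ _ = inj₁ (e , lt)
      ... | tri≈ _ e′ _ = contradiction (Fin.toℕ-injective e′) ne
      ... | tri> _ _ gt = inj₂ (sym e , gt)
      half : z * pc earlier? ≤ n * n
      half = ≤-trans (≤-reflexive (sym (∑-* z _ V))) (≤-trans (∑-mono V (λ {v} _ → earlier-few v))
               (≤-reflexive (trans (∑-const n V) (cong (_* n) length-V))))

  record Grouping {n k : ℕ} (part : Fin n → Fin k) (z : ℕ) : Set where
    open Pairs n
    field
      g          : Fin n → ℕ
      g-bound    : ∀ v → g v < z
      g-part     : ∀ {u v} → g u ≢ g v → part u ≢ part v
      group-size : ∀ t → z * (cnt (λ v → g v ≟ t) V + cnt (λ v → g v ≟ t) V) ≤ z * n + (n + n)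
      inner-few  : z * pc (λ u v → ¬? (part u Fin.≟ part v) ×-dec (g u ≟ g v)) ≤ n * n + n * n

  grouping : ∀ {n k} (part : Fin n → Fin k) → Fair part → 0 < n → ∀ z → 0 < z → Grouping part z
  grouping part fair n>0 z z>0 = record
    { g = g ; g-bound = g-bound z>0 ; g-part = g-part ; group-size = group-size ; inner-few = inner-few }
    where open Groups part fair n>0 z

  _≟ᶜ_ : DecidableEquality Colour
  red  ≟ᶜ red  = yes refl
  red  ≟ᶜ blue = no λ ()
  blue ≟ᶜ red  = no λ ()
  blue ≟ᶜ blue = yes refl

  other : Colour → Colour
  other red  = blue
  other blue = red

  module _ {n : ℕ} where

    open Pairs n

    length≤cnt : ∀ {xs} → Unique xs → length xs ≤ cnt (λ v → any? (v Fin.≟_) xs) V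
    length≤cnt {xs} u = ≤-trans (≤-reflexive (sym (cnt-all (λ v → any? (v Fin.≟_) xs) xs (λ x → x))))
                                (∑-⊆ _ u (λ {v} _ → ∈-allFin v))

    uncovered-bound : ∀ {xs : List (Fin n)} → Unique xs → uncovered xs + length xs ≤ n
    uncovered-bound {xs} u = begin
      uncovered xs + length xs  ≡⟨ cong (_+ length xs) (cnt-filter (¬? ∘ in?) V) ⟩
      cnt (¬? ∘ in?) V + length xs                        ≤⟨ +-monoʳ-≤ _ (length≤cnt u) ⟩
      cnt (¬? ∘ in?) V + cnt in? V                        ≡⟨ +-comm (cnt (¬? ∘ in?) V) _ ⟩
      cnt in? V + cnt (¬? ∘ in?) V                        ≡⟨ cnt-¬ in? V ⟩
      length V                                            ≡⟨ length-V ⟩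
      n                                                   ∎
      where
      open ≤-Reasoning
      in? : ∀ v → Dec (v ∈ xs)
      in? v = any? (v Fin.≟_) xs

    rectangle : ∀ {R : Fin n → Fin n → Set} (R? : ∀ u v → Dec (R u v)) {X Y} → Unique X → Unique Y →
                (∀ {x y} → x ∈ X → y ∈ Y → R x y) → length X * length Y ≤ pc R?
    rectangle R? {X} {Y} uX uY f = begin
      length X * length Y            ≡⟨ sym (∑-const (length Y) X) ⟩
      ∑ (λ _ → length Y) X  ≤⟨ ∑-mono X (λ {x} x∈ → ≤-trans (≤-reflexive (sym (cnt-all (R? x) Y (f x∈))))
                                                                     (∑-⊆ _ uY (λ {v} _ → ∈-allFin v))) ⟩
      ∑ (λ x → cnt (R? x) V) X       ≤⟨ ∑-⊆ _ uX (λ {v} _ → ∈-allFin v) ⟩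
      pc R?                          ∎
      where open ≤-Reasoning

    -- There are at most `L` fibres, and each small one contributes fewer than `n / s` vertices.
    small-fibres : ∀ {L} (f : Fin n → Fin L) s →
      s * cnt (λ v → s * cnt (λ w → f w Fin.≟ f v) V <? n) V ≤ L * n
    small-fibres {L} f s = begin
      s * cnt small? V  ≤⟨ *-monoʳ-≤ s (∑-mono V (λ {v} _ → point v)) ⟩
      s * ∑ (λ v → cnt (fibre? v) (allFin L)) V  ≡⟨ cong (s *_) (∑-swap (λ v ℓ → ind (fibre? v ℓ)) V (allFin L)) ⟩
      s * ∑ (λ ℓ → cnt (λ v → fibre? v ℓ) V) (allFin L)    ≡⟨ sym (∑-* s _ (allFin L)) ⟩
      ∑ (λ ℓ → s * cnt (λ v → fibre? v ℓ) V) (allFin L)  ≤⟨ ∑-mono (allFin L) (λ {ℓ} _ → bound ℓ) ⟩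
      ∑ (λ _ → n) (allFin L)  ≡⟨ trans (∑-const n (allFin L)) (cong (_* n) (Pairs.length-V L)) ⟩
      L * n                                                ∎
      where
      open ≤-Reasoning
      small? : Decidable (λ v → s * cnt (λ w → f w Fin.≟ f v) V < n)
      small? v = s * cnt (λ w → f w Fin.≟ f v) V <? n
      fibre? : ∀ v ℓ → Dec (f v ≡ ℓ × s * cnt (λ w → f w Fin.≟ f v) V < n)
      fibre? v ℓ = (f v Fin.≟ ℓ) ×-dec small? v
      point : ∀ v → ind (small? v) ≤ cnt (fibre? v) (allFin L)
      point v = go (small? v) refl
        where
        go : ∀ d → small? v ≡ d → ind d ≤ cnt (fibre? v) (allFin L)
        go (no _)  _ = z≤n
        go (yes p) _ = cnt-∈ (fibre? v) (∈-allFin (f v)) (refl , p)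
      bound : ∀ ℓ → s * cnt (λ v → fibre? v ℓ) V ≤ n
      bound ℓ with cnt (λ v → fibre? v ℓ) V ≟ 0
      ... | yes e = *-zero-≤ s e
      ... | no ne with cnt-pos (λ v → fibre? v ℓ) V (n≢0⇒n>0 ne)
      ...   | v , _ , refl , p = ≤-trans (*-monoʳ-≤ s (cnt-mono (λ w → fibre? w ℓ) (λ w → f w Fin.≟ f v) V (λ _ → proj₁))) (<⇒≤ p)

    product-pc : ∀ {P Q : Fin n → Set} (P? : Decidable P) (Q? : Decidable Q) →
                 cnt P? V * cnt Q? V ≡ pc (λ u v → P? u ×-dec Q? v)
    product-pc P? Q? = sym (trans (∑-cong V (λ u → trans (∑-cong V (λ v → ind-× (P? u) (Q? v))) (∑-* (ind (P? u)) _ V)))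
      (trans (∑-cong V (λ u → *-comm (ind (P? u)) _)) (trans (∑-* (cnt Q? V) _ V) (*-comm (cnt Q? V) _))))

  -- Large cells and the balanced core

  module Cells {n : ℕ} (n>0 : 0 < n) (z h s : ℕ) (z>0 : 0 < z) (s-small : (z + z + (z + z)) * (s * s) < h)
    (g ρ b : Fin n → ℕ) (g-bound : ∀ v → g v < z) (ρ-bound : ∀ v → ρ v < z) (b-bound : ∀ v → b v < z)
    {W : Fin n → Fin n → Set} (W? : ∀ u v → Dec (W u v))
    (W-spans : ∀ {x y} → g x ≢ g y → ρ x ≢ ρ y → b x ≢ b y → W x y)
    (W-few : h * Pairs.pc n W? ≤ (z + z) * (n * n) + (z + z) * (n * n))
    (group-size : ∀ t → z * (cnt (λ v → g v ≟ t) (allFin n) + cnt (λ v → g v ≟ t) (allFin n)) ≤ z * n + (n + n)) where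

    open Pairs n

    -- The three coordinates are packed into one, so that deleting the vertices in small cells is a
    -- single instance of `small-fibres`.
    cell : Fin n → Fin (z * (z * z))
    cell v = Fin.combine (Fin.fromℕ< (g-bound v)) (Fin.combine (Fin.fromℕ< (ρ-bound v)) (Fin.fromℕ< (b-bound v)))

    cell-inj : ∀ {u v} → cell u ≡ cell v → g u ≡ g v × ρ u ≡ ρ v × b u ≡ b v
    cell-inj {u} {v} e with Fin.combine-injective (Fin.fromℕ< (g-bound u)) _ (Fin.fromℕ< (g-bound v)) _ e
    ... | e₁ , e₂₃ with Fin.combine-injective (Fin.fromℕ< (ρ-bound u)) _ (Fin.fromℕ< (ρ-bound v)) _ e₂₃
    ...   | e₂ , e₃ = Fin.fromℕ<-injective _ _ _ _ e₁ , Fin.fromℕ<-injective _ _ _ _ e₂ , Fin.fromℕ<-injective _ _ _ _ e₃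

    cellSize : Fin n → ℕ
    cellSize v = cnt (λ w → cell w Fin.≟ cell v) V

    small? : Decidable (λ v → s * cellSize v < n)
    small? v = s * cellSize v <? n

    large : List (Fin n)
    large = filter (¬? ∘ small?) V

    -- Two large cells differing in all three coordinates would span too many cross edges.
    compatible : ∀ {u v} → u ∈ large → v ∈ large →
                 g u ≡ g v ⊎ ρ u ≡ ρ v ⊎ b u ≡ b v
    compatible {u} {v} u∈ v∈ with g u ≟ g v | ρ u ≟ ρ v | b u ≟ b v
    ... | yes e | _ | _ = inj₁ e
    ... | no _ | yes e | _ = inj₂ (inj₁ e)
    ... | no _ | no _ | yes e = inj₂ (inj₂ e)
    ... | no g≢ | no r≢ | no b≢ = contradiction (*-cancelʳ-≤ h _ (n * n) {{>-nonZero (*-mono-< n>0 n>0)}} bound) (<⇒≱ s-small)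
      where
      big : ∀ {w} → w ∈ large → n ≤ s * cellSize w
      big {w} w∈ = ≮⇒≥ (proj₂ (∈-filter⁻ (¬? ∘ small?) {xs = V} w∈))
      in? : ∀ w → Decidable (λ x → cell x ≡ cell w)
      in? w x = cell x Fin.≟ cell w
      spans : ∀ {x y} → cell x ≡ cell u × cell y ≡ cell v → W x y
      spans {x} {y} (ex , ey) with cell-inj {x} {u} ex | cell-inj {y} {v} ey
      ... | gx , rx , bx | gy , ry , by = W-spans (λ e → g≢ (trans (sym gx) (trans e gy)))
              (λ e → r≢ (trans (sym rx) (trans e ry))) (λ e → b≢ (trans (sym bx) (trans e by)))
      bound : h * (n * n) ≤ (z + z + (z + z)) * (s * s) * (n * n)
      bound = begin
        h * (n * n)                                  ≤⟨ *-monoʳ-≤ h (*-mono-≤ (big u∈) (big v∈)) ⟩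
        h * (s * cellSize u * (s * cellSize v))      ≡⟨ alg₁ h s (cellSize u) (cellSize v) ⟩
        s * s * (h * (cellSize u * cellSize v))
          ≤⟨ *-monoʳ-≤ (s * s) (*-monoʳ-≤ h (≤-trans (≤-reflexive (product-pc (in? u) (in? v)))
               (pc-mono (λ x y → in? u x ×-dec in? v y) W? spans))) ⟩
        s * s * (h * pc W?)                   ≤⟨ *-monoʳ-≤ (s * s) W-few ⟩
        s * s * ((z + z) * (n * n) + (z + z) * (n * n)) ≡⟨ alg₂ s z (n * n) ⟩
        (z + z + (z + z)) * (s * s) * (n * n)        ∎
        where
        open ≤-Reasoning
        alg₁ : ∀ h s a b → h * (s * a * (s * b)) ≡ s * s * (h * (a * b))
        alg₁ = solve-∀
        alg₂ : ∀ s z q → s * s * ((z + z) * q + (z + z) * q) ≡ (z + z + (z + z)) * (s * s) * q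
        alg₂ = solve-∀

    lost : ℕ
    lost = cnt small? V

    lost-few : s * lost ≤ z * (z * z) * n
    lost-few = small-fibres cell s

    large+lost : length large + lost ≡ n
    large+lost = trans (cong (_+ lost) (cnt-filter (¬? ∘ small?) V))
      (trans (+-comm _ lost) (trans (cnt-¬ small? V) length-V))

    -- Allowance for `evenTrim`: a group doubled may exceed `n` by `2n / z`, and the vertices left
    -- number only `n` minus `lost`.
    excess : ℕ
    excess = lost + _/_ (n + n) z {{>-nonZero z>0}}

    record Core : Set where
      field
        m          : ℕ
        ys         : List (Fin n)
        unique     : Unique ys
        len        : length ys ≡ m + m
        fairGroups : ∀ l → cnt (λ v → g v ≟ l) ys ≤ m
        pairwise   : ∀ {u v} → u ∈ ys → v ∈ ys → g u ≡ g v ⊎ ρ u ≡ ρ v ⊎ b u ≡ b v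
        -- Small cells cost `lost`, fairness of the groups costs at most `excess`, and parity costs
        -- one more.
        missing    : n ≤ m + m + (lost + suc excess)

    core : Core
    core = finish (evenTrim g excess large nearlyFair)
      where
      instance
        z≢0 : NonZero z
        z≢0 = >-nonZero z>0
      nearlyFair : ∀ l → cnt (λ v → g v ≟ l) large + cnt (λ v → g v ≟ l) large ≤ length large + excess
      nearlyFair l = begin
        c + c                             ≤⟨ +-mono-≤ c≤ c≤ ⟩
        c′ + c′                           ≤⟨ m≤n+m∸n (c′ + c′) n ⟩
        n + (c′ + c′ ∸ n)  ≤⟨ +-monoʳ-≤ n (≤-trans (≤-reflexive (sym (m*n/n≡m (c′ + c′ ∸ n) z))) (/-monoˡ-≤ z over)) ⟩
        n + (n + n) / z                   ≡⟨ cong (_+ (n + n) / z) (sym large+lost) ⟩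
        length large + lost + (n + n) / z ≡⟨ +-assoc (length large) lost _ ⟩
        length large + excess             ∎
        where
        open ≤-Reasoning
        c = cnt (λ v → g v ≟ l) large
        c′ = cnt (λ v → g v ≟ l) V
        c≤ : c ≤ c′
        c≤ = ∑-⊆ _ (filter⁺ (¬? ∘ small?) (allFin⁺ n)) (λ {v} _ → ∈-allFin v)
        over : (c′ + c′ ∸ n) * z ≤ n + n
        over = ≤-trans (≤-reflexive (trans (*-comm _ z) (*-distribˡ-∸ z (c′ + c′) n)))
          (≤-trans (∸-monoˡ-≤ (z * n) (group-size l)) (≤-reflexive (m+n∸m≡n (z * n) (n + n))))
      finish : (∃₂ λ rs ys → large ↭ rs ++ ys × length rs ≤ suc excess ×
                 ∃ λ m → length ys ≡ m + m × (∀ l → cnt (λ v → g v ≟ l) ys ≤ m)) → Core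
      finish (rs , ys , p , rs≤ , m , len , parts) = record
        { m = m ; ys = ys ; len = len ; fairGroups = parts
        ; unique = proj₁ (proj₂ (Unique-++⁻ rs (Unique-↭ p (filter⁺ (¬? ∘ small?) (allFin⁺ n)))))
        ; pairwise = λ u∈ v∈ → compatible (∈-resp-↭ (↭-sym p) (∈-++⁺ʳ rs u∈)) (∈-resp-↭ (↭-sym p) (∈-++⁺ʳ rs v∈))
        ; missing = begin
            n                                 ≡⟨ sym large+lost ⟩
            length large + lost  ≡⟨ cong (_+ lost) (trans (↭-length p) (length-++ rs)) ⟩
            length rs + length ys + lost      ≤⟨ +-monoˡ-≤ lost (+-mono-≤ rs≤ (≤-reflexive len)) ⟩
            suc excess + (m + m) + lost       ≡⟨ alg (suc excess) (m + m) lost ⟩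
            m + m + (lost + suc excess)       ∎ }
        where
        open ≤-Reasoning
        alg : ∀ a b c → a + b + c ≡ b + (c + a)
        alg = solve-∀

  module Setup {n k : ℕ} (part : Fin n → Fin k) (col : Fin n → Fin n → Colour) (col-sym : Symmetric col)
    (n>0 : 0 < n) (z h : ℕ) (z>0 : 0 < z) (G : Grouping part z) where

    open Pairs n
    open Grouping G public

    -- Edges inside a group are given up here, so that adjacency depends on boundedly many groups
    -- only. By `inner-few` there are few of them.
    E : Colour → Fin n → Fin n → Set
    E c u v = g u ≢ g v × col u v ≡ c

    E? : ∀ c u v → Dec (E c u v)
    E? c u v = ¬? (g u ≟ g v) ×-dec (col u v ≟ᶜ c)

    E-sym : ∀ c {u v} → E c u v → E c v u
    E-sym c (ne , e) = ne ∘ sym , trans (col-sym _ _) e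

    monoEdge : ∀ {c u v} → E c u v → MonoEdge part col c u v
    monoEdge (ne , e) = g-part ne , e

    closedWalk : ∀ {c a xs b v₀} → Path (E c) a (a ∷ xs) b → E c b v₀ → ClosedWalkFrom part col c v₀ a xs
    closedWalk [ _ ]               e = monoEdge e
    closedWalk (step f p@([ _ ]))    e = monoEdge f , closedWalk p e
    closedWalk (step f p@(step _ _)) e = monoEdge f , closedWalk p e

    cycleShape : ∀ {c xs} → IsCycle (E c) xs → CycleShape part col c xs
    cycleShape (inj₁ refl)                              = tt
    cycleShape (inj₂ (a , .a , [ _ ] , e))              = tt
    cycleShape (inj₂ (a , b , p@(step _ [ _ ]) , e))      = closedWalk p e
    cycleShape (inj₂ (a , b , p@(step _ (step _ _)) , e)) = closedWalk p e

    Labellings : Set₁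
    Labellings = ∀ c → Labels.Robust n z h n>0 z>0 (E c) (E? c) (E-sym c)

    labellings : Labellings
    labellings c = Labels.robustLabelling n z h n>0 z>0 (E c) (E? c) (E-sym c)

    module Labelled (R : Labellings) where

      lab : Colour → Fin n → ℕ
      lab c = Labels.Robust.lab (R c)

      cross? : ∀ c u v → Dec (E c u v × lab c u ≢ lab c v)
      cross? c = Labels.cross? n z h n>0 z>0 (E c) (E? c) (E-sym c) (lab c)

      cross-few : ∀ c → h * pc (cross? c) ≤ (z + z) * (n * n)
      cross-few c = Labels.Robust.cross (R c)

      anyCross? : ∀ u v → Dec ((E red u v × lab red u ≢ lab red v) ⊎ (E blue u v × lab blue u ≢ lab blue v))
      anyCross? u v = cross? red u v ⊎-dec cross? blue u v

      anyCross-few : h * pc anyCross? ≤ (z + z) * (n * n) + (z + z) * (n * n)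
      anyCross-few = ≤-trans (*-monoʳ-≤ h (pc-⊎ anyCross? (cross? red) (cross? blue) (λ x → x)))
        (≤-trans (≤-reflexive (*-distribˡ-+ h _ _)) (+-mono-≤ (cross-few red) (cross-few blue)))

  -- Choosing the components

  colour-cases : ∀ c c′ → c′ ≡ c ⊎ c′ ≡ other c
  colour-cases red  red  = inj₁ refl
  colour-cases red  blue = inj₂ refl
  colour-cases blue red  = inj₂ refl
  colour-cases blue blue = inj₁ refl

  choose-colour : Colour → ℕ → ℕ → Colour → ℕ
  choose-colour red  a b red  = a
  choose-colour red  a b blue = b
  choose-colour blue a b red  = b
  choose-colour blue a b blue = a

  choose-same : ∀ c {a b} → choose-colour c a b c ≡ a
  choose-same red  = refl
  choose-same blue = refl

  choose-other : ∀ c {a b} → choose-colour c a b (other c) ≡ b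
  choose-other red  = refl
  choose-other blue = refl

  module Planning {A : Set} (g : A → ℕ) (lab : Colour → A → ℕ) (L : ℕ) (g-bound : ∀ v → g v < L) (lab-bound : ∀ c v → lab c v < L)
    (m : ℕ) (m>0 : 0 < m) (ys : List A) (len : length ys ≡ m + m) (fairGroups : ∀ l → cnt (λ v → g v ≟ l) ys ≤ m)
    (pairwise : ∀ {u v} → u ∈ ys → v ∈ ys → g u ≡ g v ⊎ lab red u ≡ lab red v ⊎ lab blue u ≡ lab blue v) where

    -- Whichever colour the edge `uv` has, it lies inside the chosen component of that colour or
    -- runs between two components, and the latter edges are few.
    Ok : (Colour → ℕ) → A → A → Set
    Ok r u v = g u ≢ g v × (∀ c → (lab c u ≡ r c × lab c v ≡ r c) ⊎ lab c u ≢ lab c v)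

    record Plan : Set where
      field
        r      : Colour → ℕ
        f₁ f₂  : A → Maybe (Fin 3)
        small₁ : PartsAtMost₃ f₁ m ys
        small₂ : PartsAtMost₃ f₂ m ys
        ok     : ∀ {u v} → u ∈ ys → v ∈ ys → ¬ Clash₃ f₁ u v → ¬ Clash₃ f₂ u v → Ok r u v

    escape : ∀ l → ∃ λ z → z ∈ ys × g z ≢ l
    escape l = cnt-pos (¬? ∘ λ v → g v ≟ l) ys (≤-trans m>0 (+-cancelˡ-≤ m _ _
      (≤-trans (≤-reflexive (sym (trans (cnt-¬ (λ v → g v ≟ l) ys) len))) (+-monoˡ-≤ _ (fairGroups l)))))

    superGroup : ∃ λ t → PartsAtMost₃ (superOf g t) m ys
    superGroup = merge₃ g L m ys len (λ {v} _ → g-bound v) fairGroups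

    no-clash : ∀ (f : A → ℕ) t {u v} → ¬ Clash₃ (superOf f t) u v → f u ≢ f v
    no-clash f t {u} {v} ¬cl e = ¬cl (super t (f u) , refl , cong (λ l → just (super t l)) (sym e))

    monoPlan : ∀ c r₀ → (∀ {v} → v ∈ ys → lab c v ≡ r₀) → Plan
    monoPlan c r₀ all = byMajority (any? (λ x → suc m ≤? cnt (λ v → b v ≟ b x) ys) ys)
      where
      b : A → ℕ
      b = lab (other c)
      t = proj₁ superGroup
      labels : ∀ b₀ {u v} → u ∈ ys → v ∈ ys → (b u ≡ b₀ × b v ≡ b₀) ⊎ b u ≢ b v →
               ∀ c′ → (lab c′ u ≡ choose-colour c r₀ b₀ c′ × lab c′ v ≡ choose-colour c r₀ b₀ c′) ⊎ lab c′ u ≢ lab c′ v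
      labels b₀ u∈ v∈ alt c′ with colour-cases c c′
      ... | inj₁ refl = inj₁ (trans (all u∈) (sym (choose-same c)) , trans (all v∈) (sym (choose-same c)))
      ... | inj₂ refl with alt
      ...   | inj₁ (bu , bv) = inj₁ (trans bu (sym (choose-other c)) , trans bv (sym (choose-other c)))
      ...   | inj₂ ne        = inj₂ ne
      byMajority : Dec (Any (λ x → m < cnt (λ v → b v ≟ b x) ys) ys) → Plan
      byMajority (no ¬maj) = record
        -- The component `0` is a dummy: compatible vertices always lie in different components of
        -- the other colour.
        { r = choose-colour c r₀ 0 ; f₁ = superOf g t ; f₂ = superOf b t′
        ; small₁ = proj₂ superGroup ; small₂ = proj₂ superLabel
        ; ok = λ u∈ v∈ ¬c₁ ¬c₂ → no-clash g t ¬c₁ , labels 0 u∈ v∈ (inj₂ (no-clash b t′ ¬c₂)) }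
        where
        parts : ∀ l → cnt (λ v → b v ≟ l) ys ≤ m
        parts l with cnt (λ v → b v ≟ l) ys ≤? m
        ... | yes le = le
        ... | no ¬le with cnt-pos (λ v → b v ≟ l) ys (≤-trans (s≤s z≤n) (≰⇒> ¬le))
        ...   | x , x∈ , refl = contradiction (lose x∈ (≰⇒> ¬le)) ¬maj
        superLabel : ∃ λ t′ → PartsAtMost₃ (superOf b t′) m ys
        superLabel = merge₃ b L m ys len (λ {v} _ → lab-bound (other c) v) parts
        t′ = proj₁ superLabel
      -- A majority component may be matched within itself, so only its complement is restricted.
      byMajority (yes maj) with find maj
      ... | x , _ , big = record
        { r = choose-colour c r₀ b₀ ; f₁ = superOf g t ; f₂ = f₂
        ; small₁ = proj₂ superGroup ; small₂ = small₂
        ; ok = λ {u} {v} u∈ v∈ ¬c₁ ¬c₂ → no-clash g t ¬c₁ , labels b₀ u∈ v∈ (alt u v ¬c₂) }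
        where
        b₀ = b x
        f : ∀ {l} → Dec (l ≡ b₀) → Maybe (Fin 3)
        f (yes _) = nothing
        f (no _)  = just zero
        f₂ : A → Maybe (Fin 3)
        f₂ v = f (b v ≟ b₀)
        only : ∀ {l} (d : Dec (l ≡ b₀)) {i} → f d ≡ just i → i ≡ zero × l ≢ b₀
        only (no ne) refl = refl , ne
        small₂ : PartsAtMost₃ f₂ m ys
        small₂ i = ≤-trans (cnt-mono (part₃? f₂ i) (¬? ∘ λ v → b v ≟ b₀) ys (λ {v} _ e → proj₂ (only (b v ≟ b₀) e)))
          (+-cancelˡ-≤ m _ _ (≤-trans (+-monoˡ-≤ _ (<⇒≤ big)) (≤-reflexive (trans (cnt-¬ (λ v → b v ≟ b₀) ys) len))))
        alt : ∀ u v → ¬ Clash₃ f₂ u v → (b u ≡ b₀ × b v ≡ b₀) ⊎ b u ≢ b v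
        alt u v ¬cl with b u ≟ b₀ | b v ≟ b₀
        ... | yes e | yes e′ = inj₁ (e , e′)
        ... | yes e | no ne  = inj₂ (λ q → ne (trans (sym q) e))
        ... | no ne | yes e  = inj₂ (λ q → ne (trans q e))
        ... | no _  | no _   = contradiction (zero , refl , refl) ¬cl

    open Trichotomy g (lab red) (lab blue) ys pairwise escape

    -- Of two vertices in different groups one lies in both chosen components, and this alone
    -- settles `Ok` in both colours. Hence only the groups have to be avoided.
    crossPlan : CrossShape → Plan
    crossPlan (r , s , g₁ , shape) = record
      { r = choose-colour red r s ; f₁ = superOf g t ; f₂ = λ _ → nothing
      ; small₁ = proj₂ superGroup
      ; small₂ = λ i → ≤-trans (≤-reflexive (∑-zero ys (λ _ → refl))) z≤n
      ; ok = λ {u} {v} u∈ v∈ ¬c₁ _ → no-clash g t {u} {v} ¬c₁ , labels (no-clash g t ¬c₁) (shape u∈) (shape v∈) }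
      where
      t = proj₁ superGroup
      agree : ∀ {a b r : ℕ} → a ≡ r → (a ≡ r × b ≡ r) ⊎ a ≢ b
      agree {a} {b} {r} e with b ≟ r
      ... | yes e′ = inj₁ (e , e′)
      ... | no ne  = inj₂ (λ q → ne (trans (sym q) e))
      agree′ : ∀ {a b r : ℕ} → b ≡ r → (a ≡ r × b ≡ r) ⊎ a ≢ b
      agree′ {a} {b} {r} e with a ≟ r
      ... | yes e′ = inj₁ (e′ , e)
      ... | no ne  = inj₂ (λ q → ne (trans q e))
      labels : ∀ {u v} → g u ≢ g v → Cell r s u ⊎ g u ≡ g₁ × (lab red u ≡ r ⊎ lab blue u ≡ s) →
               Cell r s v ⊎ g v ≡ g₁ × (lab red v ≡ r ⊎ lab blue v ≡ s) →
               ∀ c → (lab c u ≡ choose-colour red r s c × lab c v ≡ choose-colour red r s c) ⊎ lab c u ≢ lab c v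
      labels ne (inj₁ (e , _)) _ red  = agree e
      labels ne (inj₁ (_ , e)) _ blue = agree e
      labels ne (inj₂ _) (inj₁ (e , _)) red  = agree′ e
      labels ne (inj₂ _) (inj₁ (_ , e)) blue = agree′ e
      labels ne (inj₂ (e , _)) (inj₂ (e′ , _)) c = contradiction (trans e (sym e′)) ne

    plan : Plan ⊎ SplitShape
    plan with trichotomy
    ... | inj₁ (r , all)               = inj₁ (monoPlan red r all)
    ... | inj₂ (inj₁ (s , all))        = inj₁ (monoPlan blue s all)
    ... | inj₂ (inj₂ (inj₁ cross))     = inj₁ (crossPlan cross)
    ... | inj₂ (inj₂ (inj₂ splitting)) = inj₂ splitting

  maybe₃ : List (Maybe (Fin 3))
  maybe₃ = nothing ∷ just zero ∷ just (suc zero) ∷ just (suc (suc zero)) ∷ []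

  ∈-maybe₃ : ∀ x → x ∈ maybe₃
  ∈-maybe₃ nothing                 = here refl
  ∈-maybe₃ (just zero)             = there (here refl)
  ∈-maybe₃ (just (suc zero))       = there (there (here refl))
  ∈-maybe₃ (just (suc (suc zero))) = there (there (there (here refl)))

  -- Each end of a matched pair has two labels with four values each, so there are `256` keys,
  -- independently of `δ`.
  typePairs : List ((Maybe (Fin 3) × Maybe (Fin 3)) × (Maybe (Fin 3) × Maybe (Fin 3)))
  typePairs = cartesianProduct (cartesianProduct maybe₃ maybe₃) (cartesianProduct maybe₃ maybe₃)

  ∈-typePairs : ∀ p → p ∈ typePairs
  ∈-typePairs ((a , b) , (c , d)) =
    ∈-cartesianProduct⁺ (∈-cartesianProduct⁺ (∈-maybe₃ a) (∈-maybe₃ b)) (∈-cartesianProduct⁺ (∈-maybe₃ c) (∈-maybe₃ d))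

  -- Assembling the two cycles

  square-≤ : ∀ {a b} → a * a ≤ b * b → a ≤ b
  square-≤ {a} {b} le with a ≤? b
  ... | yes p = p
  ... | no ¬p = contradiction le (<⇒≱ (*-mono-< (≰⇒> ¬p) (≰⇒> ¬p)))

  module Assembly {n : ℕ} (n>0 : 0 < n) (z h : ℕ) (z>0 : 0 < z)
    (E : Colour → Fin n → Fin n → Set) (E? : ∀ c u v → Dec (E c u v)) (E-sym : ∀ c {u v} → E c u v → E c v u)
    (R : ∀ c → Labels.Robust n z h n>0 z>0 (E c) (E? c) (E-sym c))
    (g : Fin n → ℕ) (edge : ∀ u v → g u ≢ g v → ∃ λ c → E c u v)
    (N q K : ℕ) (N-big : K + K < N)
    (n-big : (h + h) * (N * suc (h + h) + N * suc (h + h)) ≤ n) where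

    open Pairs n

    w : ℕ
    w = N * suc (h + h)

    lab : Colour → Fin n → ℕ
    lab c = Labels.Robust.lab (R c)

    cross? : ∀ c u v → Dec (E c u v × lab c u ≢ lab c v)
    cross? c = Labels.cross? n z h n>0 z>0 (E c) (E? c) (E-sym c) (lab c)

    Stage : Colour → ℕ → List (Fin n) → ℕ → Set
    Stage c r F f = Labels.InClass.Hubs n z h n>0 z>0 (E c) (E? c) (E-sym c) (R c) r F N ⊎
                    Labels.InClass.DeadClass n z h n>0 z>0 (E c) (E? c) (E-sym c) (R c) r f

    hubVerts : ∀ c r {F f} → Stage c r F f → List (Fin n)
    hubVerts c r = Labels.InClass.hubVerts n z h n>0 z>0 (E c) (E? c) (E-sym c) (R c) r

    Usable : Colour → ℕ → List (Fin n) → List (Fin n) → Set₁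
    Usable c r = Labels.InClass.Usable n z h n>0 z>0 (E c) (E? c) (E-sym c) (R c) r N (w + w)

    inner? : ∀ c r u v → Dec (E c u v × lab c u ≡ r × lab c v ≡ r)
    inner? c = Labels.InClass.inner? n z h n>0 z>0 (E c) (E? c) (E-sym c) (R c)

    hubVerts-small : ∀ c r {F f} (st : Stage c r F f) → length (hubVerts c r st) ≤ w
    hubVerts-small c r (inj₁ hs) = Labels.InClass.Hubs.small hs
    hubVerts-small c r (inj₂ _)  = z≤n

    hubVerts-avoid : ∀ c r {F f} (st : Stage c r F f) → ∀ {v} → v ∈ hubVerts c r st → v ∉ F
    hubVerts-avoid c r (inj₁ hs) = Labels.InClass.Hubs.avoid hs

    module _ (cross-few : ∀ c → 4 * (q * q) * pc (cross? c) ≤ n * n)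
      (inner-few : ∀ x → z * x ≤ (z * ((w + w) * n) + N * (n * n)) + (z * ((w + w) * n) + N * (n * n)) → 4 * (q * q) * x ≤ n * n)
      (m : ℕ) (ys : List (Fin n)) (ys-unique : Unique ys) (len : length ys ≡ m + m)
      (r : Colour → ℕ) (f₁ f₂ : Fin n → Maybe (Fin 3)) (small₁ : PartsAtMost₃ f₁ m ys) (small₂ : PartsAtMost₃ f₂ m ys)
      (ok : ∀ {u v} → u ∈ ys → v ∈ ys → ¬ Clash₃ f₁ u v → ¬ Clash₃ f₂ u v →
            g u ≢ g v × (∀ c → (lab c u ≡ r c × lab c v ≡ r c) ⊎ lab c u ≢ lab c v)) where

      N>0 : 0 < N
      N>0 = ≤-trans (s≤s z≤n) N-big

      Ok : Fin n → Fin n → Set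
      Ok u v = g u ≢ g v × (∀ c → (lab c u ≡ r c × lab c v ≡ r c) ⊎ lab c u ≢ lab c v)

      record TwoCycles : Set where
        field
          reds blues  : List (Fin n)
          redCycle    : IsCycle (E red) reds
          blueCycle   : IsCycle (E blue) blues
          redUnique   : Unique reds
          blueUnique  : Unique blues
          disjoint    : ∀ v → v ∈ reds → v ∉ blues
          left        : ℕ
          left-few    : q * left ≤ K * 4 * (n + n)
          covered     : m + m ≤ length reds + length blues + left

      module Covered (Fᵣ Fᵇ : List (Fin n)) (apart : ∀ {v} → v ∈ Fᵇ → v ∉ Fᵣ)
        (usableᵣ : Usable red (r red) Fᵣ (Fᵣ ++ Fᵇ))
        (usableᵇ : Usable blue (r blue) Fᵇ (Fᵣ ++ Fᵇ)) where

        F : List (Fin n)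
        F = Fᵣ ++ Fᵇ

        module Uᵣ = Labels.InClass.Usable usableᵣ
        module Uᵇ = Labels.InClass.Usable usableᵇ

        open Cover Uᵣ.U Uᵇ.U Uᵣ.U? Uᵇ.U? Uᵣ.U-sym Uᵇ.U-sym

        module Cycles (cover : PathCover Ok K ys) where

          open PathCover cover

          flat-unique : Unique (concat ps₁ ++ concat ps₂ ++ concatH holes)
          flat-unique = Unique-↭ perm ys-unique

          -- In each of the two colours an edge is lost in one of two ways: between components, or
          -- inside the chosen component without being usable. These four kinds explain the factor
          -- `4` in the hypotheses.
          Unused : Fin n → Fin n → Set
          Unused u v = ((E red u v × lab red u ≢ lab red v) ⊎ (E blue u v × lab blue u ≢ lab blue v)) ⊎
                       (((E red u v × lab red u ≡ r red × lab red v ≡ r red) × ¬ Uᵣ.U u v) ⊎ ((E blue u v × lab blue u ≡ r blue × lab blue v ≡ r blue) × ¬ Uᵇ.U u v))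

          unused? : ∀ u v → Dec (Unused u v)
          unused? u v = (cross? red u v ⊎-dec cross? blue u v) ⊎-dec
            ((inner? red (r red) u v ×-dec ¬? (Uᵣ.U? u v)) ⊎-dec (inner? blue (r blue) u v ×-dec ¬? (Uᵇ.U? u v)))

          unused-few : q * q * pc unused? ≤ n * n
          unused-few = *-cancelˡ-≤ 4 (begin
            4 * (q * q * pc unused?)  ≡⟨ sym (*-assoc 4 (q * q) _) ⟩
            4 * (q * q) * pc unused?  ≤⟨ *-monoʳ-≤ (4 * (q * q)) parts ⟩
            4 * (q * q) * (a + b + (c + d))  ≡⟨ alg (4 * (q * q)) a b c d ⟩
            4 * (q * q) * a + 4 * (q * q) * b + (4 * (q * q) * c + 4 * (q * q) * d)
              ≤⟨ +-mono-≤ (+-mono-≤ (cross-few red) (cross-few blue)) (+-mono-≤ (inner-few c Uᵣ.few) (inner-few d Uᵇ.few)) ⟩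
            n * n + n * n + (n * n + n * n)                            ≡⟨ alg₂ (n * n) ⟩
            4 * (n * n)                                                ∎)
            where
            open ≤-Reasoning
            innerᵣ? : ∀ u v → Dec ((E red u v × lab red u ≡ r red × lab red v ≡ r red) × ¬ Uᵣ.U u v)
            innerᵣ? u v = inner? red (r red) u v ×-dec ¬? (Uᵣ.U? u v)
            innerᵇ? : ∀ u v → Dec ((E blue u v × lab blue u ≡ r blue × lab blue v ≡ r blue) × ¬ Uᵇ.U u v)
            innerᵇ? u v = inner? blue (r blue) u v ×-dec ¬? (Uᵇ.U? u v)
            a = pc (cross? red)
            b = pc (cross? blue)
            c = pc innerᵣ?
            d = pc innerᵇ?
            parts : pc unused? ≤ a + b + (c + d)
            parts = ≤-trans (pc-⊎ unused? (λ u v → cross? red u v ⊎-dec cross? blue u v) (λ u v → innerᵣ? u v ⊎-dec innerᵇ? u v) (λ x → x))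
              (+-mono-≤ (pc-⊎ (λ u v → cross? red u v ⊎-dec cross? blue u v) (cross? red) (cross? blue) (λ x → x))
                        (pc-⊎ (λ u v → innerᵣ? u v ⊎-dec innerᵇ? u v) innerᵣ? innerᵇ? (λ x → x)))
            alg : ∀ s a b c d → s * (a + b + (c + d)) ≡ s * a + s * b + (s * c + s * d)
            alg = solve-∀
            alg₂ : ∀ x → x + x + (x + x) ≡ 4 * x
            alg₂ = solve-∀

          unusedEdge : ∀ {x y} → Ok x y → ¬ Uᵣ.U x y → ¬ Uᵇ.U x y → Unused x y
          unusedEdge {x} {y} (ne , labels) ¬r ¬b with edge x y ne
          ... | red , e with labels red
          ...   | inj₁ (lx , ly) = inj₂ (inj₁ ((e , lx , ly) , ¬r))
          ...   | inj₂ l≢        = inj₁ (inj₁ (e , l≢))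
          unusedEdge {x} {y} (ne , labels) ¬r ¬b | blue , e with labels blue
          ...   | inj₁ (lx , ly) = inj₂ (inj₂ ((e , lx , ly) , ¬b))
          ...   | inj₂ l≢        = inj₁ (inj₂ (e , l≢))

          holes-small : ∀ H → Unique (concatH H) → All (IsHole Ok) H → q * length (concatH H) ≤ length H * (n + n)
          holes-small [] u [] = ≤-reflexive (*-zeroʳ q)
          holes-small ((X , Y) ∷ H) u ((bal , no₁ , no₂ , okXY) ∷ hs) with Unique-++⁻ (X ++ Y) u
          ... | uXY , uH , _ with Unique-++⁻ X uXY
          ...   | uX , uY , _ = begin
            q * length ((X ++ Y) ++ concatH H)  ≡⟨ cong (q *_) (trans (length-++ (X ++ Y)) (cong (_+ length (concatH H)) (length-++ X))) ⟩
            q * (length X + length Y + length (concatH H))  ≡⟨ alg q (length X) (length Y) _ ⟩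
            q * length X + q * length Y + q * length (concatH H)
              ≤⟨ +-mono-≤ (+-mono-≤ sizeX (subst (λ l → q * l ≤ n) bal sizeX)) (holes-small H uH hs) ⟩
            n + n + length H * (n + n)                             ∎
            where
            open ≤-Reasoning
            alg : ∀ q x y z → q * (x + y + z) ≡ q * x + q * y + q * z
            alg = solve-∀
            alg₂ : ∀ q x → q * x * (q * x) ≡ q * q * (x * x)
            alg₂ = solve-∀
            sizeX : q * length X ≤ n
            sizeX = square-≤ (begin
              q * length X * (q * length X)     ≡⟨ alg₂ q (length X) ⟩
              q * q * (length X * length X)     ≡⟨ cong (λ l → q * q * (length X * l)) bal ⟩
              q * q * (length X * length Y)
                ≤⟨ *-monoʳ-≤ (q * q) (rectangle unused? uX uY (λ x∈ y∈ → unusedEdge (okXY x∈ y∈) (no₁ x∈ y∈) (no₂ x∈ y∈))) ⟩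
              q * q * pc unused?                ≤⟨ unused-few ⟩
              n * n                             ∎)

          cycles : TwoCycles
          cycles with Unique-++⁻ (concat ps₁) flat-unique
          ... | u₁ , u₂₃ , d₁ with Unique-++⁻ (concat ps₂) u₂₃
          ...   | u₂ , u₃ , d₂
            with Uᵣ.cycle ps₁ (≤-trans (s≤s (≤-trans (≤-reflexive |ps₁|) (m≤m+n _ _))) N-big) all₁ u₁
               | Uᵇ.cycle ps₂ (≤-trans (s≤s (≤-reflexive |ps₂|)) N-big) all₂ u₂
          ...     | xs , cx , ux , insx , longx | zs , cz , uz , insz , longz = record
            { reds = xs ; blues = zs ; redCycle = cx ; blueCycle = cz ; redUnique = ux ; blueUnique = uz
            ; disjoint = λ v x∈ z∈ → disj (insx x∈) (insz z∈)
            ; left = length (concatH holes)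
            ; left-few = ≤-trans (holes-small holes u₃ allH) (≤-reflexive (cong (_* (n + n)) |holes|))
            ; covered = begin
                m + m                                                             ≡⟨ sym len ⟩
                length ys  ≡⟨ ↭-length perm ⟩
                length (concat ps₁ ++ concat ps₂ ++ concatH holes)  ≡⟨ trans (length-++ (concat ps₁)) (cong (length (concat ps₁) +_) (length-++ (concat ps₂))) ⟩
                length (concat ps₁) + (length (concat ps₂) + length (concatH holes)) ≡⟨ sym (+-assoc (length (concat ps₁)) _ _) ⟩
                length (concat ps₁) + length (concat ps₂) + length (concatH holes) ≤⟨ +-monoˡ-≤ _ (+-mono-≤ longx longz) ⟩
                length xs + length zs + length (concatH holes)                    ∎ }
            where
            open ≤-Reasoning
            -- Paths are disjoint parts of the cover, usable edges of either colour avoid the hubs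
            -- of both colours, and the blue hubs were grown outside the red ones.
            disj : ∀ {v} → v ∈ concat ps₁ ⊎ v ∈ Fᵣ → v ∈ concat ps₂ ⊎ v ∈ Fᵇ → ⊥
            disj (inj₁ a) (inj₁ b) = d₁ a (∈-++⁺ˡ b)
            disj (inj₁ a) (inj₂ b) = Labels.InClass.concat-avoid n z h n>0 z>0 (E red) (E? red) (E-sym red) (R red) (r red) {Uᵣ.U} {F} Uᵣ.U-sym Uᵣ.avoid ps₁ all₁ a (∈-++⁺ʳ Fᵣ b)
            disj (inj₂ a) (inj₁ b) = Labels.InClass.concat-avoid n z h n>0 z>0 (E blue) (E? blue) (E-sym blue) (R blue) (r blue) {Uᵇ.U} {F} Uᵇ.U-sym Uᵇ.avoid ps₂ all₂ b (∈-++⁺ˡ a)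
            disj (inj₂ a) (inj₂ b) = apart b a

      stageᵣ : Stage red (r red) [] w
      stageᵣ = Labels.InClass.manyHubs n z h n>0 z>0 (E red) (E? red) (E-sym red) (R red) (r red) N [] (≤-trans (*-monoʳ-≤ (h + h) (m≤m+n w w)) n-big)

      Fᵣ : List (Fin n)
      Fᵣ = hubVerts red (r red) stageᵣ

      stageᵇ : Stage blue (r blue) Fᵣ (length Fᵣ + w)
      stageᵇ = Labels.InClass.manyHubs n z h n>0 z>0 (E blue) (E? blue) (E-sym blue) (R blue) (r blue) N Fᵣ
        (≤-trans (*-monoʳ-≤ (h + h) (+-monoˡ-≤ w (hubVerts-small red (r red) stageᵣ))) n-big)

      Fᵇ : List (Fin n)
      Fᵇ = hubVerts blue (r blue) stageᵇ

      F : List (Fin n)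
      F = Fᵣ ++ Fᵇ

      F-small : length F ≤ w + w
      F-small = ≤-trans (≤-reflexive (length-++ Fᵣ))
        (+-mono-≤ (hubVerts-small red (r red) stageᵣ) (hubVerts-small blue (r blue) stageᵇ))

      usableᵣ : Usable red (r red) Fᵣ F
      usableᵣ = Labels.InClass.usable n z h n>0 z>0 (E red) (E? red) (E-sym red) (R red) (r red) stageᵣ N>0 (w + w) F (m≤m+n w w) F-small ∈-++⁺ˡ

      usableᵇ : Usable blue (r blue) Fᵇ F
      usableᵇ = Labels.InClass.usable n z h n>0 z>0 (E blue) (E? blue) (E-sym blue) (R blue) (r blue) stageᵇ N>0 (w + w) F
        (+-monoˡ-≤ w (hubVerts-small red (r red) stageᵣ)) F-small (∈-++⁺ʳ Fᵣ)

      matching : ∃ λ M → flat M ↭ ys × All (λ { (u , v) → ¬ Clash₃ f₁ u v × ¬ Clash₃ f₂ u v }) M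
      matching = perfectMatching₃ m ys len small₁ small₂

      M : List (Fin n × Fin n)
      M = proj₁ matching

      ∈-flat : ∀ {u v} {M : List (Fin n × Fin n)} → (u , v) ∈ M → u ∈ flat M × v ∈ flat M
      ∈-flat (here refl) = here refl , there (here refl)
      ∈-flat (there i) with ∈-flat i
      ... | a , b = there (there a) , there (there b)

      -- Clashing depends on labels only: `v′` has the labels of `v`, the partner of `u`, so it
      -- clashes with `u` as little as `v` does.
      type-ok : ∀ {u v u′ v′} → (u , v) ∈ M → (u′ , v′) ∈ M →
                (f₁ u , f₂ u) ≡ (f₁ u′ , f₂ u′) → (f₁ v , f₂ v) ≡ (f₁ v′ , f₂ v′) → Ok u v′
      type-ok {u} {v} {u′} {v′} i i′ _ e =
        ok (∈-resp-↭ (proj₁ (proj₂ matching)) (proj₁ (∈-flat i))) (∈-resp-↭ (proj₁ (proj₂ matching)) (proj₂ (∈-flat i′)))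
           (λ { (l , a , b) → proj₁ (All.lookup (proj₂ (proj₂ matching)) i) (l , a , trans (cong proj₁ e) b) })
           (λ { (l , a , b) → proj₂ (All.lookup (proj₂ (proj₂ matching)) i) (l , a , trans (cong proj₂ e) b) })

      twoCycles : (keys : List ((Maybe (Fin 3) × Maybe (Fin 3)) × (Maybe (Fin 3) × Maybe (Fin 3)))) →
                  (∀ p → p ∈ keys) → length keys ≡ K → TwoCycles
      twoCycles keys all∈ refl = Cycles.cycles (record { PathCover cover ; perm = ↭trans (↭-sym (proj₁ (proj₂ matching))) (PathCover.perm cover) })
        where
        open Covered Fᵣ Fᵇ (hubVerts-avoid blue (r blue) stageᵇ) usableᵣ usableᵇ
        open Cover Uᵣ.U Uᵇ.U Uᵣ.U? Uᵇ.U? Uᵣ.U-sym Uᵇ.U-sym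
        cover : PathCover Ok (length keys) (flat M)
        cover = coverMatching (≡-dec (Maybe.≡-dec Fin._≟_) (Maybe.≡-dec Fin._≟_)) (λ v → f₁ v , f₂ v) keys M
          (λ _ → all∈ _) type-ok

  -- Constants

  -- A positive fraction is at least the reciprocal of its denominator, so all estimates can be made
  -- in natural numbers with `1 / D` in place of `δ`.
  scale-≤ : ∀ δ → Positive δ → ∀ a b → suc (ℚ.denominator-1 δ) * a ≤ b → ℕtoℚ a ≤ℚ δ *ℚ ℕtoℚ b
  scale-≤ (mkℚ (ℤ.+ zero) _ _) (record { pos = () })
  scale-≤ (mkℚ (ℤ.-[1+ _ ]) _ _) (record { pos = () })
  scale-≤ δ@(mkℚ (ℤ.+ suc p) q-1 _) _ a b le = ℚ.toℚᵘ-cancel-≤ (begin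
    toℚᵘ (ℕtoℚ a)                                               ≃⟨ ℚ.toℚᵘ-fromℚᵘ (ℚᵘ.mkℚᵘ (ℤ.+ a) 0) ⟩
    ℚᵘ.mkℚᵘ (ℤ.+ a) 0                                           ≤⟨ ℚᵘ.*≤* ineq ⟩
    ℚᵘ.mkℚᵘ (ℤ.+ suc p) q-1 ℚᵘ.* ℚᵘ.mkℚᵘ (ℤ.+ b) 0
      ≃⟨ ℚᵘ.*-congˡ {ℚᵘ.mkℚᵘ (ℤ.+ suc p) q-1} (ℚᵘ.≃-sym (ℚ.toℚᵘ-fromℚᵘ (ℚᵘ.mkℚᵘ (ℤ.+ b) 0))) ⟩
    ℚᵘ.mkℚᵘ (ℤ.+ suc p) q-1 ℚᵘ.* toℚᵘ (ℕtoℚ b)                  ≃⟨ ℚᵘ.≃-sym (ℚ.toℚᵘ-homo-* δ (ℕtoℚ b)) ⟩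
    toℚᵘ (δ *ℚ ℕtoℚ b)                                          ∎)
    where
    open ℚᵘ.≤-Reasoning
    ineqℕ : a * (suc q-1 * 1) ≤ suc p * b * 1
    ineqℕ = ≤-trans (≤-reflexive (alg a (suc q-1))) (≤-trans le (≤-trans (m≤m+n b (p * b)) (≤-reflexive (sym (*-identityʳ _)))))
      where
      alg : ∀ a q → a * (q * 1) ≡ q * a
      alg = solve-∀
    ineq : (ℤ.+ a) ℤ.* (ℤ.+ (suc q-1 * 1)) ℤ.≤ ((ℤ.+ suc p) ℤ.* (ℤ.+ b)) ℤ.* (ℤ.+ 1)
    ineq = subst₂ ℤ._≤_ (ℤ.pos-* a (suc q-1 * 1)) (trans (ℤ.pos-* (suc p * b) 1) (cong (ℤ._* ℤ.+ 1) (ℤ.pos-* (suc p) b)))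
             (ℤ.+≤+ ineqℕ)

  cross-arith : ∀ {q z h x Q} → 8 * (q * q) * z ≤ h → 0 < z → h * x ≤ (z + z) * Q → 4 * (q * q) * x ≤ Q
  cross-arith {q} {z} {h} {x} {Q} le z>0 hx =
    *-cancelˡ-≤ (z + z) {{>-nonZero (≤-trans z>0 (m≤m+n z z))}} (≤-trans (≤-reflexive (alg q z x)) (≤-trans (*-monoˡ-≤ x le) hx))
    where
    alg : ∀ q z x → (z + z) * (4 * (q * q) * x) ≡ 8 * (q * q) * z * x
    alg = solve-∀

  -- With the threshold `16q²N`, the vertices missed by hubs spoil at most `n² / 8q²` pairs; for
  -- large `n` the reserved vertices add at most half as much. Together this stays below `n² / 4q²`.
  inner-arith : ∀ {q N n f x} → 0 < N → 32 * (q * q) * f ≤ n →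
    16 * (q * q) * N * x ≤ (16 * (q * q) * N * (f * n) + N * (n * n)) + (16 * (q * q) * N * (f * n) + N * (n * n)) →
    4 * (q * q) * x ≤ n * n
  inner-arith {q} {N} {n} {f} {x} N>0 le hx = *-cancelˡ-≤ 4 (*-cancelˡ-≤ N {{>-nonZero N>0}} (begin
    N * (4 * (4 * (q * q) * x))                        ≡⟨ alg₁ N q x ⟩
    16 * (q * q) * N * x                               ≤⟨ hx ⟩
    (16 * (q * q) * N * (f * n) + N * (n * n)) + (16 * (q * q) * N * (f * n) + N * (n * n)) ≡⟨ alg₂ N q f n ⟩
    N * (32 * (q * q) * f * n + (n * n + n * n))  ≤⟨ *-monoʳ-≤ N (+-monoˡ-≤ _ (*-monoˡ-≤ n le)) ⟩
    N * (n * n + (n * n + n * n))                      ≤⟨ *-monoʳ-≤ N (m≤m+n _ (n * n)) ⟩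
    N * (n * n + (n * n + n * n) + n * n)              ≡⟨ cong (N *_) (alg₃ (n * n)) ⟩
    N * (4 * (n * n))                                  ∎))
    where
    open ≤-Reasoning
    alg₁ : ∀ N q x → N * (4 * (4 * (q * q) * x)) ≡ 16 * (q * q) * N * x
    alg₁ = solve-∀
    alg₂ : ∀ N q f n → (16 * (q * q) * N * (f * n) + N * (n * n)) + (16 * (q * q) * N * (f * n) + N * (n * n)) ≡
                       N * (32 * (q * q) * f * n + (n * n + n * n))
    alg₂ = solve-∀
    alg₃ : ∀ x → x + (x + x) + x ≡ 4 * x
    alg₃ = solve-∀

  module Constants (K D : ℕ) (K>0 : 0 < K) (D>0 : 0 < D) where

    private
      *-pos : ∀ {a b} → 0 < a → 0 < b → 0 < a * b
      *-pos {suc a} {suc b} _ _ = s≤s z≤n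

    abstract
      N C q z s h f n₀ : ℕ
      -- The second colour has `2K` paths to link, and one further hub closes the cycle.
      N  = suc (K + K)
      -- The split case decides: it deletes at most `12n² / C` pairs, and `n²` is at most four times
      -- the number of edges. So `48` would do.
      C  = 64 * D
      -- The `4K` holes have two sides of at most `n / q` vertices, at most `n / C` vertices in all.
      q  = K * 8 * C
      z  = 16 * (q * q) * N
      -- Each of the `z³` cells loses fewer than `n / s` vertices, together at most `n / C`.
      s  = C * (z * (z * z))
      -- The first summand rules out two large cells without a common coordinate; the others make
      -- the edges between components negligible for the holes and for the split case.
      h  = suc ((z + z + (z + z)) * (s * s)) + (8 * (q * q) * z + 128 * D * z)
      f  = N * suc (h + h) + N * suc (h + h)
      -- Room for the hubs of both colours, insignificance of the `f` reserved vertices, and `C ≤ n`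
      -- to absorb the vertex lost to parity.
      n₀ = (h + h) * f + (32 * (q * q) * f + C)

      N-big : K + K < N
      N-big = ≤-refl

      C≡ : C ≡ 64 * D
      C≡ = refl

      C>0 : 0 < C
      C>0 = *-pos {64} (s≤s z≤n) D>0

      q>0 : 0 < q
      q>0 = *-pos (*-pos K>0 (s≤s z≤n)) C>0

      z>0 : 0 < z
      z>0 = *-pos (*-pos {16} (s≤s z≤n) (*-pos q>0 q>0)) (s≤s z≤n)

      2C≤z : C + C ≤ z
      2C≤z = begin
        C + C                  ≤⟨ +-mono-≤ C≤q C≤q ⟩
        q + q                  ≤⟨ m≤m+n (q + q) (14 * q) ⟩
        q + q + 14 * q         ≡⟨ alg q ⟩
        16 * q                 ≤⟨ *-monoʳ-≤ 16 (m≤m*n q q {{>-nonZero q>0}}) ⟩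
        16 * (q * q)           ≤⟨ m≤m*n _ N ⟩
        z                      ∎
        where
        open ≤-Reasoning
        C≤q : C ≤ q
        C≤q = m≤n*m C (K * 8) {{>-nonZero (*-pos K>0 (s≤s z≤n))}}
        alg : ∀ q → q + q + 14 * q ≡ 16 * q
        alg = solve-∀

      s-small : (z + z + (z + z)) * (s * s) < h
      s-small = m≤m+n _ _

      8qqz≤h : 8 * (q * q) * z ≤ h
      8qqz≤h = ≤-trans (m≤m+n _ (128 * D * z)) (m≤n+m _ (suc ((z + z + (z + z)) * (s * s))))

      128Dz≤h : 128 * D * z ≤ h
      128Dz≤h = ≤-trans (m≤n+m _ (8 * (q * q) * z)) (m≤n+m _ (suc ((z + z + (z + z)) * (s * s))))

      hub-room : ∀ {n} → n₀ < n → (h + h) * (N * suc (h + h) + N * suc (h + h)) ≤ n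
      hub-room lt = ≤-trans (m≤m+n _ _) (<⇒≤ lt)

      C≤n : ∀ {n} → n₀ < n → C ≤ n
      C≤n lt = ≤-trans (m≤n+m C (32 * (q * q) * f)) (≤-trans (m≤n+m _ ((h + h) * f)) (<⇒≤ lt))

      unused-few : ∀ {n} → n₀ < n → ∀ x →
        z * x ≤ (z * ((N * suc (h + h) + N * suc (h + h)) * n) + N * (n * n)) + (z * ((N * suc (h + h) + N * suc (h + h)) * n) + N * (n * n)) →
        4 * (q * q) * x ≤ n * n
      unused-few lt x = inner-arith {q} {N} {_} {f} {x} (s≤s z≤n)
        (≤-trans (m≤m+n _ C) (≤-trans (m≤n+m _ ((h + h) * f)) (<⇒≤ lt)))

      lost-few : ∀ {n x} → s * x ≤ z * (z * z) * n → C * x ≤ n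
      lost-few {n} {x} le = *-cancelˡ-≤ (z * (z * z)) {{>-nonZero (*-pos z>0 (*-pos z>0 z>0))}}
        (≤-trans (≤-reflexive (alg C (z * (z * z)) x)) le)
        where
        alg : ∀ c l x → l * (c * x) ≡ c * l * x
        alg = solve-∀

      left-few : ∀ {n x} → q * x ≤ K * 4 * (n + n) → C * x ≤ n
      left-few {n} {x} le = *-cancelˡ-≤ (K * 8) {{>-nonZero (*-pos K>0 (s≤s z≤n))}}
        (≤-trans (≤-reflexive (sym (*-assoc (K * 8) C x))) (≤-trans le (≤-reflexive (alg K n))))
        where
        alg : ∀ K n → K * 4 * (n + n) ≡ K * 8 * n
        alg = solve-∀

    share-few : ∀ n → C * (_/_ (n + n) z {{>-nonZero z>0}}) ≤ n
    share-few n = half-≤ (begin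
      C * d + C * d        ≡⟨ sym (*-distribʳ-+ d C C) ⟩
      (C + C) * d          ≤⟨ *-monoˡ-≤ d 2C≤z ⟩
      z * d                ≡⟨ *-comm z d ⟩
      d * z                ≤⟨ m/n*n≤m (n + n) z {{>-nonZero z>0}} ⟩
      n + n                ∎)
      where
      open ≤-Reasoning
      d = _/_ (n + n) z {{>-nonZero z>0}}

    -- The vertices of small cells enter twice: they are deleted, and their deletion may upset the
    -- balance of the groups by as much.
    missing-few : ∀ {n a d} → C * a ≤ n → C * d ≤ n → C ≤ n → C * (a + suc (a + d)) ≤ 4 * n
    missing-few {n} {a} {d} ha hd hC = ≤-trans (≤-reflexive (alg C a d))
      (≤-trans (+-mono-≤ (+-mono-≤ ha ha) (+-mono-≤ hd hC)) (≤-reflexive (alg₂ n)))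
      where
      alg : ∀ c a d → c * (a + suc (a + d)) ≡ c * a + c * a + (c * d + c)
      alg = solve-∀
      alg₂ : ∀ n → n + n + (n + n) ≡ 4 * n
      alg₂ = solve-∀

    m-pos : ∀ {n m x} → 0 < n → n ≤ m + m + x → C * x ≤ 4 * n → 0 < m
    m-pos {n} {zero} {x} n>0 le hx = contradiction (≤-trans (*-monoʳ-≤ C le) hx) (<⇒≱ (begin-strict
      4 * n           <⟨ *-monoˡ-< n {{>-nonZero n>0}} (s≤s (s≤s (s≤s (s≤s (s≤s (z≤n {59})))))) ⟩
      64 * n  ≤⟨ *-monoˡ-≤ n (≤-trans (m≤m*n 64 D {{>-nonZero D>0}}) (≤-reflexive (sym C≡))) ⟩
      C * n           ∎))
      where open ≤-Reasoning
    m-pos {m = suc m} _ _ _ = s≤s z≤n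

    final-arith : ∀ {n m miss left len u} → n ≤ m + m + miss → C * miss ≤ 4 * n → C * left ≤ n →
                  m + m ≤ len + left → u + len ≤ n → D * u ≤ n
    final-arith {n} {m} {miss} {left} {len} {u} h₁ h₂ h₃ h₄ h₅ = *-cancelˡ-≤ 64 (begin
      64 * (D * u)             ≡⟨ sym (*-assoc 64 D u) ⟩
      64 * D * u               ≡⟨ cong (_* u) (sym C≡) ⟩
      C * u                    ≤⟨ *-monoʳ-≤ C u≤ ⟩
      C * (miss + left)        ≡⟨ *-distribˡ-+ C miss left ⟩
      C * miss + C * left      ≤⟨ +-mono-≤ h₂ h₃ ⟩
      4 * n + n                ≤⟨ m≤m+n _ (59 * n) ⟩
      4 * n + n + 59 * n       ≡⟨ alg n ⟩
      64 * n                   ∎)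
      where
      open ≤-Reasoning
      alg : ∀ n → 4 * n + n + 59 * n ≡ 64 * n
      alg = solve-∀
      u≤ : u ≤ miss + left
      u≤ = lin 0 (+-mono-≤ (+-mono-≤ h₅ h₁) h₄) (alg₂ u miss left len m n)
        where
        alg₂ : ∀ u x l k m n → u + (n + (m + m + x) + (k + l)) + 0 ≡ x + l + (u + k + n + (m + m))
        alg₂ = solve-∀

    close-arith : ∀ {n e t miss I X} → n * n ≤ 4 * e → C * miss ≤ 4 * n → z * I ≤ n * n + n * n →
      h * X ≤ (z + z) * (n * n) + (z + z) * (n * n) → t ≤ (n * miss + n * miss) + (I + X) → D * t ≤ e
    close-arith {n} {e} {t} {miss} {I} {X} he hm hI hX ht = *-cancelˡ-≤ 64 (begin
      64 * (D * t)  ≡⟨ trans (sym (*-assoc 64 D t)) (cong (_* t) (sym C≡)) ⟩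
      C * t                                             ≤⟨ *-monoʳ-≤ C ht ⟩
      C * ((n * miss + n * miss) + (I + X))             ≡⟨ alg₁ C n miss I X ⟩
      (n * (C * miss) + n * (C * miss)) + (C * I + C * X)
        ≤⟨ +-mono-≤ (+-mono-≤ (*-monoʳ-≤ n hm) (*-monoʳ-≤ n hm)) (+-mono-≤ CI CX) ⟩
      (n * (4 * n) + n * (4 * n)) + (n * n + n * n + (n * n + n * n)) ≤⟨ m≤m+n _ (4 * (n * n)) ⟩
      (n * (4 * n) + n * (4 * n)) + (n * n + n * n + (n * n + n * n)) + 4 * (n * n) ≡⟨ alg₂ n ⟩
      16 * (n * n)                                      ≤⟨ *-monoʳ-≤ 16 he ⟩
      16 * (4 * e)                                      ≡⟨ sym (*-assoc 16 4 e) ⟩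
      64 * e                                            ∎)
      where
      open ≤-Reasoning
      alg₁ : ∀ c n m I X → c * ((n * m + n * m) + (I + X)) ≡ (n * (c * m) + n * (c * m)) + (c * I + c * X)
      alg₁ = solve-∀
      alg₂ : ∀ n → (n * (4 * n) + n * (4 * n)) + (n * n + n * n + (n * n + n * n)) + 4 * (n * n) ≡ 16 * (n * n)
      alg₂ = solve-∀
      CI : C * I ≤ n * n + n * n
      CI = ≤-trans (*-monoˡ-≤ I (≤-trans (m≤m+n C C) 2C≤z)) hI
      CX : C * X ≤ n * n + n * n
      CX = *-cancelˡ-≤ (z + z) {{>-nonZero (≤-trans z>0 (m≤m+n z z))}} (begin
        (z + z) * (C * X)          ≡⟨ cong (λ c → (z + z) * (c * X)) C≡ ⟩
        (z + z) * (64 * D * X)     ≡⟨ alg₃ z D X ⟩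
        128 * D * z * X            ≤⟨ *-monoˡ-≤ X 128Dz≤h ⟩
        h * X                      ≤⟨ hX ⟩
        (z + z) * (n * n) + (z + z) * (n * n) ≡⟨ sym (*-distribˡ-+ (z + z) (n * n) (n * n)) ⟩
        (z + z) * (n * n + n * n)  ∎)
        where
        alg₃ : ∀ z D X → (z + z) * (64 * D * X) ≡ 128 * D * z * X
        alg₃ = solve-∀

  -- The split case and the conclusion

  does-true : ∀ {P : Set} (d : Dec P) → P → does d ≡ true
  does-true (yes _) _ = refl
  does-true (no ¬p) p = contradiction p ¬p

  does-false : ∀ {P : Set} (d : Dec P) → ¬ P → does d ≡ false
  does-false (yes p) ¬p = contradiction p ¬p
  does-false (no _)  _  = refl

  does-¬?-true : ∀ {P : Set} (d : Dec P) → does (¬? d) ≡ true → ¬ P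
  does-¬?-true (no ¬p) _ = ¬p

  does-¬?-false : ∀ {P : Set} (d : Dec P) → does (¬? d) ≡ false → P
  does-¬?-false (yes p) _ = p

  splitColour-sym : ∀ a b → splitColour a b ≡ splitColour b a
  splitColour-sym false false = refl
  splitColour-sym false true  = refl
  splitColour-sym true  false = refl
  splitColour-sym true  true  = refl

  Scales : ℕ → ℚ → Set
  Scales D δ = ∀ a b → D * a ≤ b → ℕtoℚ a ≤ℚ δ *ℚ ℕtoℚ b

  deltaClose : ∀ {n k} (part : Fin n → Fin k) (col : Fin n → Fin n → Colour) D δ →
    Scales D δ → (del : Fin n → Fin n → Bool) (side sub : Fin n → Bool) →
    D * countPairs (λ u v → if adjᵇ part u v then del u v else false) ≤ numEdges part →
    (∀ u v → del u v ≡ false → (side u ≢ side v) × (col u v ≡ splitColour (sub u) (sub v))) → DeltaClose δ part col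
  deltaClose part col D δ scale del side sub few split = del , scale _ _ few , side , sub , λ u v _ _ → split u v

  module Main (K D : ℕ) (K>0 : 0 < K) (D>0 : 0 < D) {n k : ℕ} (n₀<n : Constants.n₀ K D K>0 D>0 < n)
    (part : Fin n → Fin k) (fair : Fair part) (col : Fin n → Fin n → Colour) (col-sym : Symmetric col) where

    open Constants K D K>0 D>0
    open Pairs n

    n>0 : 0 < n
    n>0 = ≤-trans (s≤s z≤n) n₀<n

    Cycles : Set
    Cycles = Σ (List (Fin n)) λ Rs → Σ (List (Fin n)) λ Bs →
      MonoCycle part col red Rs × MonoCycle part col blue Bs × Disjoint Rs Bs × D * uncovered (Rs ++ Bs) ≤ n

    module WithLabels (G : Grouping part z) (R : Setup.Labellings part col col-sym n>0 z h z>0 G) where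

      open Setup part col col-sym n>0 z h z>0 G
      open Labelled R

      spans : ∀ {x y} → g x ≢ g y → lab red x ≢ lab red y → lab blue x ≢ lab blue y →
              (E red x y × lab red x ≢ lab red y) ⊎ (E blue x y × lab blue x ≢ lab blue y)
      spans {x} {y} g≢ r≢ b≢ = byColour (col x y) refl
        where
        byColour : ∀ c → col x y ≡ c → (E red x y × lab red x ≢ lab red y) ⊎ (E blue x y × lab blue x ≢ lab blue y)
        byColour red  e = inj₁ ((g≢ , e) , r≢)
        byColour blue e = inj₂ ((g≢ , e) , b≢)

      lab-bound : ∀ c v → lab c v < z
      lab-bound c = Labels.Robust.bound (R c)

      open Cells n>0 z h s z>0 s-small g (lab red) (lab blue) g-bound
        (lab-bound red) (lab-bound blue) anyCross? spans anyCross-few group-size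
        using (Core; core; lost; excess) renaming (lost-few to lost-count)

      miss : ℕ
      miss = lost + suc excess

      miss-few : C * miss ≤ 4 * n
      miss-few = missing-few (lost-few lost-count) (share-few n) (C≤n n₀<n)

      module WithCore (c : Core) where

        open Core c

        m>0 : 0 < m
        m>0 = m-pos n>0 missing miss-few

        open Planning g lab z g-bound lab-bound m m>0 ys len fairGroups pairwise
        open Trichotomy g (lab red) (lab blue) ys pairwise escape using (SplitShape; Cell)

        edge : ∀ u v → g u ≢ g v → ∃ λ c → E c u v
        edge u v ne = col u v , ne , refl

        cycles : Plan → length typePairs ≡ K → Cycles
        cycles p |K| = finish (Assembly.twoCycles n>0 z h z>0 E E? E-sym R g edge N q K N-big (hub-room n₀<n) (λ c → cross-arith {q} {z} {h} 8qqz≤h z>0 (cross-few c)) (unused-few n₀<n)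
                            m ys unique len r f₁ f₂ small₁ small₂ ok typePairs ∈-typePairs |K|)
          where
          open Plan p
          finish : Assembly.TwoCycles n>0 z h z>0 E E? E-sym R g edge N q K N-big (hub-room n₀<n)
                   (λ c → cross-arith {q} {z} {h} 8qqz≤h z>0 (cross-few c)) (unused-few n₀<n) m ys unique len r f₁ f₂ small₁ small₂ ok → Cycles
          finish t = reds , blues , (redUnique , cycleShape redCycle) , (blueUnique , cycleShape blueCycle) , disjoint ,
            final-arith {m = m} {miss = miss} missing miss-few (left-few left-few′) (≤-trans covered (≤-reflexive (cong (_+ left) (sym (length-++ reds)))))
              (uncovered-bound (Unique-++⁺ redUnique blueUnique (λ { (a , b) → disjoint _ a b })))
            where open Assembly.TwoCycles t renaming (left-few to left-few′)

        module Splitting (r₁ r₂ s₁ s₂ g₁ g₂ : ℕ) (r≢ : r₁ ≢ r₂) (s≢ : s₁ ≢ s₂)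
          (shape : ∀ {v} → v ∈ ys → g v ≡ g₁ × (Cell r₁ s₁ v ⊎ Cell r₂ s₂ v) ⊎ g v ≡ g₂ × (Cell r₁ s₂ v ⊎ Cell r₂ s₁ v)) where

          -- Exactly the pairs for which the position of the ends in the four cells determines the
          -- colour; all other edges are deleted.
          Keep : Fin n → Fin n → Set
          Keep u v = u ∈ ys × v ∈ ys × g u ≢ g v × ¬ ((E red u v × lab red u ≢ lab red v) ⊎ (E blue u v × lab blue u ≢ lab blue v))

          in? : ∀ v → Dec (v ∈ ys)
          in? v = any? (v Fin.≟_) ys

          keep? : ∀ u v → Dec (Keep u v)
          keep? u v = in? u ×-dec in? v ×-dec ¬? (g u ≟ g v) ×-dec ¬? (anyCross? u v)

          del : Fin n → Fin n → Bool
          del u v = does (¬? (keep? u v))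

          -- The group gives the bipartition. In each group the two cells have different blue
          -- components, so the blue component alone refines it.
          side sub : Fin n → Bool
          side v = does (g v ≟ g₁)
          sub v  = does (lab blue v ≟ s₂)

          sub-true : ∀ {v} → lab blue v ≡ s₂ → sub v ≡ true
          sub-true {v} e = does-true (lab blue v ≟ s₂) e

          sub-false : ∀ {v} → lab blue v ≡ s₁ → sub v ≡ false
          sub-false {v} e = does-false (lab blue v ≟ s₂) (λ e′ → s≢ (trans (sym e) e′))

          -- Each of the four combinations of cells shares exactly one component, and the edge must
          -- have its colour: blue if the blue components, and thus the values of `sub`, agree, and
          -- red otherwise.
          colouring : ∀ {u v} → (col u v ≡ red → lab red u ≡ lab red v) → (col u v ≡ blue → lab blue u ≡ lab blue v) →
                      Cell r₁ s₁ u ⊎ Cell r₂ s₂ u → Cell r₁ s₂ v ⊎ Cell r₂ s₁ v → col u v ≡ splitColour (sub u) (sub v)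
          colouring {u} {v} sameRed sameBlue cu cv = byColour (col u v) refl cu cv
            where
            byColour : ∀ c → col u v ≡ c → Cell r₁ s₁ u ⊎ Cell r₂ s₂ u → Cell r₁ s₂ v ⊎ Cell r₂ s₁ v →
                       col u v ≡ splitColour (sub u) (sub v)
            byColour red e (inj₁ (_ , bu)) (inj₁ (_ , bv)) rewrite sub-false {u} bu | sub-true {v} bv = e
            byColour red e (inj₂ (_ , bu)) (inj₂ (_ , bv)) rewrite sub-true {u} bu | sub-false {v} bv = e
            byColour red e (inj₁ (ru , _)) (inj₂ (rv , _)) = contradiction (trans (sym ru) (trans (sameRed e) rv)) r≢
            byColour red e (inj₂ (ru , _)) (inj₁ (rv , _)) = contradiction (trans (sym rv) (trans (sym (sameRed e)) ru)) r≢
            byColour blue e (inj₁ (_ , bu)) (inj₂ (_ , bv)) rewrite sub-false {u} bu | sub-false {v} bv = e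
            byColour blue e (inj₂ (_ , bu)) (inj₁ (_ , bv)) rewrite sub-true {u} bu | sub-true {v} bv = e
            byColour blue e (inj₁ (_ , bu)) (inj₁ (_ , bv)) = contradiction (trans (sym bu) (trans (sameBlue e) bv)) s≢
            byColour blue e (inj₂ (_ , bu)) (inj₂ (_ , bv)) = contradiction (trans (sym bv) (trans (sym (sameBlue e)) bu)) s≢

          kept : ∀ {u v} → Keep u v → side u ≢ side v × col u v ≡ splitColour (sub u) (sub v)
          kept {u} {v} (u∈ , v∈ , g≢ , ¬x) = go (shape u∈) (shape v∈)
            where
            sameRed : col u v ≡ red → lab red u ≡ lab red v
            sameRed e with lab red u ≟ lab red v
            ... | yes p = p
            ... | no ¬p = contradiction (inj₁ ((g≢ , e) , ¬p)) ¬x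
            sameBlue : col u v ≡ blue → lab blue u ≡ lab blue v
            sameBlue e with lab blue u ≟ lab blue v
            ... | yes p = p
            ... | no ¬p = contradiction (inj₂ ((g≢ , e) , ¬p)) ¬x
            sides : ∀ {x y} → g x ≡ g₁ → g x ≢ g y → side x ≢ side y
            sides {x} {y} e ne q = contradiction (trans (sym (does-true (g x ≟ g₁) e))
              (trans q (does-false (g y ≟ g₁) (λ e′ → ne (trans e (sym e′)))))) λ ()
            go : g u ≡ g₁ × (Cell r₁ s₁ u ⊎ Cell r₂ s₂ u) ⊎ g u ≡ g₂ × (Cell r₁ s₂ u ⊎ Cell r₂ s₁ u) →
                 g v ≡ g₁ × (Cell r₁ s₁ v ⊎ Cell r₂ s₂ v) ⊎ g v ≡ g₂ × (Cell r₁ s₂ v ⊎ Cell r₂ s₁ v) →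
                 side u ≢ side v × col u v ≡ splitColour (sub u) (sub v)
            go (inj₁ (e , _)) (inj₁ (e′ , _)) = contradiction (trans e (sym e′)) g≢
            go (inj₂ (e , _)) (inj₂ (e′ , _)) = contradiction (trans e (sym e′)) g≢
            go (inj₁ (e , cu)) (inj₂ (_ , cv)) = sides e g≢ , colouring sameRed sameBlue cu cv
            go (inj₂ (_ , cu)) (inj₁ (e , cv)) = (sides e (g≢ ∘ sym) ∘ sym) ,
              trans (col-sym u v) (trans (colouring (λ q → sym (sameRed (trans (col-sym u v) q)))
                (λ q → sym (sameBlue (trans (col-sym u v) q))) cv cu) (splitColour-sym (sub v) (sub u)))

          open Counting part fair using (countPairs≤pc; edges-lower)

          out? : ∀ v → Dec (v ∉ ys)
          out? v = ¬? (in? v)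

          out-few : cnt out? V ≤ miss
          out-few = +-cancelˡ-≤ (m + m) _ _ (≤-trans (≤-trans (≤-reflexive (+-comm (m + m) _))
            (≤-trans (+-monoʳ-≤ (cnt out? V) (≤-trans (≤-reflexive (sym len)) (length≤cnt unique)))
              (≤-reflexive (trans (+-comm (cnt out? V) _) (trans (cnt-¬ in? V) length-V))))) missing)

          Deleted : Fin n → Fin n → Set
          Deleted u v = part u ≢ part v × ¬ Keep u v

          deleted? : ∀ u v → Dec (Deleted u v)
          deleted? u v = ¬? (part u Fin.≟ part v) ×-dec ¬? (keep? u v)

          within? : ∀ u v → Dec (part u ≢ part v × g u ≡ g v)
          within? u v = ¬? (part u Fin.≟ part v) ×-dec (g u ≟ g v)

          -- The first two terms account for pairs whose first or second end is outside the core.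
          deleted-few : pc deleted? ≤ (n * miss + n * miss) + (pc within? + pc anyCross?)
          deleted-few = ≤-trans (pc-⊎ deleted? ends? rest? split) (+-mono-≤
            (≤-trans (pc-⊎ ends? (λ u v → out? u) (λ u v → out? v) (λ x → x))
              (+-mono-≤ outs (≤-trans (≤-reflexive (pc-flip (λ u v → out? u))) outs)))
            (pc-⊎ rest? within? anyCross? (λ x → x)))
            where
            ends? : ∀ u v → Dec (u ∉ ys ⊎ v ∉ ys)
            ends? u v = out? u ⊎-dec out? v
            rest? : ∀ u v → Dec _
            rest? u v = within? u v ⊎-dec anyCross? u v
            outs : pc (λ u v → out? u) ≤ n * miss
            outs = ≤-trans (≤-reflexive (trans (∑-cong V (λ u → trans (∑-const (ind (out? u)) V) (cong (_* ind (out? u)) length-V)))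
                     (∑-* n _ V))) (*-monoʳ-≤ n out-few)
            split : ∀ {u v} → Deleted u v → (u ∉ ys ⊎ v ∉ ys) ⊎ ((part u ≢ part v × g u ≡ g v) ⊎
                    ((E red u v × lab red u ≢ lab red v) ⊎ (E blue u v × lab blue u ≢ lab blue v)))
            split {u} {v} (ne , ¬k) with in? u | in? v | g u ≟ g v | anyCross? u v
            ... | no ¬u | _ | _ | _ = inj₁ (inj₁ ¬u)
            ... | yes _ | no ¬v | _ | _ = inj₁ (inj₂ ¬v)
            ... | yes _ | yes _ | yes e | _ = inj₂ (inj₁ (ne , e))
            ... | yes _ | yes _ | no _ | yes x = inj₂ (inj₂ x)
            ... | yes u∈ | yes v∈ | no g≢ | no ¬x = contradiction (u∈ , v∈ , g≢ , ¬x) ¬k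

          remove : Fin n → Fin n → Bool
          remove u v = if adjᵇ part u v then del u v else false

          remove⇒deleted : ∀ u v → remove u v ≡ true → Deleted u v
          remove⇒deleted u v e with part u Fin.≟ part v
          ... | no ne = ne , does-¬?-true (keep? u v) e

          remove-few : countPairs remove ≤ (n * miss + n * miss) + (pc within? + pc anyCross?)
          remove-few = ≤-trans (countPairs≤pc remove deleted? remove⇒deleted) deleted-few

          removal : D * countPairs remove ≤ numEdges part
          removal = close-arith {n} {numEdges part} {countPairs remove} {miss} {pc within?} {pc anyCross?}
            edges-lower miss-few inner-few anyCross-few remove-few

          isKept : ∀ u v → del u v ≡ false → Keep u v
          isKept u v e = does-¬?-false (keep? u v) e

          close : ∀ δ → Scales D δ → DeltaClose δ part col
          close δ scale = deltaClose part col D δ scale del side sub removal (λ u v e → kept (isKept u v e))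

        cycles-or-close : length typePairs ≡ K → ∀ δ → Scales D δ → Cycles ⊎ DeltaClose δ part col
        cycles-or-close |K| δ scale = go plan
          where
          go : Plan ⊎ SplitShape → Cycles ⊎ DeltaClose δ part col
          go (inj₁ p) = inj₁ (cycles p |K|)
          go (inj₂ (r₁ , r₂ , s₁ , s₂ , g₁ , g₂ , r≢ , s≢ , shape)) = inj₂ (Splitting.close r₁ r₂ s₁ s₂ g₁ g₂ r≢ s≢ shape δ scale)

      result : length typePairs ≡ K → ∀ δ → Scales D δ → Cycles ⊎ DeltaClose δ part col
      result = WithCore.cycles-or-close core

    G : Grouping part z
    G = grouping part fair n>0 z z>0

    cycles-or-close : length typePairs ≡ K → ∀ δ → Scales D δ → Cycles ⊎ DeltaClose δ part col
    cycles-or-close = WithLabels.result G (Setup.labellings part col col-sym n>0 z h z>0 G)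

open import Data.List using (length)
open import Data.Nat using (suc; s≤s; z≤n)
open import Data.Product using (_,_)
open import Data.Rational using (ℚ; Positive; _*_)
open import Data.Sum using (_⊎_; inj₁; inj₂)
open import Relation.Binary.PropositionalEquality using (refl)
open import Relation.Nullary using (contradiction)

theorem1p6 : (δ : ℚ) → Positive δ →
    Σ ℕ λ n₀ →
    (n k : ℕ) → n₀ < n → 2 ≤ k →
    (part : Fin n → Fin k) → AllClassesNonEmpty part → Fair part →
    (col : Fin n → Fin n → Colour) → Symmetric col →
    ¬ DeltaClose δ part col →
    Σ (List (Fin n)) λ R → Σ (List (Fin n)) λ B →
    MonoCycle part col red R × MonoCycle part col blue B × Disjoint R B
    × Data.Rational._≤_ (ℕtoℚ (uncovered (R ++ B))) (δ * ℕtoℚ n)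
theorem1p6 δ pos = Constants.n₀ K D K>0 D>0 , main
  where
  K D : ℕ
  K = length typePairs
  D = suc (ℚ.denominator-1 δ)
  K>0 : 0 < K
  K>0 = s≤s z≤n
  D>0 : 0 < D
  D>0 = s≤s z≤n
  main : (n k : ℕ) → Constants.n₀ K D K>0 D>0 < n → 2 ≤ k →
    (part : Fin n → Fin k) → AllClassesNonEmpty part → Fair part →
    (col : Fin n → Fin n → Colour) → Symmetric col →
    ¬ DeltaClose δ part col →
    Σ (List (Fin n)) λ R → Σ (List (Fin n)) λ B →
    MonoCycle part col red R × MonoCycle part col blue B × Disjoint R B
    × Data.Rational._≤_ (ℕtoℚ (uncovered (R ++ B))) (δ * ℕtoℚ n)
  main n k n₀<n _ part _ fair col col-sym ¬close =
    finish (Main.cycles-or-close K D K>0 D>0 n₀<n part fair col col-sym refl δ (scale-≤ δ pos))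
    where
    finish : Main.Cycles K D K>0 D>0 n₀<n part fair col col-sym ⊎ DeltaClose δ part col → _
    finish (inj₂ close) = contradiction close ¬close
    finish (inj₁ (R , B , red-cycle , blue-cycle , disjoint , few)) =
      R , B , red-cycle , blue-cycle , disjoint , scale-≤ δ pos (uncovered (R ++ B)) n few
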